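{- Let $G$ be a partial 2-tree (a graph of treewidth at most 2). Then $G$ is $X$-induced-minor-free if and only if $\mathsf{mtw}(G) \le 3$.
   Context: $X$ is the graph on vertices $u_0,\dots,u_5,u_1',u_3',u_5'$ with edges $u_0u_1,u_1u_2,u_2u_3,u_3u_4,u_4u_5,u_5u_0$ and $u_0u_1',u_1'u_2,u_2u_3',u_3'u_4,u_4u_5',u_5'u_0$ (9 vertices, 12 edges). A graph $F$ is an induced minor of $G$ if $F$ can be obtained from an induced subgraph of $G$ by contracting edges; $G$ is $F$-induced-minor-free if $F$ is not an induced minor of $G$. A tree decomposition of $G$ is a tree with bags $B(t)\subseteq V(G)$ such that every edge lies in some bag and, for each vertex, the bags containing it form a nonempty connected subtree; width is maximum bag size minus one. A bag is matched if the subgraph of $G$ induced by the bag has a perfect matching, or has a matching leaving exactly one vertex $v$ of the bag unmatched with $v$ adjacent to some matched vertex. $\mathsf{mtw}(G)$ is the minimum width of a tree decomposition all of whose bags are matched.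
   Formalization: The graph G is additionally assumed to have no isolated vertices; a graph with an isolated vertex (e.g. a single vertex) has no tree decomposition with all bags matched, so mtw(G) is undefined and the claim as stated fails. -}

module Defs where

open import Data.Nat using (ℕ; zero; suc; _≤_)
open import Data.Bool using (Bool; true; false; _∨_)
open import Data.Bool.Properties using (∨-comm)
import Data.Fin as Fin
open Fin using (Fin; toℕ)
open import Data.Fin.Subset using (Subset; _∈_; _∉_; ∣_∣)
open import Data.Maybe using (Maybe; just; nothing)
open import Data.List using (List; []; _∷_; _++_; length)
open import Data.List.Relation.Unary.Unique.Propositional using (Unique)
open import Data.List.Relation.Unary.Linked using (Linked)
open import Data.Product using (Σ; ∃; ∃-syntax; _×_; _,_)
open import Data.Unit using (⊤)
open import Relation.Nullary using (¬_)
open import Relation.Binary.PropositionalEquality using (_≡_; _≢_; refl)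

record Graph (n : ℕ) : Set where
  field
    adj    : Fin n → Fin n → Bool
    sym    : ∀ u v → adj u v ≡ adj v u
    irrefl : ∀ u → adj u u ≡ false

open Graph public

Edge : ∀ {n} → Graph n → Fin n → Fin n → Set
Edge G u v = adj G u v ≡ true

NoIsolated : ∀ {n} → Graph n → Set
NoIsolated {n} G = ∀ (u : Fin n) → ∃[ v ] Edge G u v

data PathIn {n} (G : Graph n) (P : Fin n → Set) : Fin n → Fin n → Set where
  here : ∀ {u} → P u → PathIn G P u u
  step : ∀ {u w v} → P u → Edge G u w → PathIn G P w v → PathIn G P u v

ConnectedSet : ∀ {n} → Graph n → (Fin n → Set) → Set
ConnectedSet G P = ∀ u v → P u → P v → PathIn G P u v

Connected : ∀ {n} → Graph n → Set
Connected G = ConnectedSet G (λ _ → ⊤)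

HasCycle : ∀ {n} → Graph n → Set
HasCycle {n} G =
  Σ (Fin n) λ x → Σ (List (Fin n)) λ xs →
    (2 ≤ length xs) × Unique (x ∷ xs) × Linked (Edge G) (x ∷ xs ++ x ∷ [])

IsTree : ∀ {m} → Graph m → Set
IsTree {m} T = (1 ≤ m) × Connected T × ¬ HasCycle T

record TreeDecomp {n} (G : Graph n) : Set where
  field
    m         : ℕ
    T         : Graph m
    isTree    : IsTree T
    bag       : Fin m → Subset n
    edgeCov   : ∀ u v → Edge G u v → ∃[ t ] (u ∈ bag t × v ∈ bag t)
    vertexCov : ∀ v → ∃[ t ] v ∈ bag t
    subtree   : ∀ v → ConnectedSet T (λ t → v ∈ bag t)

open TreeDecomp public

WidthAtMost : ∀ {n} {G : Graph n} → TreeDecomp G → ℕ → Set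
WidthAtMost D k = ∀ t → ∣ bag D t ∣ ≤ suc k

TwAtMost : ∀ {n} → Graph n → ℕ → Set
TwAtMost G k = Σ (TreeDecomp G) λ D → WidthAtMost D k

record MatchingIn {n} (G : Graph n) (B : Subset n) : Set where
  field
    mate      : Fin n → Maybe (Fin n)
    mate-in   : ∀ u w → mate u ≡ just w → u ∈ B × w ∈ B
    mate-edge : ∀ u w → mate u ≡ just w → Edge G u w
    mate-sym  : ∀ u w → mate u ≡ just w → mate w ≡ just u

open MatchingIn public

Covered : ∀ {n} {G : Graph n} {B : Subset n} → MatchingIn G B → Fin n → Set
Covered M u = mate M u ≢ nothing

Matched : ∀ {n} → Graph n → Subset n → Set
Matched {n} G B =
  (Σ (MatchingIn G B) λ M → ∀ u → u ∈ B → Covered M u)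
  ⊎' (Σ (MatchingIn G B) λ M → Σ (Fin n) λ v →
        v ∈ B × mate M v ≡ nothing
        × (∀ u → u ∈ B → u ≢ v → Covered M u)
        × (∃[ w ] (w ∈ B × Covered M w × Edge G v w)))
  where open import Data.Sum using () renaming (_⊎_ to _⊎'_)

MtwAtMost : ∀ {n} → Graph n → ℕ → Set
MtwAtMost G k = Σ (TreeDecomp G) λ D → WidthAtMost D k × (∀ t → Matched G (bag D t))

-- Induced minors: F is obtained from an induced subgraph G[S] by contracting
-- edges.  Encoded by φ : V(G) → V(F) ∪ {deleted}; S = φ⁻¹(V(F)); the fibres
-- φ⁻¹(x) are the (nonempty, connected) sets contracted to x, and distinct x, y
-- are adjacent in F iff some edge of G joins their fibres.

InducedMinor : ∀ {k n} → Graph k → Graph n → Set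
InducedMinor {k} {n} F G =
  Σ (Fin n → Maybe (Fin k)) λ φ →
    (∀ x → ∃[ u ] φ u ≡ just x)
    × (∀ x → ConnectedSet G (λ u → φ u ≡ just x))
    × (∀ x y → x ≢ y →
         (Edge F x y → ∃[ u ] ∃[ v ] (φ u ≡ just x × φ v ≡ just y × Edge G u v))
         × (∃[ u ] ∃[ v ] (φ u ≡ just x × φ v ≡ just y × Edge G u v) → Edge F x y))

-- The graph X.  Vertex numbering: 0..5 = u₀..u₅, 6 = u₁', 7 = u₃', 8 = u₅'.

isEX : ℕ → ℕ → Bool
isEX 0 1 = true
isEX 1 2 = true
isEX 2 3 = true
isEX 3 4 = true
isEX 4 5 = true
isEX 5 0 = true
isEX 0 6 = true
isEX 6 2 = true
isEX 2 7 = true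
isEX 7 4 = true
isEX 4 8 = true
isEX 8 0 = true
isEX _ _ = false

X : Graph 9
X = record
  { adj    = λ u v → isEX (toℕ u) (toℕ v) ∨ isEX (toℕ v) (toℕ u)
  ; sym    = λ u v → ∨-comm (isEX (toℕ u) (toℕ v)) (isEX (toℕ v) (toℕ u))
  ; irrefl = irr
  }
  where
  irr : ∀ u → isEX (toℕ u) (toℕ u) ∨ isEX (toℕ u) (toℕ u) ≡ false
  irr Fin.zero = refl
  irr (Fin.suc Fin.zero) = refl
  irr (Fin.suc (Fin.suc Fin.zero)) = refl
  irr (Fin.suc (Fin.suc (Fin.suc Fin.zero))) = refl
  irr (Fin.suc (Fin.suc (Fin.suc (Fin.suc Fin.zero)))) = refl
  irr (Fin.suc (Fin.suc (Fin.suc (Fin.suc (Fin.suc Fin.zero))))) = refl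
  irr (Fin.suc (Fin.suc (Fin.suc (Fin.suc (Fin.suc (Fin.suc Fin.zero)))))) = refl
  irr (Fin.suc (Fin.suc (Fin.suc (Fin.suc (Fin.suc (Fin.suc (Fin.suc Fin.zero))))))) = refl
  irr (Fin.suc (Fin.suc (Fin.suc (Fin.suc (Fin.suc (Fin.suc (Fin.suc (Fin.suc Fin.zero)))))))) = refl

{-# OPTIONS --safe #-}

-- If mtw G ≤ 3, note that a matched bag of at most four vertices contains no
-- three independent ones.  Helly's theorem for subtrees, applied to the branch
-- sets of two hubs of X enlarged by each of three routes between them, gives a
-- bag meeting both hubs (otherwise it meets all three routes, in independent
-- vertices); so the hubs pairwise share a bag, hence all three share one, which
-- is again impossible.
--
-- Conversely, take a tree decomposition of width 2 and root it at an independent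
-- bag {a, b, d}.  The part of G behind the pair ab either does not connect a to
-- b, or is a chain of edges of G that can be retriangulated from the apex d, or
-- contains the 4-cycle as a minor with a and b in opposite branch sets.  In the
-- first two cases the number of independent bags can be decreased; if all three
-- pairs are of the last kind, the three 4-cycles form X.  Once every bag of three
-- vertices contains an edge, a vertex c without neighbours in some bag has, at
-- the boundary of the bags where this happens, a neighbour d in the adjacent bag;
-- adding d repairs the bag, and bags never exceed four vertices.
module Submission where

open import Defs
open import Data.Nat using (ℕ; zero; suc; _+_; _∸_; _≤_; _<_; z≤n; s≤s)
open import Data.Nat.Properties using (≤-refl; ≤-reflexive; ≤-trans; <-≤-trans; <-irrefl; n≤1+n; m≤m+n; m≤n+m; m<n+m; m<m+n; +-mono-≤; +-mono-<-≤; +-mono-≤-<; +-monoˡ-<; +-monoˡ-≤; +-monoʳ-≤; +-assoc; +-comm; +-identityʳ; ∸-monoʳ-<; ∸-monoʳ-≤; +-suc; 1+n≢0; m+n≡0⇒m≡0; m+n≡0⇒n≡0; module ≤-Reasoning)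
open import Data.Nat.ListAction using (sum)
open import Data.Nat.Induction using (<-wellFounded)
open import Data.Nat.Solver using (module +-*-Solver)
open import Data.Bool using (Bool; true; false; _∨_; not; if_then_else_)
import Data.Bool.Properties as Bool
open import Data.Fin using (Fin; zero; suc)
open import Data.Fin.Patterns
open import Data.Fin.Properties using (_≟_; any?; all?; suc-injective)
open import Data.Fin.Subset using (Subset; inside; outside; ⁅_⁆; ∣_∣) renaming (_∈_ to _∈ₛ_; _∪_ to _∪ₛ_; ⊥ to ⊥ₛ)
open import Data.Fin.Subset.Properties using (x∈⁅x⁆; x∈⁅y⁆⇒x≡y; x∈p∪q⁺; x∈p∪q⁻; ∉⊥)
open import Data.Vec using ([]; _∷_; here; there)
open import Data.Maybe using (Maybe; just; nothing)
open import Data.Maybe.Properties using (just-injective; ≡-dec)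
open import Data.List using (List; []; _∷_; _++_; length; map; allFin)
open import Data.List.Properties using (length-map; length-++; map-++)
open import Data.List.Membership.Propositional using (_∈_; _∉_; find; lose)
open import Data.List.Membership.Propositional.Properties using (∈-map⁺; ∈-map⁻; ∈-++⁺ˡ; ∈-++⁺ʳ; ∈-++⁻; ∈-∃++; ∈-allFin)
import Data.List.Membership.DecPropositional as DecMembership
import Data.List.Relation.Unary.Any as Any
open Any using (Any; here; there)
open import Data.List.Relation.Unary.Any.Properties using (++⁻)
import Data.List.Relation.Unary.All as All
open All using (All; []; _∷_)
open import Data.List.Relation.Unary.All.Properties using (¬Any⇒All¬; ¬All⇒Any¬)
open import Data.List.Relation.Unary.AllPairs using ([]; _∷_)
open import Data.List.Relation.Unary.Linked using (Linked; []; [-]; _∷_; linked?)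
import Data.List.Relation.Unary.Linked.Properties as Linked
open import Data.List.Relation.Unary.Unique.Propositional using (Unique)
import Data.List.Relation.Unary.Unique.Propositional.Properties as Unique
open import Data.Product using (Σ; ∃; ∃-syntax; _×_; _,_; proj₁; proj₂)
open import Data.Sum using (_⊎_; inj₁; inj₂; [_,_]′)
import Data.Sum as Sum
open import Data.Empty using (⊥; ⊥-elim)
open import Data.Unit using (⊤; tt)
open import Function using (_∘_; id)
open import Induction.WellFounded using (Acc; acc)
open import Relation.Nullary using (¬_; Dec; yes; no)
open import Relation.Nullary.Decidable using (map′; ¬?; _×-dec_; _⊎-dec_; _→-dec_; from-yes; does; dec-true)
open import Relation.Binary.PropositionalEquality using (_≡_; _≢_; refl; cong; cong₂; subst; subst₂; module ≡-Reasoning)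
import Relation.Binary.PropositionalEquality as ≡

-- The part behind a pair `a`, `b` is a series-parallel composition: subtrees containing both
-- vertices are parallel parts, and a third vertex `d` of the root bag puts the parts behind `ad`
-- and `db` in series. The three outcomes are closed under both operations. An edge `ab` settles the
-- pair at once, so parallel composition is needed only for non-adjacent `a` and `b`; then two
-- connections have non-adjacent interiors, which with `a` and `b` form a 4-cycle. A part without
-- connection falls into two pieces that are hung elsewhere, and a series of chains is a chain. The
-- difficulty is that rebuilding a part may create independent bags, so every outcome that rebuilds
-- carries a bound on their number. The apex of a chain has to remain a variable: the vertex `d` of
-- the bag that is finally removed lies outside the part and is unknown while chains are composed.
-- Progress is strict because the bag `{a, b, d}` itself disappears. Minors must be induced, so each
-- part is also required to see all edges of `G` among its vertices.

-- Paths and connected vertex sets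

Conn : ∀ {k} → Graph k → List (Fin k) → Set
Conn G l = ConnectedSet G (_∈ l)

module _ {k : ℕ} {G : Graph k} where

  edge-sym : ∀ {u v} → Edge G u v → Edge G v u
  edge-sym {u} {v} e = ≡.trans (Defs.sym G v u) e

  edge-irrefl : ∀ {u} → ¬ Edge G u u
  edge-irrefl {u} e with () ← ≡.trans (≡.sym e) (irrefl G u)

  edge⇒≢ : ∀ {u v} → Edge G u v → u ≢ v
  edge⇒≢ e refl = edge-irrefl e

  edge? : ∀ u v → Dec (Edge G u v)
  edge? u v = adj G u v Bool.≟ true

  module _ {P : Fin k → Set} where

    path-start : ∀ {u v} → PathIn G P u v → P u
    path-start (here p)     = p
    path-start (step p _ _) = p

    path-trans : ∀ {u v w} → PathIn G P u v → PathIn G P v w → PathIn G P u w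
    path-trans (here _)     q = q
    path-trans (step p e r) q = step p e (path-trans r q)

    path-sym : ∀ {u v} → PathIn G P u v → PathIn G P v u
    path-sym (here p)     = here p
    path-sym (step p e r) =
      path-trans (path-sym r) (step (path-start r) (edge-sym e) (here p))

  path-map : ∀ {P Q : Fin k → Set} → (∀ {x} → P x → Q x) →
    ∀ {u v} → PathIn G P u v → PathIn G Q u v
  path-map f (here p)     = here (f p)
  path-map f (step p e r) = step (f p) e (path-map f r)

  conn-[_] : ∀ x → Conn G (x ∷ [])
  conn-[ x ] u v (here refl) (here refl) = here (here refl)

  conn-via : ∀ {l l′ x y} → Conn G l → Conn G l′ → x ∈ l → y ∈ l′ →
    PathIn G (_∈ l ++ l′) x y → Conn G (l ++ l′)
  conn-via {l} {l′} {x} {y} c c′ x∈ y∈ xy u v u∈ v∈ =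
    path-trans (to-x u (∈-++⁻ l u∈)) (path-sym (to-x v (∈-++⁻ l v∈)))
    where
    to-x : ∀ w → w ∈ l ⊎ w ∈ l′ → PathIn G (_∈ l ++ l′) w x
    to-x w (inj₁ w∈) = path-map ∈-++⁺ˡ (c w x w∈ x∈)
    to-x w (inj₂ w∈) = path-trans (path-map (∈-++⁺ʳ l) (c′ w y w∈ y∈)) (path-sym xy)

  conn-++ : ∀ {l l′ x} → Conn G l → Conn G l′ → x ∈ l → x ∈ l′ → Conn G (l ++ l′)
  conn-++ c c′ x∈ x∈′ = conn-via c c′ x∈ x∈′ (here (∈-++⁺ˡ x∈))

  conn-edge : ∀ {l l′ x y} → Conn G l → Conn G l′ → x ∈ l → y ∈ l′ → Edge G x y → Conn G (l ++ l′)
  conn-edge {l} c c′ x∈ y∈ e =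
    conn-via c c′ x∈ y∈ (step (∈-++⁺ˡ x∈) e (here (∈-++⁺ʳ l y∈)))

module _ {k : ℕ} where
  open DecMembership (_≟_ {k}) public using (_∈?_)

-- Pigeonhole: the head of `xs` is cut out of `ys`, and its freshness keeps the tail of `xs` inside
-- what remains.
unique-⊆-length : ∀ {A : Set} {xs ys : List A} → Unique xs →
  (∀ {v} → v ∈ xs → v ∈ ys) → length xs ≤ length ys
unique-⊆-length {xs = []}     _        _ = z≤n
unique-⊆-length {xs = x ∷ xs} (x∉ ∷ u) f with ∈-∃++ (f (here refl))
... | l , r , refl = subst (suc (length xs) ≤_) (≡.sym len) (s≤s (unique-⊆-length u g))
  where
  len : length (l ++ x ∷ r) ≡ suc (length (l ++ r))
  len = ≡.trans (length-++ l) (≡.trans (+-suc _ _) (cong suc (≡.sym (length-++ l))))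
  g : ∀ {v} → v ∈ xs → v ∈ l ++ r
  g {v} v∈ with ∈-++⁻ l (f (there v∈))
  ... | inj₁ p           = ∈-++⁺ˡ p
  ... | inj₂ (here refl) = ⊥-elim (All.lookup x∉ v∈ refl)
  ... | inj₂ (there p)   = ∈-++⁺ʳ l p

-- Tree decompositions as rooted binary trees of bags

Bag : ℕ → Set
Bag n = List (Fin n)

-- join t s connects the roots of t and s by an edge and keeps the root of t.
data Tree (n : ℕ) : Set where
  leaf : Bag n → Tree n
  join : Tree n → Tree n → Tree n

module _ {n : ℕ} where

  root : Tree n → Bag n
  root (leaf B)   = B
  root (join t _) = root t

  At : Tree n → Bag n → Set
  At (leaf B)   C = B ≡ C
  At (join t s) C = At t C ⊎ At s C

  V : Tree n → Fin n → Set
  V t v = ∃[ B ] (At t B × v ∈ B)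

  Cov : Tree n → Fin n → Fin n → Set
  Cov t u w = ∃[ B ] (At t B × u ∈ B × w ∈ B)

  covˡ : ∀ {t u w} → Cov t u w → V t u
  covˡ (B , p , u∈ , _) = B , p , u∈

  covʳ : ∀ {t u w} → Cov t u w → V t w
  covʳ (B , p , _ , w∈) = B , p , w∈

  at-root : ∀ t → At t (root t)
  at-root (leaf B)   = refl
  at-root (join t _) = inj₁ (at-root t)

  root⇒V : ∀ t {v} → v ∈ root t → V t v
  root⇒V t v∈ = root t , at-root t , v∈

  V-join⁻ : ∀ {t s v} → V (join t s) v → V t v ⊎ V s v
  V-join⁻ (B , inj₁ p , v∈) = inj₁ (B , p , v∈)
  V-join⁻ (B , inj₂ p , v∈) = inj₂ (B , p , v∈)

  V-joinˡ : ∀ {t s v} → V t v → V (join t s) v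
  V-joinˡ (B , p , v∈) = B , inj₁ p , v∈

  V-joinʳ : ∀ {t s v} → V s v → V (join t s) v
  V-joinʳ (B , p , v∈) = B , inj₂ p , v∈

  Cov-join⁻ : ∀ {t s u w} → Cov (join t s) u w → Cov t u w ⊎ Cov s u w
  Cov-join⁻ (B , inj₁ p , q) = inj₁ (B , p , q)
  Cov-join⁻ (B , inj₂ p , q) = inj₂ (B , p , q)

  Cov-joinˡ : ∀ {t s u w} → Cov t u w → Cov (join t s) u w
  Cov-joinˡ (B , p , q) = B , inj₁ p , q

  Cov-joinʳ : ∀ {t s u w} → Cov s u w → Cov (join t s) u w
  Cov-joinʳ (B , p , q) = B , inj₂ p , q

  V? : ∀ t v → Dec (V t v)
  V? (leaf B)   v = map′ (λ p → B , refl , p) (λ { (_ , refl , p) → p }) (v ∈? B)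
  V? (join t s) v = map′ [ V-joinˡ , V-joinʳ ]′ V-join⁻ (V? t v ⊎-dec V? s v)

  -- `k` bounds the size of a bag, so width 2 is `Valid 3`. Connectedness of the bags of each vertex
  -- becomes one local condition per `join`: a vertex present on both sides lies in both ends of the
  -- joining edge.
  Valid : ℕ → Tree n → Set
  Valid k (leaf B)   = Unique B × length B ≤ k
  Valid k (join t s) =
    Valid k t × Valid k s × (∀ v → V t v → V s v → v ∈ root t × v ∈ root s)

  valid-at : ∀ {k} t {B} → Valid k t → At t B → Unique B × length B ≤ k
  valid-at (leaf B)   v           refl     = v
  valid-at (join t s) (v , _ , _) (inj₁ p) = valid-at t v p
  valid-at (join t s) (_ , v , _) (inj₂ p) = valid-at s v p

  -- `join` attaches at roots only; here the proof of `At t B` is the address of the node where `s`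
  -- is hung.
  graft : (t s : Tree n) {B : Bag n} → At t B → Tree n
  graft (leaf B)     s _        = join (leaf B) s
  graft (join t₁ t₂) s (inj₁ p) = join (graft t₁ s p) t₂
  graft (join t₁ t₂) s (inj₂ p) = join t₁ (graft t₂ s p)

  module _ {s : Tree n} where

    root-graft : ∀ t {B} (p : At t B) → root (graft t s p) ≡ root t
    root-graft (leaf B)     p        = refl
    root-graft (join t₁ t₂) (inj₁ p) = root-graft t₁ p
    root-graft (join t₁ t₂) (inj₂ p) = refl

    at-graftˡ : ∀ t {B C} (p : At t B) → At t C → At (graft t s p) C
    at-graftˡ (leaf B)     p        q        = inj₁ q
    at-graftˡ (join t₁ t₂) (inj₁ p) (inj₁ q) = inj₁ (at-graftˡ t₁ p q)
    at-graftˡ (join t₁ t₂) (inj₁ p) (inj₂ q) = inj₂ q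
    at-graftˡ (join t₁ t₂) (inj₂ p) (inj₁ q) = inj₁ q
    at-graftˡ (join t₁ t₂) (inj₂ p) (inj₂ q) = inj₂ (at-graftˡ t₂ p q)

    at-graftʳ : ∀ t {B C} (p : At t B) → At s C → At (graft t s p) C
    at-graftʳ (leaf B)     p        q = inj₂ q
    at-graftʳ (join t₁ t₂) (inj₁ p) q = inj₁ (at-graftʳ t₁ p q)
    at-graftʳ (join t₁ t₂) (inj₂ p) q = inj₂ (at-graftʳ t₂ p q)

    at-graft⁻ : ∀ t {B C} (p : At t B) → At (graft t s p) C → At t C ⊎ At s C
    at-graft⁻ (leaf B)     p        q        = q
    at-graft⁻ (join t₁ t₂) (inj₁ p) (inj₁ q) = Sum.map inj₁ id (at-graft⁻ t₁ p q)
    at-graft⁻ (join t₁ t₂) (inj₁ p) (inj₂ q) = inj₁ (inj₂ q)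
    at-graft⁻ (join t₁ t₂) (inj₂ p) (inj₁ q) = inj₁ (inj₁ q)
    at-graft⁻ (join t₁ t₂) (inj₂ p) (inj₂ q) = Sum.map inj₂ id (at-graft⁻ t₂ p q)

    V-graft⁻ : ∀ t {B v} (p : At t B) → V (graft t s p) v → V t v ⊎ V s v
    V-graft⁻ t p (C , q , v∈) = Sum.map (λ r → C , r , v∈) (λ r → C , r , v∈) (at-graft⁻ t p q)

    Cov-graftˡ : ∀ t {B u w} (p : At t B) → Cov t u w → Cov (graft t s p) u w
    Cov-graftˡ t p (C , q , r) = C , at-graftˡ t p q , r

    Cov-graftʳ : ∀ t {B u w} (p : At t B) → Cov s u w → Cov (graft t s p) u w
    Cov-graftʳ t p (C , q , r) = C , at-graftʳ t p q , r

    -- A vertex of `s` that also occurs in the other half of a join lies in `B` by `h`, hence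
    -- already in the half that receives `s`; the old adhesion condition then applies to it.
    valid-graft : ∀ {k} t {B} → Valid k t → Valid k s → (p : At t B) →
      (∀ v → V t v → V s v → v ∈ B × v ∈ root s) → Valid k (graft t s p)
    valid-graft (leaf B)     vt             vs refl     h = vt , vs , h
    valid-graft (join t₁ t₂) {B} (v₁ , v₂ , a) vs (inj₁ p) h =
      valid-graft t₁ v₁ vs p (λ v x → h v (V-joinˡ x)) , v₂ , λ v x y →
        subst (λ r → v ∈ r × _) (≡.sym (root-graft t₁ p))
          ([ (λ x₁ → a v x₁ y)
           , (λ xₛ → a v (B , p , proj₁ (h v (V-joinʳ y) xₛ)) y) ]′ (V-graft⁻ t₁ p x))
    valid-graft (join t₁ t₂) {B} (v₁ , v₂ , a) vs (inj₂ p) h =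
      v₁ , valid-graft t₂ v₂ vs p (λ v x → h v (V-joinʳ x)) , λ v x y →
        subst (λ r → _ × v ∈ r) (≡.sym (root-graft t₂ p))
          ([ (λ y₂ → a v x y₂)
           , (λ yₛ → a v x (B , p , proj₁ (h v (V-joinˡ x) yₛ))) ]′ (V-graft⁻ t₂ p y))

-- Counting independent bags, rerooting, and splitting a tree at a root triple

module Surgery {n : ℕ} (G : Graph n) where

  E : Fin n → Fin n → Set
  E = Edge G

  esym : ∀ {u v} → E u v → E v u
  esym = edge-sym {G = G}

  -- The reflexive closure of adjacency, so that one covering condition speaks of vertices and edges
  -- alike.
  Rel : Fin n → Fin n → Set
  Rel u w = u ≡ w ⊎ E u w

  -- Is 1 exactly for the independent bags of three vertices; larger bags do not occur.
  bad : Bag n → ℕ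
  bad (a ∷ b ∷ c ∷ _) = if adj G a b ∨ (adj G b c ∨ adj G c a) then 0 else 1
  bad _               = 0

  zeros : Tree n → ℕ
  zeros (leaf B)   = bad B
  zeros (join t s) = zeros t + zeros s

  zeros-graft : ∀ t {s B} (p : At t B) → zeros (graft t s p) ≡ zeros t + zeros s
  zeros-graft (leaf B)     p        = refl
  zeros-graft (join t₁ t₂) {s} (inj₁ p) = begin
    zeros (graft t₁ s p) + zeros t₂   ≡⟨ cong (_+ zeros t₂) (zeros-graft t₁ p) ⟩
    (zeros t₁ + zeros s) + zeros t₂   ≡⟨ solve 3 (λ x y z → (x :+ y) :+ z := (x :+ z) :+ y) refl (zeros t₁) (zeros s) (zeros t₂) ⟩
    (zeros t₁ + zeros t₂) + zeros s   ∎
    where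
    open ≡-Reasoning
    open +-*-Solver
  zeros-graft (join t₁ t₂) {s} (inj₂ p) =
    ≡.trans (cong (zeros t₁ +_) (zeros-graft t₂ p)) (≡.sym (+-assoc (zeros t₁) _ _))

  record Reroot (k : ℕ) (t : Tree n) (B : Bag n) : Set where
    field
      tree  : Tree n
      valid : Valid k tree
      root≡ : root tree ≡ B
      at⁺   : ∀ {C} → At t C → At tree C
      at⁻   : ∀ {C} → At tree C → At t C
      zeros≡ : zeros tree ≡ zeros t

    V⁻ : ∀ {v} → V tree v → V t v
    V⁻ (C , p , q) = C , at⁻ p , q

    Cov⁺ : ∀ {u w} → Cov t u w → Cov tree u w
    Cov⁺ (C , p , q) = C , at⁺ p , q

  -- The half holding `B` is rerooted at `B`, and the other half is grafted back at the bag to which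
  -- the joining edge led, so the underlying tree stays the same.
  reroot : ∀ {k} t {B} → Valid k t → At t B → Reroot k t B
  reroot (leaf B) v refl = record
    { tree = leaf B ; valid = v ; root≡ = refl ; at⁺ = id ; at⁻ = id ; zeros≡ = refl }
  reroot (join t₁ t₂) (v₁ , v₂ , a) (inj₁ p) = record
    { tree = graft tree t₂ q
    ; valid = valid-graft tree valid v₂ q λ v x y → a v (V⁻ x) y
    ; root≡ = ≡.trans (root-graft tree q) root≡
    ; at⁺ = [ at-graftˡ tree q ∘ at⁺ , at-graftʳ tree q ]′
    ; at⁻ = Sum.map at⁻ id ∘ at-graft⁻ tree q
    ; zeros≡ = ≡.trans (zeros-graft tree q) (cong (_+ zeros t₂) zeros≡)
    }
    where
    open Reroot (reroot t₁ v₁ p)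
    q : At tree (root t₁)
    q = at⁺ (at-root t₁)
  reroot (join t₁ t₂) (v₁ , v₂ , a) (inj₂ p) = record
    { tree = graft tree t₁ q
    ; valid = valid-graft tree valid v₁ q λ v x y → let (c , d) = a v y (V⁻ x) in d , c
    ; root≡ = ≡.trans (root-graft tree q) root≡
    ; at⁺ = [ at-graftʳ tree q , at-graftˡ tree q ∘ at⁺ ]′
    ; at⁻ = Sum.swap ∘ Sum.map at⁻ id ∘ at-graft⁻ tree q
    ; zeros≡ = ≡.trans (zeros-graft tree q) (≡.trans (cong (_+ zeros t₁) zeros≡) (+-comm (zeros t₂) _))
    }
    where
    open Reroot (reroot t₂ v₂ p)
    q : At tree (root t₂)
    q = at⁺ (at-root t₂)

  -- Bag sizes count besides the number of bags: splitting a single bag of three vertices yields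
  -- single bags of two, and this has to be a decrease as well.
  weight : Tree n → ℕ
  weight (leaf B)   = suc (length B)
  weight (join t s) = weight t + weight s

  weight-pos : ∀ t → 0 < weight t
  weight-pos (leaf B)   = s≤s z≤n
  weight-pos (join t s) = <-≤-trans (weight-pos t) (m≤m+n _ _)

  Only : Fin n → Fin n → Fin n → Bag n → Set
  Only a b d B = ∀ {v} → v ∈ B → v ≡ a ⊎ v ≡ b ⊎ v ≡ d

  -- A further vertex would make four distinct members of a list of length at most 3.
  only : ∀ {a b d B} → length B ≤ 3 → a ∈ B → b ∈ B → d ∈ B →
    a ≢ b → b ≢ d → d ≢ a → Only a b d B
  only {a} {b} {d} {B} len a∈ b∈ d∈ a≢b b≢d d≢a {v} v∈ with v ≟ a | v ≟ b | v ≟ d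
  ... | yes p | _     | _     = inj₁ p
  ... | _     | yes p | _     = inj₂ (inj₁ p)
  ... | _     | _     | yes p = inj₂ (inj₂ p)
  ... | no v≢a | no v≢b | no v≢d = ⊥-elim (<-irrefl refl (≤-trans (unique-⊆-length {xs = v ∷ a ∷ b ∷ d ∷ []} u f) len))
    where
    u : Unique (v ∷ a ∷ b ∷ d ∷ [])
    u = (v≢a ∷ v≢b ∷ v≢d ∷ []) ∷ (a≢b ∷ (d≢a ∘ ≡.sym) ∷ []) ∷ (b≢d ∷ []) ∷ [] ∷ []
    f : ∀ {x} → x ∈ v ∷ a ∷ b ∷ d ∷ [] → x ∈ B
    f (here refl) = v∈
    f (there (here refl)) = a∈
    f (there (there (here refl))) = b∈
    f (there (there (there (here refl)))) = d∈

  -- The three parts of a tree rooted at {a, b, d}, hanging from the pairs ab, bd and da.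
  record Split (t : Tree n) (a b d : Fin n) : Set where
    field
      ab bd da : Tree n
      v-ab : Valid 3 ab
      v-bd : Valid 3 bd
      v-da : Valid 3 da
      r-ab : root ab ≡ a ∷ b ∷ []
      r-bd : root bd ≡ b ∷ d ∷ []
      r-da : root da ≡ d ∷ a ∷ []
      s-ab : ∀ {v} → V ab v → V t v
      s-bd : ∀ {v} → V bd v → V t v
      s-da : ∀ {v} → V da v → V t v
      i-a : ∀ {v} → V da v → V ab v → v ≡ a
      i-b : ∀ {v} → V ab v → V bd v → v ≡ b
      i-d : ∀ {v} → V bd v → V da v → v ≡ d
      cov : ∀ {u w} → Cov t u w → Cov ab u w ⊎ Cov bd u w ⊎ Cov da u w
      cnt : bad (root t) + (zeros ab + (zeros bd + zeros da)) ≤ zeros t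
      w-ab : weight ab < weight t
      w-bd : weight bd < weight t
      w-da : weight da < weight t

    ab∋a : V ab a
    ab∋a = root⇒V ab (subst (a ∈_) (≡.sym r-ab) (here refl))

    ab∋b : V ab b
    ab∋b = root⇒V ab (subst (b ∈_) (≡.sym r-ab) (there (here refl)))

  rotate : ∀ {t a b d} → Split t a b d → Split t b d a
  rotate {t} S = record
    { ab = bd ; bd = da ; da = ab
    ; v-ab = v-bd ; v-bd = v-da ; v-da = v-ab
    ; r-ab = r-bd ; r-bd = r-da ; r-da = r-ab
    ; s-ab = s-bd ; s-bd = s-da ; s-da = s-ab
    ; i-a = i-b ; i-b = i-d ; i-d = i-a
    ; cov = λ c → [ inj₂ ∘ inj₂ , [ inj₁ , inj₂ ∘ inj₁ ]′ ]′ (cov c)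
    ; cnt = subst (λ z → bad (root t) + z ≤ zeros t)
        (solve 3 (λ x y z → x :+ (y :+ z) := y :+ (z :+ x)) refl (zeros ab) (zeros bd) (zeros da)) cnt
    ; w-ab = w-bd ; w-bd = w-da ; w-da = w-ab
    }
    where
    open Split S
    open +-*-Solver

  split-∌ : ∀ {t a b d} → b ≢ d → (S : Split t a b d) → ¬ V (Split.ab S) d
  split-∌ b≢d S x = b≢d (≡.sym (i-b x (root⇒V bd (subst (_ ∈_) (≡.sym r-bd) (there (here refl))))))
    where
    open Split S

  module _ {a b d : Fin n} (a≢b : a ≢ b) (b≢d : b ≢ d) (d≢a : d ≢ a) where

    private
      len : ∀ {B} → a ∈ B → b ∈ B → d ∈ B → 3 ≤ length B
      len {B} a∈ b∈ d∈ = unique-⊆-length {xs = a ∷ b ∷ d ∷ []}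
        ((a≢b ∷ (d≢a ∘ ≡.sym) ∷ []) ∷ (b≢d ∷ []) ∷ [] ∷ []) λ where
          (here refl) → a∈
          (there (here refl)) → b∈
          (there (there (here refl))) → d∈

      pair : ∀ {x y : Fin n} → x ≢ y → Valid 3 (leaf (x ∷ y ∷ []))
      pair x≢y = ((x≢y ∷ []) ∷ [] ∷ []) , s≤s (s≤s z≤n)

      common : ∀ {x y z v : Fin n} → y ≢ z → v ∈ z ∷ x ∷ [] → v ∈ x ∷ y ∷ [] → v ≡ x
      common _ (there (here p)) _ = p
      common _ (here refl) (here p) = p
      common y≢z (here refl) (there (here refl)) = ⊥-elim (y≢z refl)

    split-leaf : ∀ {B} → length B ≤ 3 → a ∈ B → b ∈ B → d ∈ B → Split (leaf B) a b d
    split-leaf {B} len≤ a∈ b∈ d∈ = record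
      { ab = leaf (a ∷ b ∷ []) ; bd = leaf (b ∷ d ∷ []) ; da = leaf (d ∷ a ∷ [])
      ; v-ab = pair a≢b ; v-bd = pair b≢d ; v-da = pair d≢a
      ; r-ab = refl ; r-bd = refl ; r-da = refl
      ; s-ab = λ { (_ , refl , here refl) → B , refl , a∈ ; (_ , refl , there (here refl)) → B , refl , b∈ }
      ; s-bd = λ { (_ , refl , here refl) → B , refl , b∈ ; (_ , refl , there (here refl)) → B , refl , d∈ }
      ; s-da = λ { (_ , refl , here refl) → B , refl , d∈ ; (_ , refl , there (here refl)) → B , refl , a∈ }
      ; i-a = λ { (_ , refl , p) (_ , refl , q) → common b≢d p q }
      ; i-b = λ { (_ , refl , p) (_ , refl , q) → common d≢a p q }
      ; i-d = λ { (_ , refl , p) (_ , refl , q) → common a≢b p q }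
      ; cov = λ { (_ , refl , u∈ , w∈) → pairs (only len≤ a∈ b∈ d∈ a≢b b≢d d≢a u∈) (only len≤ a∈ b∈ d∈ a≢b b≢d d≢a w∈) }
      ; cnt = ≤-reflexive (+-identityʳ _)
      ; w-ab = s≤s (len a∈ b∈ d∈) ; w-bd = s≤s (len a∈ b∈ d∈) ; w-da = s≤s (len a∈ b∈ d∈)
      }
      where
      pairs : ∀ {u w} → u ≡ a ⊎ u ≡ b ⊎ u ≡ d → w ≡ a ⊎ w ≡ b ⊎ w ≡ d →
        Cov (leaf (a ∷ b ∷ [])) u w ⊎ Cov (leaf (b ∷ d ∷ [])) u w ⊎ Cov (leaf (d ∷ a ∷ [])) u w
      pairs (inj₁ refl) (inj₁ refl) = inj₁ (_ , refl , here refl , here refl)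
      pairs (inj₁ refl) (inj₂ (inj₁ refl)) = inj₁ (_ , refl , here refl , there (here refl))
      pairs (inj₁ refl) (inj₂ (inj₂ refl)) = inj₂ (inj₂ (_ , refl , there (here refl) , here refl))
      pairs (inj₂ (inj₁ refl)) (inj₁ refl) = inj₁ (_ , refl , there (here refl) , here refl)
      pairs (inj₂ (inj₁ refl)) (inj₂ (inj₁ refl)) = inj₁ (_ , refl , there (here refl) , there (here refl))
      pairs (inj₂ (inj₁ refl)) (inj₂ (inj₂ refl)) = inj₂ (inj₁ (_ , refl , here refl , there (here refl)))
      pairs (inj₂ (inj₂ refl)) (inj₁ refl) = inj₂ (inj₂ (_ , refl , here refl , there (here refl)))
      pairs (inj₂ (inj₂ refl)) (inj₂ (inj₁ refl)) = inj₂ (inj₁ (_ , refl , there (here refl) , here refl))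
      pairs (inj₂ (inj₂ refl)) (inj₂ (inj₂ refl)) = inj₂ (inj₂ (_ , refl , here refl , here refl))

  -- Since `t₂` misses `d`, everything it shares with `t₁` is `a` or `b`, and all of `t₂` can go
  -- behind the pair `ab`.
  split-attach : ∀ {a b d t₁ t₂} → a ≢ b → b ≢ d → d ≢ a → Only a b d (root t₁) →
    Valid 3 (join t₁ t₂) → Split t₁ a b d → ¬ V t₂ d → Split (join t₁ t₂) a b d
  split-attach {a} {b} {d} {t₁} {t₂} a≢b b≢d d≢a sub (_ , v₂ , adh) S d∉ = record
    { ab = join ab t₂ ; bd = bd ; da = da
    ; v-ab = v-ab , v₂ , λ v x y →
        subst (v ∈_) (≡.sym r-ab) (in-ab (s-ab x) y) , proj₂ (adh v (s-ab x) y)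
    ; v-bd = v-bd ; v-da = v-da
    ; r-ab = r-ab ; r-bd = r-bd ; r-da = r-da
    ; s-ab = [ V-joinˡ ∘ s-ab , V-joinʳ ]′ ∘ V-join⁻
    ; s-bd = V-joinˡ ∘ s-bd ; s-da = V-joinˡ ∘ s-da
    ; i-a = λ x y → [ i-a x , (λ z → meet-a x (in-ab (s-da x) z)) ]′ (V-join⁻ y)
    ; i-b = λ y x → [ (λ z → i-b z x) , (λ z → meet-b x (in-ab (s-bd x) z)) ]′ (V-join⁻ y)
    ; i-d = i-d
    ; cov = λ c → [ Sum.map Cov-joinˡ id ∘ cov , inj₁ ∘ Cov-joinʳ ]′ (Cov-join⁻ c)
    ; cnt = begin
        bad (root t₁) + ((zeros ab + zeros t₂) + (zeros bd + zeros da))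
          ≡⟨ solve 5 (λ r x y z w → r :+ ((x :+ w) :+ (y :+ z)) := (r :+ (x :+ (y :+ z))) :+ w)
               refl (bad (root t₁)) (zeros ab) (zeros bd) (zeros da) (zeros t₂) ⟩
        (bad (root t₁) + (zeros ab + (zeros bd + zeros da))) + zeros t₂
          ≤⟨ +-monoˡ-≤ (zeros t₂) cnt ⟩
        zeros t₁ + zeros t₂ ∎
    ; w-ab = +-monoˡ-< (weight t₂) w-ab
    ; w-bd = <-≤-trans w-bd (m≤m+n _ _)
    ; w-da = <-≤-trans w-da (m≤m+n _ _)
    }
    where
    open Split S
    open ≤-Reasoning
    open +-*-Solver
    in-ab : ∀ {v} → V t₁ v → V t₂ v → v ∈ a ∷ b ∷ []
    in-ab {v} x y with sub (proj₁ (adh v x y))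
    ... | inj₁ refl        = here refl
    ... | inj₂ (inj₁ refl) = there (here refl)
    ... | inj₂ (inj₂ refl) = ⊥-elim (d∉ y)
    meet-a : ∀ {v} → V da v → v ∈ a ∷ b ∷ [] → v ≡ a
    meet-a x (here p)            = p
    meet-a x (there (here refl)) = ⊥-elim (split-∌ a≢b (rotate (rotate S)) x)
    meet-b : ∀ {v} → V bd v → v ∈ a ∷ b ∷ [] → v ≡ b
    meet-b x (here refl)      = ⊥-elim (split-∌ d≢a (rotate S) x)
    meet-b x (there (here p)) = p

  -- Both sides are split along the same triple and corresponding parts are joined. Only corners are
  -- common to `t₁` and `t₂`, which settles every mixed intersection.
  split-merge : ∀ {a b d t₁ t₂} → a ≢ b → b ≢ d → d ≢ a → Only a b d (root t₁) →
    Valid 3 (join t₁ t₂) → Split t₁ a b d → Split t₂ a b d → Split (join t₁ t₂) a b d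
  split-merge {a} {b} {d} {t₁} {t₂} a≢b b≢d d≢a sub (_ , _ , adh) S S′ = record
    { ab = join S.ab S′.ab ; bd = join S.bd S′.bd ; da = join S.da S′.da
    ; v-ab = S.v-ab , S′.v-ab , λ v x y → both S.r-ab S′.r-ab (in-xy S b≢d (corner (S.s-ab x) (S′.s-ab y)) x)
    ; v-bd = S.v-bd , S′.v-bd , λ v x y → both S.r-bd S′.r-bd
        (in-xy (rotate S) d≢a (turn (corner (S.s-bd x) (S′.s-bd y))) x)
    ; v-da = S.v-da , S′.v-da , λ v x y → both S.r-da S′.r-da
        (in-xy (rotate (rotate S)) a≢b (turn (turn (corner (S.s-da x) (S′.s-da y)))) x)
    ; r-ab = S.r-ab ; r-bd = S.r-bd ; r-da = S.r-da
    ; s-ab = [ V-joinˡ ∘ S.s-ab , V-joinʳ ∘ S′.s-ab ]′ ∘ V-join⁻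
    ; s-bd = [ V-joinˡ ∘ S.s-bd , V-joinʳ ∘ S′.s-bd ]′ ∘ V-join⁻
    ; s-da = [ V-joinˡ ∘ S.s-da , V-joinʳ ∘ S′.s-da ]′ ∘ V-join⁻
    ; i-a = λ x y → meet S.i-a S′.i-a
        (λ p q → mix (rotate (rotate S)) (rotate (rotate S′)) a≢b b≢d (turn (turn (corner (S.s-da p) (S′.s-ab q)))) p q)
        (λ p q → mix (rotate (rotate S′)) (rotate (rotate S)) a≢b b≢d (turn (turn (corner (S.s-ab q) (S′.s-da p)))) p q)
        (V-join⁻ x) (V-join⁻ y)
    ; i-b = λ x y → meet S.i-b S′.i-b
        (λ p q → mix S S′ b≢d d≢a (corner (S.s-ab p) (S′.s-bd q)) p q)
        (λ p q → mix S′ S b≢d d≢a (corner (S.s-bd q) (S′.s-ab p)) p q)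
        (V-join⁻ x) (V-join⁻ y)
    ; i-d = λ x y → meet S.i-d S′.i-d
        (λ p q → mix (rotate S) (rotate S′) d≢a a≢b (turn (corner (S.s-bd p) (S′.s-da q))) p q)
        (λ p q → mix (rotate S′) (rotate S) d≢a a≢b (turn (corner (S.s-da q) (S′.s-bd p))) p q)
        (V-join⁻ x) (V-join⁻ y)
    ; cov = λ c → [ Sum.map Cov-joinˡ (Sum.map Cov-joinˡ Cov-joinˡ) ∘ S.cov
                  , Sum.map Cov-joinʳ (Sum.map Cov-joinʳ Cov-joinʳ) ∘ S′.cov ]′ (Cov-join⁻ c)
    ; cnt = begin
        bad (root t₁) + ((zeros S.ab + zeros S′.ab) + ((zeros S.bd + zeros S′.bd) + (zeros S.da + zeros S′.da)))
          ≡⟨ solve 7 (λ r x y z x′ y′ z′ → r :+ ((x :+ x′) :+ ((y :+ y′) :+ (z :+ z′)))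
                       := (r :+ (x :+ (y :+ z))) :+ (x′ :+ (y′ :+ z′)))
               refl (bad (root t₁)) (zeros S.ab) (zeros S.bd) (zeros S.da) (zeros S′.ab) (zeros S′.bd) (zeros S′.da) ⟩
        (bad (root t₁) + (zeros S.ab + (zeros S.bd + zeros S.da))) + (zeros S′.ab + (zeros S′.bd + zeros S′.da))
          -- The root bag of `t₂` vanishes too; its possible contribution is dropped on the smaller
          -- side.
          ≤⟨ +-mono-≤ S.cnt (≤-trans (m≤n+m _ (bad (root t₂))) S′.cnt) ⟩
        zeros t₁ + zeros t₂ ∎
    ; w-ab = +-mono-<-≤ S.w-ab (≤-trans (n≤1+n _) S′.w-ab)
    ; w-bd = +-mono-<-≤ S.w-bd (≤-trans (n≤1+n _) S′.w-bd)
    ; w-da = +-mono-<-≤ S.w-da (≤-trans (n≤1+n _) S′.w-da)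
    }
    where
    module S = Split S
    module S′ = Split S′
    open ≤-Reasoning
    open +-*-Solver
    corner : ∀ {v} → V t₁ v → V t₂ v → v ≡ a ⊎ v ≡ b ⊎ v ≡ d
    corner {v} x y = sub (proj₁ (adh v x y))
    turn : ∀ {v x y z : Fin n} → v ≡ x ⊎ v ≡ y ⊎ v ≡ z → v ≡ y ⊎ v ≡ z ⊎ v ≡ x
    turn = [ inj₂ ∘ inj₂ , [ inj₁ , inj₂ ∘ inj₁ ]′ ]′
    in-xy : ∀ {x y z t} (R : Split t x y z) → y ≢ z → ∀ {v} →
      v ≡ x ⊎ v ≡ y ⊎ v ≡ z → V (Split.ab R) v → v ∈ x ∷ y ∷ []
    in-xy R y≢z (inj₁ p)           _ = here p
    in-xy R y≢z (inj₂ (inj₁ p))    _ = there (here p)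
    in-xy R y≢z (inj₂ (inj₂ refl)) x = ⊥-elim (split-∌ y≢z R x)
    both : ∀ {r r′ s : Bag n} → r ≡ s → r′ ≡ s → ∀ {v} → v ∈ s → v ∈ r × v ∈ r′
    both refl refl v∈ = v∈ , v∈
    mix : ∀ {x y z t t′} (R : Split t x y z) (R′ : Split t′ x y z) → y ≢ z → z ≢ x → ∀ {v} →
      v ≡ x ⊎ v ≡ y ⊎ v ≡ z → V (Split.ab R) v → V (Split.bd R′) v → v ≡ y
    mix R R′ y≢z z≢x (inj₁ refl)        p q = ⊥-elim (split-∌ z≢x (rotate R′) q)
    mix R R′ y≢z z≢x (inj₂ (inj₁ eq))   p q = eq
    mix R R′ y≢z z≢x (inj₂ (inj₂ refl)) p q = ⊥-elim (split-∌ y≢z R p)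
    meet : ∀ {v x : Fin n} {A A′ B B′ : Set} → (A → B → v ≡ x) → (A′ → B′ → v ≡ x) →
      (A → B′ → v ≡ x) → (A′ → B → v ≡ x) → A ⊎ A′ → B ⊎ B′ → v ≡ x
    meet f g h k (inj₁ x) (inj₁ y) = f x y
    meet f g h k (inj₁ x) (inj₂ y) = h x y
    meet f g h k (inj₂ x) (inj₁ y) = k x y
    meet f g h k (inj₂ x) (inj₂ y) = g x y

  -- A subtree missing one of the three vertices hangs behind the pair of the other two. A subtree
  -- with all three has them in its root by adhesion and is split recursively.
  split : ∀ {a b d} → a ≢ b → b ≢ d → d ≢ a → ∀ t → Valid 3 t →
    a ∈ root t → b ∈ root t → d ∈ root t → Split t a b d
  split a≢b b≢d d≢a (leaf B) (_ , l) a∈ b∈ d∈ = split-leaf a≢b b≢d d≢a l a∈ b∈ d∈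
  split {a} {b} {d} a≢b b≢d d≢a (join t₁ t₂) v@(v₁ , v₂ , adh) a∈ b∈ d∈
    with V? t₂ a | V? t₂ b | V? t₂ d
  ... | _ | _ | no d∉ = split-attach a≢b b≢d d≢a sub v (split a≢b b≢d d≢a t₁ v₁ a∈ b∈ d∈) d∉
    where
    sub : Only a b d (root t₁)
    sub = only (proj₂ (valid-at t₁ v₁ (at-root t₁))) a∈ b∈ d∈ a≢b b≢d d≢a
  ... | no a∉ | _ | _ = rotate (rotate
      (split-attach b≢d d≢a a≢b sub v (split b≢d d≢a a≢b t₁ v₁ b∈ d∈ a∈) a∉))
    where
    sub : Only b d a (root t₁)
    sub = only (proj₂ (valid-at t₁ v₁ (at-root t₁))) b∈ d∈ a∈ b≢d d≢a a≢b
  ... | _ | no b∉ | _ = rotate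
      (split-attach d≢a a≢b b≢d sub v (split d≢a a≢b b≢d t₁ v₁ d∈ a∈ b∈) b∉)
    where
    sub : Only d a b (root t₁)
    sub = only (proj₂ (valid-at t₁ v₁ (at-root t₁))) d∈ a∈ b∈ d≢a a≢b b≢d
  ... | yes a∈₂ | yes b∈₂ | yes d∈₂ = split-merge a≢b b≢d d≢a sub v
      (split a≢b b≢d d≢a t₁ v₁ a∈ b∈ d∈)
      (split a≢b b≢d d≢a t₂ v₂ (up a∈ a∈₂) (up b∈ b∈₂) (up d∈ d∈₂))
    where
    sub : Only a b d (root t₁)
    sub = only (proj₂ (valid-at t₁ v₁ (at-root t₁))) a∈ b∈ d∈ a≢b b≢d d≢a
    up : ∀ {x} → x ∈ root t₁ → V t₂ x → x ∈ root t₂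
    up {x} x∈ y = proj₂ (adh x (root⇒V t₁ x∈) y)

-- How two vertices of a bag are joined in the part behind them

-- The vertices of a 4-cycle: the two `end`s are opposite to each other, and so are the two `mid`s.
data Role : Set where
  end mid : Bool → Role

module Classification {n : ℕ} (G : Graph n) where

  open Surgery G

  -- The interior of a connection from `a` to `b`, kept as one connected set so that it can serve as
  -- a branch set.
  record Mid (U : Fin n → Set) (a b : Fin n) : Set where
    field
      set  : List (Fin n)
      conn : Conn G set
      a∉   : a ∉ set
      b∉   : b ∉ set
      sub  : ∀ {u} → u ∈ set → U u
      to-a : ∃[ u ] (u ∈ set × E a u)
      to-b : ∃[ u ] (u ∈ set × E b u)

  Link : (Fin n → Set) → Fin n → Fin n → Set
  Link U a b = E a b ⊎ Mid U a b

  link-map : ∀ {U U′ : Fin n → Set} {a b} → (∀ {u} → U u → U′ u) → Link U a b → Link U′ a b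
  link-map f (inj₁ e) = inj₁ e
  link-map f (inj₂ M) = inj₂ record
    { set = set ; conn = conn ; a∉ = a∉ ; b∉ = b∉ ; sub = f ∘ sub ; to-a = to-a ; to-b = to-b }
    where
    open Mid M

  link-flip : ∀ {U a b} → Link U a b → Link U b a
  link-flip (inj₁ e) = inj₁ (esym e)
  link-flip (inj₂ M) = inj₂ record
    { set = set ; conn = conn ; a∉ = b∉ ; b∉ = a∉ ; sub = sub ; to-a = to-b ; to-b = to-a }
    where
    open Mid M

  link⇒mid : ∀ {U a b} → ¬ E a b → Link U a b → Mid U a b
  link⇒mid ¬e (inj₁ e) = ⊥-elim (¬e e)
  link⇒mid ¬e (inj₂ M) = M

  -- A connection from `a` to `d` with `a` removed and `d` kept; two arms meeting in `d` make up a
  -- `Mid`.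
  record Arm (U : Fin n → Set) (a d : Fin n) : Set where
    field
      set  : List (Fin n)
      conn : Conn G set
      d∈   : d ∈ set
      a∉   : a ∉ set
      sub  : ∀ {u} → u ∈ set → U u
      to-a : ∃[ u ] (u ∈ set × E a u)

  arm : ∀ {U a d} → a ≢ d → U d → Link U a d → Arm U a d
  arm {d = d} a≢d Ud (inj₁ e) = record
    { set = d ∷ [] ; conn = conn-[ d ] ; d∈ = here refl
    ; a∉ = λ { (here p) → a≢d p } ; sub = λ { (here refl) → Ud } ; to-a = d , here refl , e }
  arm {d = d} a≢d Ud (inj₂ M) = record
    { set = set ++ d ∷ []
    ; conn = conn-edge conn conn-[ d ] (proj₁ (proj₂ to-b)) (here refl) (esym (proj₂ (proj₂ to-b)))
    ; d∈ = ∈-++⁺ʳ set (here refl)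
    ; a∉ = λ p → [ a∉ , (λ { (here q) → a≢d q }) ]′ (∈-++⁻ set p)
    ; sub = λ p → [ sub , (λ { (here refl) → Ud }) ]′ (∈-++⁻ set p)
    ; to-a = let (u , u∈ , e) = to-a in u , ∈-++⁺ˡ u∈ , e
    }
    where
    open Mid M

  -- An induced-minor model of the 4-cycle with a and b in opposite branch sets.
  record Square (U : Fin n → Set) (a b : Fin n) : Set where
    field
      set  : Role → List (Fin n)
      conn : ∀ r → Conn G (set r)
      sub  : ∀ r {u} → u ∈ set r → U u
      disj : ∀ r r′ {u} → u ∈ set r → u ∈ set r′ → r ≡ r′
      link : ∀ i j → ∃[ u ] ∃[ w ] (u ∈ set (end i) × w ∈ set (mid j) × E u w)
      apart-end : ∀ {u w} → u ∈ set (end false) → w ∈ set (end true) → ¬ E u w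
      apart-mid : ∀ {u w} → u ∈ set (mid false) → w ∈ set (mid true) → ¬ E u w
      a∈ : a ∈ set (end false)
      b∈ : b ∈ set (end true)

  square-map : ∀ {U U′ : Fin n → Set} {a b} → (∀ {u} → U u → U′ u) → Square U a b → Square U′ a b
  square-map f S = record
    { set = set ; conn = conn ; sub = λ r → f ∘ sub r ; disj = disj ; link = link
    ; apart-end = apart-end ; apart-mid = apart-mid ; a∈ = a∈ ; b∈ = b∈ }
    where
    open Square S

  swap : Role → Role
  swap (end i) = end (not i)
  swap (mid j) = mid j

  swap-injective : ∀ {r r′} → swap r ≡ swap r′ → r ≡ r′
  swap-injective {end false} {end false} _ = refl
  swap-injective {end true}  {end true}  _ = refl
  swap-injective {mid _}     {mid _}  refl = refl

  square-flip : ∀ {U a b} → Square U a b → Square U b a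
  square-flip S = record
    { set = set ∘ swap ; conn = conn ∘ swap ; sub = sub ∘ swap
    ; disj = λ r r′ p q → swap-injective (disj (swap r) (swap r′) p q)
    ; link = λ i j → link (not i) j
    ; apart-end = λ p q e → apart-end q p (esym e)
    ; apart-mid = apart-mid ; a∈ = b∈ ; b∈ = a∈ }
    where
    open Square S

  -- The two interiors become the middle branch sets. A common vertex would be `a` or `b`, and so
  -- would an end of an edge between them, since one end lies on both sides; interiors avoid both
  -- vertices.
  square-parallel : ∀ {U U₁ U₂ : Fin n → Set} {a b} → a ≢ b → ¬ E a b →
    (∀ {u} → U₁ u → U u) → (∀ {u} → U₂ u → U u) → U a → U b →
    (∀ {u} → U₁ u → U₂ u → u ≡ a ⊎ u ≡ b) →
    (∀ {u w} → U₁ u → U₂ w → E u w → U₂ u ⊎ U₁ w) →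
    Mid U₁ a b → Mid U₂ a b → Square U a b
  square-parallel {U} {U₁} {U₂} {a} {b} a≢b ¬e f₁ f₂ Ua Ub share cross M₁ M₂ = record
    { set = set ; conn = conn ; sub = sub ; disj = disj ; link = link
    ; apart-end = λ { (here refl) (here refl) e → ¬e e }
    ; apart-mid = λ p q e →
        [ (λ x → apart₁ p (share (M₁.sub p) x)) , (λ x → apart₂ q (share x (M₂.sub q))) ]′
          (cross (M₁.sub p) (M₂.sub q) e)
    ; a∈ = here refl ; b∈ = here refl }
    where
    module M₁ = Mid M₁
    module M₂ = Mid M₂
    set : Role → List (Fin n)
    set (end false) = a ∷ []
    set (end true)  = b ∷ []
    set (mid false) = M₁.set
    set (mid true)  = M₂.set
    conn : ∀ r → Conn G (set r)
    conn (end false) = conn-[ a ]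
    conn (end true)  = conn-[ b ]
    conn (mid false) = M₁.conn
    conn (mid true)  = M₂.conn
    sub : ∀ r {u} → u ∈ set r → U u
    sub (end false) (here refl) = Ua
    sub (end true)  (here refl) = Ub
    sub (mid false) p = f₁ (M₁.sub p)
    sub (mid true)  p = f₂ (M₂.sub p)
    apart₁ : ∀ {u} → u ∈ M₁.set → ¬ (u ≡ a ⊎ u ≡ b)
    apart₁ p (inj₁ refl) = M₁.a∉ p
    apart₁ p (inj₂ refl) = M₁.b∉ p
    apart₂ : ∀ {u} → u ∈ M₂.set → ¬ (u ≡ a ⊎ u ≡ b)
    apart₂ p (inj₁ refl) = M₂.a∉ p
    apart₂ p (inj₂ refl) = M₂.b∉ p
    ends : ∀ i {u} → u ∈ set (end i) → u ≡ a ⊎ u ≡ b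
    ends false (here p) = inj₁ p
    ends true  (here p) = inj₂ p
    mids : ∀ j {u} → u ∈ set (mid j) → ¬ (u ≡ a ⊎ u ≡ b)
    mids false = apart₁
    mids true  = apart₂
    disj : ∀ r r′ {u} → u ∈ set r → u ∈ set r′ → r ≡ r′
    disj (end false) (end false) _ _ = refl
    disj (end true)  (end true)  _ _ = refl
    disj (end false) (end true)  (here refl) (here q) = ⊥-elim (a≢b q)
    disj (end true)  (end false) (here refl) (here q) = ⊥-elim (a≢b (≡.sym q))
    disj (end i)     (mid j)     p q = ⊥-elim (mids j q (ends i p))
    disj (mid j)     (end i)     p q = ⊥-elim (mids j p (ends i q))
    disj (mid false) (mid false) _ _ = refl
    disj (mid true)  (mid true)  _ _ = refl
    disj (mid false) (mid true)  p q = ⊥-elim (apart₁ p (share (M₁.sub p) (M₂.sub q)))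
    disj (mid true)  (mid false) p q = ⊥-elim (apart₁ q (share (M₁.sub q) (M₂.sub p)))
    link : ∀ i j → ∃[ u ] ∃[ w ] (u ∈ set (end i) × w ∈ set (mid j) × E u w)
    link false false = let (w , w∈ , e) = M₁.to-a in a , w , here refl , w∈ , e
    link false true  = let (w , w∈ , e) = M₂.to-a in a , w , here refl , w∈ , e
    link true  false = let (w , w∈ , e) = M₁.to-b in b , w , here refl , w∈ , e
    link true  true  = let (w , w∈ , e) = M₂.to-b in b , w , here refl , w∈ , e

  module _ {U U₁ U₂ : Fin n → Set} {a b d : Fin n}
    (f₁ : ∀ {u} → U₁ u → U u) (f₂ : ∀ {u} → U₂ u → U u)
    (share : ∀ {u} → U₁ u → U₂ u → u ≡ d)
    (U₁a : U₁ a) (U₁d : U₁ d) (a≢d : a ≢ d) where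

    mid-series : U₂ b → U₂ d → b ≢ d → Link U₁ a d → Link U₂ d b → Mid U a b
    mid-series U₂b U₂d b≢d l₁ l₂ = record
      { set = A₁.set ++ A₂.set
      ; conn = conn-++ A₁.conn A₂.conn A₁.d∈ A₂.d∈
      ; a∉ = λ p → [ A₁.a∉ , (λ q → a≢d (share U₁a (A₂.sub q))) ]′ (∈-++⁻ A₁.set p)
      ; b∉ = λ p → [ (λ q → b≢d (share (A₁.sub q) U₂b)) , A₂.a∉ ]′ (∈-++⁻ A₁.set p)
      ; sub = λ p → [ f₁ ∘ A₁.sub , f₂ ∘ A₂.sub ]′ (∈-++⁻ A₁.set p)
      ; to-a = let (u , u∈ , e) = A₁.to-a in u , ∈-++⁺ˡ u∈ , e
      ; to-b = let (u , u∈ , e) = A₂.to-a in u , ∈-++⁺ʳ A₁.set u∈ , e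
      }
      where
      module A₁ = Arm (arm a≢d U₁d l₁)
      module A₂ = Arm (arm b≢d U₂d (link-flip l₂))

    -- The end that contains `d` absorbs `a` and its connection to `d`. It stays apart from the
    -- opposite end because every edge from `U₁` to `U₂` has `d` as one of its ends.
    square-series : (∀ {u w} → U₁ u → U₂ w → E u w → u ≡ d ⊎ w ≡ d) →
      Link U₁ a d → Square U₂ d b → Square U a b
    square-series cross l S = record
      { set = set ; conn = conn ; sub = sub ; disj = disj ; link = link
      ; apart-end = apart-end ; apart-mid = S.apart-mid ; a∈ = here refl ; b∈ = S.b∈ }
      where
      module S = Square S
      module A = Arm (arm a≢d U₁d l)
      set : Role → List (Fin n)
      set (end false) = (a ∷ A.set) ++ S.set (end false)
      set (end true)  = S.set (end true)
      set (mid j)     = S.set (mid j)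
      conn : ∀ r → Conn G (set r)
      conn (end false) = conn-++ {l = a ∷ A.set}
        (conn-edge conn-[ a ] A.conn (here refl) (proj₁ (proj₂ A.to-a)) (proj₂ (proj₂ A.to-a)))
        (S.conn (end false)) (there A.d∈) S.a∈
      conn (end true)  = S.conn (end true)
      conn (mid j)     = S.conn (mid j)
      new : ∀ {u} → u ∈ a ∷ A.set → U₁ u
      new (here refl) = U₁a
      new (there p)   = A.sub p
      mem : ∀ r {u} → u ∈ set r → u ∈ S.set r ⊎ (U₁ u × r ≡ end false)
      mem (end false) p = Sum.swap (Sum.map (λ q → new q , refl) id (∈-++⁻ (a ∷ A.set) p))
      mem (end true)  p = inj₁ p
      mem (mid j)     p = inj₁ p
      sub : ∀ r {u} → u ∈ set r → U u
      sub r p = [ f₂ ∘ S.sub r , f₁ ∘ proj₁ ]′ (mem r p)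
      old : ∀ r {u} → U₁ u → u ∈ S.set r → r ≡ end false
      old r x p with share x (S.sub r p)
      ... | refl = S.disj r (end false) p S.a∈
      disj : ∀ r r′ {u} → u ∈ set r → u ∈ set r′ → r ≡ r′
      disj r r′ p q with mem r p | mem r′ q
      ... | inj₁ p′         | inj₁ q′         = S.disj r r′ p′ q′
      ... | inj₁ p′         | inj₂ (x , refl) = old r x p′
      ... | inj₂ (x , refl) | inj₁ q′         = ≡.sym (old r′ x q′)
      ... | inj₂ (_ , refl) | inj₂ (_ , refl) = refl
      link : ∀ i j → ∃[ u ] ∃[ w ] (u ∈ set (end i) × w ∈ set (mid j) × E u w)
      link false j = let (u , w , u∈ , r) = S.link false j in u , w , ∈-++⁺ʳ (a ∷ A.set) u∈ , r
      link true  j = S.link true j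
      apart-end : ∀ {u w} → u ∈ set (end false) → w ∈ set (end true) → ¬ E u w
      apart-end {u} {w} p q e with mem (end false) p
      ... | inj₁ p′ = S.apart-end p′ q e
      ... | inj₂ (x , _) with cross x (S.sub (end true) q) e
      ...   | inj₁ refl = S.apart-end S.a∈ q e
      ...   | inj₂ refl with () ← S.disj (end false) (end true) S.a∈ q

  -- A replacement for `t` by two vertex-disjoint trees, each of which can be hung separately
  -- wherever its own vertex of the pair occurs.
  record Cut (t : Tree n) (a b : Fin n) : Set where
    field
      ta tb : Tree n
      va  : Valid 3 ta
      vb  : Valid 3 tb
      a∈  : a ∈ root ta
      b∈  : b ∈ root tb
      sa  : ∀ {v} → V ta v → V t v
      sb  : ∀ {v} → V tb v → V t v
      dis : ∀ {v} → V ta v → ¬ V tb v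
      cov : ∀ {u w} → Rel u w → Cov t u w → Cov ta u w ⊎ Cov tb u w
      cnt : zeros ta + zeros tb ≤ zeros t

    b∉a : ¬ V ta b
    b∉a x = dis x (root⇒V tb b∈)

    a∉b : ¬ V tb a
    a∉b x = dis (root⇒V ta a∈) x

  -- A replacement for `t` retriangulated with apex `c`. The bags recorded in `ac` and `bc` are the
  -- places for parts that share `a, c` or `b, c` with it.
  record Fan (t : Tree n) (a b c : Fin n) : Set where
    field
      tree  : Tree n
      valid : Valid 3 tree
      ac    : Cov tree a c
      bc    : Cov tree b c
      sub   : ∀ {v} → V tree v → V t v ⊎ v ≡ c
      cov   : ∀ {u w} → Rel u w → Cov t u w → Cov tree u w
      cnt   : zeros tree ≤ zeros t

  -- How a and b are joined inside the part of G covered by t: not at all, by a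
  -- chain that can be triangulated from any apex with every new bag containing
  -- an edge of the chain, or through a 4-cycle minor.
  data Class (t : Tree n) (a b : Fin n) : Set where
    cut    : Cut t a b → Class t a b
    ladder : Link (V t) a b → (∀ c → ¬ V t c → Fan t a b c) → Class t a b
    double : Link (V t) a b → Square (V t) a b → Class t a b

  -- Lets a part be rearranged into a shape that is easier to classify: these three relations are
  -- all that `Class` reads off its tree.
  record _≼_ (t t′ : Tree n) : Set where
    field
      sub : ∀ {v} → V t v → V t′ v
      cov : ∀ {u w} → Cov t′ u w → Cov t u w
      cnt : zeros t ≤ zeros t′

  transfer : ∀ {t t′ a b} → t ≼ t′ → Class t a b → Class t′ a b
  transfer r (cut c) = cut record
    { ta = ta ; tb = tb ; va = va ; vb = vb ; a∈ = a∈ ; b∈ = b∈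
    ; sa = r.sub ∘ sa ; sb = r.sub ∘ sb ; dis = dis
    ; cov = λ x y → cov x (r.cov y) ; cnt = ≤-trans cnt r.cnt }
    where
    module r = _≼_ r
    open Cut c
  transfer {t} {t′} {a} {b} r (ladder l f) =
    ladder (link-map r.sub l) λ c c∉ → fan (f c (c∉ ∘ r.sub))
    where
    module r = _≼_ r
    fan : ∀ {c} → Fan t a b c → Fan t′ a b c
    fan F = record
      { tree = tree ; valid = valid ; ac = ac ; bc = bc ; sub = Sum.map r.sub id ∘ sub
      ; cov = λ x y → cov x (r.cov y) ; cnt = ≤-trans cnt r.cnt }
      where
      open Fan F
  transfer r (double l s) = double (link-map (_≼_.sub r) l) (square-map (_≼_.sub r) s)

  join-comm : ∀ t s → join t s ≼ join s t
  join-comm t s = record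
    { sub = [ V-joinʳ , V-joinˡ ]′ ∘ V-join⁻
    ; cov = [ Cov-joinʳ , Cov-joinˡ ]′ ∘ Cov-join⁻
    ; cnt = ≤-reflexive (+-comm (zeros t) _) }

  module _ {t₁ t₂ : Tree n} {a b : Fin n}
    (share : ∀ {u} → V t₁ u → V t₂ u → u ≡ a ⊎ u ≡ b) where

    -- A part that does not connect `a` to `b` leaves the class of the other one unchanged: in a
    -- rebuilt tree its two halves are hung where `a` and where `b` occur.
    parallel-cut : Cut t₁ a b → Class t₂ a b → Class (join t₁ t₂) a b
    parallel-cut C (cut D) = cut record
      { ta = join C.ta D.ta ; tb = join C.tb D.tb
      ; va = C.va , D.va , λ v x y → at-a x y ; vb = C.vb , D.vb , λ v x y → at-b x y
      ; a∈ = C.a∈ ; b∈ = C.b∈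
      ; sa = [ V-joinˡ ∘ C.sa , V-joinʳ ∘ D.sa ]′ ∘ V-join⁻
      ; sb = [ V-joinˡ ∘ C.sb , V-joinʳ ∘ D.sb ]′ ∘ V-join⁻
      ; dis = λ x y → dis (V-join⁻ x) (V-join⁻ y)
      ; cov = λ r c → [ Sum.map Cov-joinˡ Cov-joinˡ ∘ C.cov r , Sum.map Cov-joinʳ Cov-joinʳ ∘ D.cov r ]′ (Cov-join⁻ c)
      ; cnt = begin
          (zeros C.ta + zeros D.ta) + (zeros C.tb + zeros D.tb)
            ≡⟨ solve 4 (λ x y z w → (x :+ y) :+ (z :+ w) := (x :+ z) :+ (y :+ w)) refl
                 (zeros C.ta) (zeros D.ta) (zeros C.tb) (zeros D.tb) ⟩
          (zeros C.ta + zeros C.tb) + (zeros D.ta + zeros D.tb)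
            ≤⟨ +-mono-≤ C.cnt D.cnt ⟩
          zeros t₁ + zeros t₂ ∎
      }
      where
      open ≤-Reasoning
      open +-*-Solver
      module C = Cut C
      module D = Cut D
      at-a : ∀ {v} → V C.ta v → V D.ta v → v ∈ root C.ta × v ∈ root D.ta
      at-a x y with share (C.sa x) (D.sa y)
      ... | inj₁ refl = C.a∈ , D.a∈
      ... | inj₂ refl = ⊥-elim (C.b∉a x)
      at-b : ∀ {v} → V C.tb v → V D.tb v → v ∈ root C.tb × v ∈ root D.tb
      at-b x y with share (C.sb x) (D.sb y)
      ... | inj₁ refl = ⊥-elim (C.a∉b x)
      ... | inj₂ refl = C.b∈ , D.b∈
      dis : ∀ {v} → V C.ta v ⊎ V D.ta v → V C.tb v ⊎ V D.tb v → ⊥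
      dis (inj₁ x) (inj₁ y) = C.dis x y
      dis (inj₂ x) (inj₂ y) = D.dis x y
      dis (inj₁ x) (inj₂ y) with share (C.sa x) (D.sb y)
      ... | inj₁ refl = D.a∉b y
      ... | inj₂ refl = C.b∉a x
      dis (inj₂ x) (inj₁ y) with share (C.sb y) (D.sa x)
      ... | inj₁ refl = C.a∉b y
      ... | inj₂ refl = D.b∉a x
    parallel-cut C (ladder l f) = ladder (link-map V-joinʳ l) λ c c∉ → fan c c∉ (f c (c∉ ∘ V-joinʳ))
      where
      module C = Cut C
      fan : ∀ c → ¬ V (join t₁ t₂) c → Fan t₂ a b c → Fan (join t₁ t₂) a b c
      fan c c∉ F = record
        { tree = tree₂
        ; valid = valid-graft tree₁ (valid-graft F.tree F.valid C.va p adh₁) C.vb q adh₂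
        ; ac = Cov-graftˡ tree₁ q (Cov-graftˡ F.tree p F.ac)
        ; bc = Cov-graftˡ tree₁ q (Cov-graftˡ F.tree p F.bc)
        ; sub = λ x → [ (λ y → [ Sum.map V-joinʳ id ∘ F.sub , inj₁ ∘ V-joinˡ ∘ C.sa ]′ (V-graft⁻ F.tree p y))
                      , inj₁ ∘ V-joinˡ ∘ C.sb ]′ (V-graft⁻ tree₁ q x)
        ; cov = λ r x → [ (λ y → [ Cov-graftˡ tree₁ q ∘ Cov-graftʳ F.tree p , Cov-graftʳ tree₁ q ]′ (C.cov r y))
                        , Cov-graftˡ tree₁ q ∘ Cov-graftˡ F.tree p ∘ F.cov r ]′ (Cov-join⁻ x)
        ; cnt = begin
            zeros tree₂                                ≡⟨ zeros-graft tree₁ q ⟩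
            zeros tree₁ + zeros C.tb                   ≡⟨ cong (_+ zeros C.tb) (zeros-graft F.tree p) ⟩
            (zeros F.tree + zeros C.ta) + zeros C.tb   ≡⟨ solve 3 (λ x y z → (x :+ y) :+ z := (y :+ z) :+ x) refl (zeros F.tree) (zeros C.ta) (zeros C.tb) ⟩
            (zeros C.ta + zeros C.tb) + zeros F.tree   ≤⟨ +-mono-≤ C.cnt F.cnt ⟩
            zeros t₁ + zeros t₂                        ∎
        }
        where
        open ≤-Reasoning
        open +-*-Solver
        module F = Fan F
        p : At F.tree (proj₁ F.ac)
        p = proj₁ (proj₂ F.ac)
        tree₁ : Tree n
        tree₁ = graft F.tree C.ta p
        q : At tree₁ (proj₁ F.bc)
        q = at-graftˡ F.tree p (proj₁ (proj₂ F.bc))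
        tree₂ : Tree n
        tree₂ = graft tree₁ C.tb q
        meet : ∀ {v} → V F.tree v → V t₁ v → v ≡ a ⊎ v ≡ b
        meet x y with F.sub x
        ... | inj₁ z    = share y z
        ... | inj₂ refl = ⊥-elim (c∉ (V-joinˡ y))
        adh₁ : ∀ v → V F.tree v → V C.ta v → v ∈ proj₁ F.ac × v ∈ root C.ta
        adh₁ v x y with meet x (C.sa y)
        ... | inj₁ refl = proj₁ (proj₂ (proj₂ F.ac)) , C.a∈
        ... | inj₂ refl = ⊥-elim (C.b∉a y)
        adh₂ : ∀ v → V tree₁ v → V C.tb v → v ∈ proj₁ F.bc × v ∈ root C.tb
        adh₂ v x y with V-graft⁻ F.tree p x
        ... | inj₂ z = ⊥-elim (C.dis z y)
        ... | inj₁ z with meet z (C.sb y)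
        ...   | inj₁ refl = ⊥-elim (C.a∉b y)
        ...   | inj₂ refl = proj₁ (proj₂ (proj₂ F.bc)) , C.b∈
    parallel-cut C (double l s) = double (link-map V-joinʳ l) (square-map V-joinʳ s)

  -- Two linked parts yield a 4-cycle no matter whether they are ladders or double; `¬ E a b`
  -- guarantees that both links have an interior.
  parallel : ∀ {t₁ t₂ a b} → a ≢ b → ¬ E a b → V t₁ a → V t₁ b →
    (∀ {u} → V t₁ u → V t₂ u → u ≡ a ⊎ u ≡ b) →
    (∀ {u w} → V t₁ u → V t₂ w → E u w → V t₂ u ⊎ V t₁ w) →
    Class t₁ a b → Class t₂ a b → Class (join t₁ t₂) a b
  parallel {t₁} {t₂} {a} {b} a≢b ¬e Va Vb share cross = go
    where
    both : Link (V t₁) a b → Link (V t₂) a b → Class (join t₁ t₂) a b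
    both l l′ = double (link-map V-joinˡ l)
      (square-parallel a≢b ¬e V-joinˡ V-joinʳ (V-joinˡ Va) (V-joinˡ Vb) share cross (link⇒mid ¬e l) (link⇒mid ¬e l′))
    go : Class t₁ a b → Class t₂ a b → Class (join t₁ t₂) a b
    go (cut C) c = parallel-cut share C c
    go c (cut C) = transfer (join-comm t₂ t₁) (parallel-cut (λ x y → share y x) C c)
    go (ladder l _) (ladder l′ _) = both l l′
    go (ladder l _) (double l′ _) = both l l′
    go (double l _) (ladder l′ _) = both l l′
    go (double l _) (double l′ _) = both l l′

  -- A cut in one part cuts the whole, with the other part joining the side of `d`. A 4-cycle in one
  -- part is prolonged by the link through the other. Two ladders are built from the same apex `c`
  -- and glued at bags containing `d` and `c`.
  series : ∀ {t₁ t₂ a d b} → Valid 3 t₁ → Valid 3 t₂ →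
    a ∈ root t₁ → d ∈ root t₁ → d ∈ root t₂ → b ∈ root t₂ → a ≢ d → b ≢ d →
    (∀ {u} → V t₁ u → V t₂ u → u ≡ d) →
    (∀ {u w} → V t₁ u → V t₂ w → E u w → u ≡ d ⊎ w ≡ d) →
    Class t₁ a d → Class t₂ d b → Class (join t₁ t₂) a b
  series {t₁} {t₂} {a} {d} {b} v₁ v₂ a∈ d∈₁ d∈₂ b∈ a≢d b≢d share cross = go
    where
    open ≤-Reasoning
    link : Link (V t₁) a d → Link (V t₂) d b → Link (V (join t₁ t₂)) a b
    link l l′ = inj₂ (mid-series V-joinˡ V-joinʳ share (root⇒V t₁ a∈) (root⇒V t₁ d∈₁) a≢d
      (root⇒V t₂ b∈) (root⇒V t₂ d∈₂) b≢d l l′)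
    doubleʳ : Link (V t₁) a d → Link (V t₂) d b → Square (V t₂) d b → Class (join t₁ t₂) a b
    doubleʳ l l′ s = double (link l l′)
      (square-series V-joinˡ V-joinʳ share (root⇒V t₁ a∈) (root⇒V t₁ d∈₁) a≢d cross l s)
    go : Class t₁ a d → Class t₂ d b → Class (join t₁ t₂) a b
    go (cut C) _ = cut record
      { ta = ta ; tb = join t₂ tb ; va = va
      ; vb = v₂ , vb , λ v x y → at-d x y
      ; a∈ = a∈′ ; b∈ = b∈
      ; sa = V-joinˡ ∘ sa ; sb = [ V-joinʳ , V-joinˡ ∘ sb ]′ ∘ V-join⁻
      ; dis = λ x y → [ (λ z → apart x z) , dis x ]′ (V-join⁻ y)
      ; cov = λ r x → [ Sum.map id Cov-joinʳ ∘ cov r , inj₂ ∘ Cov-joinˡ ]′ (Cov-join⁻ x)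
      ; cnt = begin
          zeros ta + (zeros t₂ + zeros tb)   ≡⟨ solve 3 (λ x y z → x :+ (y :+ z) := (x :+ z) :+ y) refl (zeros ta) (zeros t₂) (zeros tb) ⟩
          (zeros ta + zeros tb) + zeros t₂   ≤⟨ +-monoˡ-≤ (zeros t₂) cnt ⟩
          zeros t₁ + zeros t₂                ∎
      }
      where
      open Cut C renaming (a∈ to a∈′; b∈ to d∈′)
      open +-*-Solver
      at-d : ∀ {v} → V t₂ v → V tb v → v ∈ root t₂ × v ∈ root tb
      at-d x y with share (sb y) x
      ... | refl = d∈₂ , d∈′
      apart : ∀ {v} → V ta v → V t₂ v → ⊥
      apart x y with share (sa x) y
      ... | refl = b∉a x
    go _ (cut C) = cut record
      { ta = join t₁ ta ; tb = tb ; va = v₁ , va , λ v x y → at-d x y ; vb = vb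
      ; a∈ = a∈ ; b∈ = b∈′
      ; sa = [ V-joinˡ , V-joinʳ ∘ sa ]′ ∘ V-join⁻ ; sb = V-joinʳ ∘ sb
      ; dis = λ x y → [ (λ z → apart z y) , (λ z → dis z y) ]′ (V-join⁻ x)
      ; cov = λ r x → [ inj₁ ∘ Cov-joinˡ , Sum.map Cov-joinʳ id ∘ cov r ]′ (Cov-join⁻ x)
      ; cnt = ≤-trans (≤-reflexive (+-assoc (zeros t₁) _ _)) (+-monoʳ-≤ (zeros t₁) cnt)
      }
      where
      open Cut C renaming (a∈ to d∈′; b∈ to b∈′)
      at-d : ∀ {v} → V t₁ v → V ta v → v ∈ root t₁ × v ∈ root ta
      at-d x y with share x (sa y)
      ... | refl = d∈₁ , d∈′
      apart : ∀ {v} → V t₁ v → V tb v → ⊥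
      apart x y with share x (sb y)
      ... | refl = a∉b y
    go (ladder l f) (ladder l′ f′) = ladder (link l l′) λ c c∉ →
      fan c c∉ (f c (c∉ ∘ V-joinˡ)) (f′ c (c∉ ∘ V-joinʳ))
      where
      fan : ∀ c → ¬ V (join t₁ t₂) c → Fan t₁ a d c → Fan t₂ d b c → Fan (join t₁ t₂) a b c
      fan c c∉ F F′ = record
        { tree = graft F.tree R.tree p
        ; valid = valid-graft F.tree F.valid R.valid p adh
        ; ac = Cov-graftˡ F.tree p F.ac
        ; bc = Cov-graftʳ F.tree p (R.Cov⁺ F′.bc)
        ; sub = λ x → [ Sum.map V-joinˡ id ∘ F.sub , Sum.map V-joinʳ id ∘ F′.sub ∘ R.V⁻ ]′ (V-graft⁻ F.tree p x)
        ; cov = λ r x → [ Cov-graftˡ F.tree p ∘ F.cov r , Cov-graftʳ F.tree p ∘ R.Cov⁺ ∘ F′.cov r ]′ (Cov-join⁻ x)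
        ; cnt = begin
            zeros (graft F.tree R.tree p)   ≡⟨ zeros-graft F.tree p ⟩
            zeros F.tree + zeros R.tree     ≡⟨ cong (zeros F.tree +_) R.zeros≡ ⟩
            zeros F.tree + zeros F′.tree    ≤⟨ +-mono-≤ F.cnt F′.cnt ⟩
            zeros t₁ + zeros t₂             ∎
        }
        where
        module F = Fan F
        module F′ = Fan F′
        -- A grafted tree is attached by its root, so the second fan is first rerooted at its bag
        -- with `d` and `c`.
        module R = Reroot (reroot F′.tree F′.valid (proj₁ (proj₂ F′.ac)))
        p : At F.tree (proj₁ F.bc)
        p = proj₁ (proj₂ F.bc)
        dc : ∀ {v} → v ≡ d ⊎ v ≡ c → v ∈ proj₁ F.bc × v ∈ root R.tree
        dc (inj₁ refl) = proj₁ (proj₂ (proj₂ F.bc)) , subst (d ∈_) (≡.sym R.root≡) (proj₁ (proj₂ (proj₂ F′.ac)))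
        dc (inj₂ refl) = proj₂ (proj₂ (proj₂ F.bc)) , subst (c ∈_) (≡.sym R.root≡) (proj₂ (proj₂ (proj₂ F′.ac)))
        adh : ∀ v → V F.tree v → V R.tree v → v ∈ proj₁ F.bc × v ∈ root R.tree
        adh v x y with F.sub x | F′.sub (R.V⁻ y)
        ... | inj₁ x′ | inj₁ y′ = dc (inj₁ (share x′ y′))
        ... | inj₂ eq | _       = dc (inj₂ eq)
        ... | _       | inj₂ eq = dc (inj₂ eq)
    go (ladder l _) (double l′ s) = doubleʳ l l′ s
    go (double l _) (double l′ s) = doubleʳ l l′ s
    go (double l s) (ladder l′ _) = double (link l l′) (square-flip
      (square-series V-joinʳ V-joinˡ (λ x y → share y x) (root⇒V t₂ b∈) (root⇒V t₂ d∈₂) b≢d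
        (λ x y e → Sum.swap (cross y x (esym e))) (link-flip l′) (square-flip s)))

  -- Without this an edge of `G` between two branch sets could escape the tree, and the minors found
  -- would not be induced.
  Full : Tree n → Set
  Full t = ∀ {u w} → V t u → V t w → E u w → Cov t u w

  full-joinˡ : ∀ t s {k} → Valid k (join t s) → Full (join t s) → Full t
  full-joinˡ t s (_ , _ , adh) full {u} {w} x y e with Cov-join⁻ (full (V-joinˡ x) (V-joinˡ y) e)
  ... | inj₁ c = c
  ... | inj₂ c = root t , at-root t , proj₁ (adh u x (covˡ c)) , proj₁ (adh w y (covʳ c))

  full-joinʳ : ∀ t s {k} → Valid k (join t s) → Full (join t s) → Full s
  full-joinʳ t s (_ , _ , adh) full {u} {w} x y e with Cov-join⁻ (full (V-joinʳ x) (V-joinʳ y) e)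
  ... | inj₁ c = root s , at-root s , proj₂ (adh u (covˡ c) x) , proj₂ (adh w (covʳ c) y)
  ... | inj₂ c = c

  full-split : ∀ {t a b d} → Full t → (S : Split t a b d) → Full (Split.ab S)
  full-split full S {u} {w} x y e with Split.cov S (full (Split.s-ab S x) (Split.s-ab S y) e)
  ... | inj₁ c        = c
  ... | inj₂ (inj₁ c) = ⊥-elim (edge⇒≢ {G = G} e (≡.trans (Split.i-b S x (covˡ c)) (≡.sym (Split.i-b S y (covʳ c)))))
  ... | inj₂ (inj₂ c) = ⊥-elim (edge⇒≢ {G = G} e (≡.trans (Split.i-a S (covˡ c) x) (≡.sym (Split.i-a S (covʳ c) y))))

  -- One new bag `a, b, c` on top of `t` suffices: it contains the edge `ab`, so it is not
  -- independent, whatever `t` looks like.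
  adjacent : ∀ {t a b} → Valid 3 t → a ∈ root t → b ∈ root t → a ≢ b → E a b → Class t a b
  adjacent {t} {a} {b} vt a∈ b∈ a≢b e = ladder (inj₁ e) λ c c∉ → record
    { tree = join (leaf (a ∷ b ∷ c ∷ [])) t
    ; valid = (((a≢b ∷ (λ { refl → c∉ (root⇒V t a∈) }) ∷ []) ∷ ((λ { refl → c∉ (root⇒V t b∈) }) ∷ []) ∷ [] ∷ [])
              , ≤-refl) , vt , λ where
        v (_ , refl , here refl) _ → here refl , a∈
        v (_ , refl , there (here refl)) _ → there (here refl) , b∈
        v (_ , refl , there (there (here refl))) x → ⊥-elim (c∉ x)
    ; ac = _ , inj₁ refl , here refl , there (there (here refl))
    ; bc = _ , inj₁ refl , there (here refl) , there (there (here refl))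
    ; sub = λ where
        (_ , inj₁ refl , here refl) → inj₁ (root⇒V t a∈)
        (_ , inj₁ refl , there (here refl)) → inj₁ (root⇒V t b∈)
        (_ , inj₁ refl , there (there (here p))) → inj₂ p
        (B , inj₂ p , q) → inj₁ (B , p , q)
    ; cov = λ _ → Cov-joinʳ
    ; cnt = ≤-reflexive (cong (λ z → (if z ∨ (adj G b c ∨ adj G c a) then 0 else 1) + zeros t) e)
    }

  apart-cut : ∀ {ta tb a b} → Valid 3 ta → Valid 3 tb → a ∈ root ta → b ∈ root tb →
    (∀ {v} → V ta v → ¬ V tb v) → Cut (join ta tb) a b
  apart-cut {ta} {tb} va vb a∈ b∈ dis = record
    { ta = ta ; tb = tb ; va = va ; vb = vb ; a∈ = a∈ ; b∈ = b∈ ; sa = V-joinˡ ; sb = V-joinʳ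
    ; dis = dis ; cov = λ _ → Cov-join⁻ ; cnt = ≤-refl }

  single : ∀ {x : Fin n} → Valid 3 (leaf (x ∷ []))
  single = ([] ∷ []) , s≤s z≤n

  -- A subtree missing `y` can share nothing but `x` with `t`. The one-vertex bag of `y` turns it
  -- into a degenerate cut, so that `parallel-cut` can absorb it.
  hang : ∀ {t s x y} → Valid 3 (join t s) → V t x → V t y → x ≢ y →
    (∀ {v} → v ∈ root t → v ≡ x ⊎ v ≡ y) → ¬ V s y →
    Cut (join (join (leaf (x ∷ [])) s) (leaf (y ∷ []))) x y ×
    (∀ {v} → V (join (join (leaf (x ∷ [])) s) (leaf (y ∷ []))) v → V t v → v ≡ x ⊎ v ≡ y)
  hang {t} {s} {x} {y} (_ , vs , adh) tx ty x≢y sub y∉ =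
    apart-cut (single , vs , (λ { v (_ , refl , here refl) z → here refl , proj₂ (adh x tx z) }))
      single (here refl) (here refl)
      (λ { (_ , inj₁ refl , here refl) (_ , refl , here p) → x≢y p
         ; (B , inj₂ p , q) (_ , refl , here refl) → y∉ (B , p , q) }) ,
    λ { (_ , inj₁ (inj₁ refl) , here p) _ → inj₁ p
      ; (B , inj₁ (inj₂ p) , q) z → sub (proj₁ (adh _ z (B , p , q)))
      ; (_ , inj₂ refl , here p) _ → inj₂ p }

  cut-flip : ∀ {t a b} → Cut t a b → Cut t b a
  cut-flip C = record
    { ta = tb ; tb = ta ; va = vb ; vb = va ; a∈ = b∈ ; b∈ = a∈ ; sa = sb ; sb = sa
    ; dis = λ x y → dis y x ; cov = λ r x → Sum.swap (cov r x)
    ; cnt = ≤-trans (≤-reflexive (+-comm (zeros tb) _)) cnt }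
    where
    open Cut C

  Classifier : Fin n → Fin n → Tree n → Set
  Classifier a b t = Valid 3 t → Full t → a ∈ root t → b ∈ root t → Class t a b

  -- With only `a` and `b` in the root bag, a subtree joined to it is either a parallel part or
  -- contains at most one of the two.
  classify-narrow : ∀ {a b} → a ≢ b → ¬ E a b → ∀ t →
    (∀ s → weight s < weight t → Classifier a b s) →
    (∀ {v} → v ∈ root t → v ≡ a ⊎ v ≡ b) → Classifier a b t
  classify-narrow {a} {b} a≢b ¬e (leaf B) _ sub _ _ a∈ b∈ = cut record
    { ta = leaf (a ∷ []) ; tb = leaf (b ∷ []) ; va = single ; vb = single
    ; a∈ = here refl ; b∈ = here refl
    ; sa = λ { (_ , refl , here refl) → B , refl , a∈ }
    ; sb = λ { (_ , refl , here refl) → B , refl , b∈ }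
    ; dis = λ { (_ , refl , here refl) (_ , refl , here p) → a≢b p }
    ; cov = λ { r (_ , refl , u∈ , w∈) → pairs r (sub u∈) (sub w∈) }
    ; cnt = z≤n }
    where
    pairs : ∀ {u w} → Rel u w → u ≡ a ⊎ u ≡ b → w ≡ a ⊎ w ≡ b →
      Cov (leaf (a ∷ [])) u w ⊎ Cov (leaf (b ∷ [])) u w
    pairs r           (inj₁ refl) (inj₁ refl) = inj₁ (_ , refl , here refl , here refl)
    pairs r           (inj₂ refl) (inj₂ refl) = inj₂ (_ , refl , here refl , here refl)
    pairs (inj₁ p)    (inj₁ refl) (inj₂ refl) = ⊥-elim (a≢b p)
    pairs (inj₂ e)    (inj₁ refl) (inj₂ refl) = ⊥-elim (¬e e)
    pairs (inj₁ p)    (inj₂ refl) (inj₁ refl) = ⊥-elim (a≢b (≡.sym p))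
    pairs (inj₂ e)    (inj₂ refl) (inj₁ refl) = ⊥-elim (¬e (esym e))
  classify-narrow {a} {b} a≢b ¬e (join t s) rec sub v@(vt , vs , adh) full a∈ b∈
    with rec t (m<m+n _ (weight-pos s)) vt (full-joinˡ t s v full) a∈ b∈ | V? s a | V? s b
  ... | c | yes sa | yes sb = parallel a≢b ¬e (root⇒V t a∈) (root⇒V t b∈)
      (λ x y → sub (proj₁ (adh _ x y)))
      (λ x y e → Sum.swap (Sum.map covʳ covˡ (Cov-join⁻ (full (V-joinˡ x) (V-joinʳ y) e))))
      c (rec s (m<n+m _ (weight-pos t)) vs (full-joinʳ t s v full)
          (proj₂ (adh a (root⇒V t a∈) sa)) (proj₂ (adh b (root⇒V t b∈) sb)))
  ... | c | _ | no b∉ =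
    let (C , share) = hang v (root⇒V t a∈) (root⇒V t b∈) a≢b sub b∉ in
    transfer record
      { sub = λ { (B , inj₁ (inj₁ (inj₁ refl)) , here refl) → V-joinˡ (root⇒V t a∈)
                ; (B , inj₁ (inj₁ (inj₂ p)) , q) → B , inj₂ p , q
                ; (B , inj₁ (inj₂ refl) , here refl) → V-joinˡ (root⇒V t b∈)
                ; (B , inj₂ p , q) → B , inj₁ p , q }
      ; cov = [ Cov-joinʳ , Cov-joinˡ ∘ Cov-joinˡ ∘ Cov-joinʳ ]′ ∘ Cov-join⁻
      ; cnt = ≤-reflexive (≡.trans (cong (_+ zeros t) (+-identityʳ (zeros s))) (+-comm (zeros s) _)) }
      (parallel-cut share C c)
  ... | c | no a∉ | _ =
    let (C , share) = hang v (root⇒V t b∈) (root⇒V t a∈) (a≢b ∘ ≡.sym) (Sum.swap ∘ sub) a∉ in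
    transfer record
      { sub = λ { (B , inj₁ (inj₁ (inj₁ refl)) , here refl) → V-joinˡ (root⇒V t b∈)
                ; (B , inj₁ (inj₁ (inj₂ p)) , q) → B , inj₂ p , q
                ; (B , inj₁ (inj₂ refl) , here refl) → V-joinˡ (root⇒V t a∈)
                ; (B , inj₂ p , q) → B , inj₁ p , q }
      ; cov = [ Cov-joinʳ , Cov-joinˡ ∘ Cov-joinˡ ∘ Cov-joinʳ ]′ ∘ Cov-join⁻
      ; cnt = ≤-reflexive (≡.trans (cong (_+ zeros t) (+-identityʳ (zeros s))) (+-comm (zeros s) _)) }
      (parallel-cut (λ x y → Sum.swap (share x y)) (cut-flip C) c)

  -- The third root vertex `d` provides a second way from `a` to `b`: the part behind `ab` is
  -- parallel to the series of the parts behind `ad` and `db`.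
  classify-wide : ∀ {t a b d} → a ≢ b → b ≢ d → d ≢ a → ¬ E a b → Full t → (S : Split t a b d) →
    Class (Split.ab S) a b → Class (Split.da S) a d → Class (Split.bd S) d b → Class t a b
  classify-wide {t} {a} {b} {d} a≢b b≢d d≢a ¬e full S c₁ c₂ c₃ = transfer r
    (parallel a≢b ¬e ab∋a ab∋b share cross c₁
      (series v-da v-bd (subst (a ∈_) (≡.sym r-da) (there (here refl))) (subst (d ∈_) (≡.sym r-da) (here refl))
        (subst (d ∈_) (≡.sym r-bd) (there (here refl))) (subst (b ∈_) (≡.sym r-bd) (here refl))
        (d≢a ∘ ≡.sym) b≢d (λ x y → i-d y x) cross-d c₂ c₃))
    where
    open Split S
    r : join ab (join da bd) ≼ t
    r = record
      { sub = [ s-ab , [ s-da , s-bd ]′ ∘ V-join⁻ ]′ ∘ V-join⁻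
      ; cov = [ Cov-joinˡ , [ Cov-joinʳ ∘ Cov-joinʳ , Cov-joinʳ ∘ Cov-joinˡ ]′ ]′ ∘ cov
      ; cnt = ≤-trans (≤-reflexive (cong (zeros ab +_) (+-comm (zeros da) _))) (≤-trans (m≤n+m _ (bad (root t))) cnt) }
    share : ∀ {u} → V ab u → V (join da bd) u → u ≡ a ⊎ u ≡ b
    share x y = [ (λ z → inj₁ (i-a z x)) , (λ z → inj₂ (i-b x z)) ]′ (V-join⁻ y)
    cross : ∀ {u w} → V ab u → V (join da bd) w → E u w → V (join da bd) u ⊎ V ab w
    cross x y e with cov (full (s-ab x) (_≼_.sub r (V-joinʳ y)) e)
    ... | inj₁ c        = inj₂ (covʳ c)
    ... | inj₂ (inj₁ c) = inj₁ (V-joinʳ (covˡ c))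
    ... | inj₂ (inj₂ c) = inj₁ (V-joinˡ (covˡ c))
    cross-d : ∀ {u w} → V da u → V bd w → E u w → u ≡ d ⊎ w ≡ d
    cross-d x y e with cov (full (s-da x) (s-bd y) e)
    -- Covered behind `ab`, the edge would have the ends `a` and `b`, which are not adjacent.
    ... | inj₁ c with i-a x (covˡ c) | i-b (covʳ c) y
    ...   | refl | refl = ⊥-elim (¬e e)
    cross-d x y e | inj₂ (inj₁ c) = inj₁ (i-d (covˡ c) x)
    cross-d x y e | inj₂ (inj₂ c) = inj₂ (i-d y (covʳ c))

  classify-acc : ∀ t → Acc _<_ (weight t) → ∀ {a b} → a ≢ b → Classifier a b t
  classify-acc t (acc rs) {a} {b} a≢b vt full a∈ b∈ with edge? {G = G} a b
  ... | yes e = adjacent vt a∈ b∈ a≢b e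
  ... | no ¬e with Any.any? (λ v → ¬? (v ≟ a) ×-dec ¬? (v ≟ b)) (root t)
  ...   | no ∄ = classify-narrow a≢b ¬e t (λ s lt → classify-acc s (rs lt) a≢b) sub vt full a∈ b∈
    where
    sub : ∀ {v} → v ∈ root t → v ≡ a ⊎ v ≡ b
    sub {v} v∈ with v ≟ a | v ≟ b
    ... | yes p | _     = inj₁ p
    ... | _     | yes p = inj₂ p
    ... | no p  | no q  = ⊥-elim (∄ (lose v∈ (p , q)))
  ...   | yes ∃d with find ∃d
  ...     | d , d∈ , d≢a , d≢b = classify-wide a≢b (d≢b ∘ ≡.sym) d≢a ¬e full S
      (classify-acc S.ab (rs S.w-ab) a≢b S.v-ab (full-split full S)
        (subst (a ∈_) (≡.sym S.r-ab) (here refl)) (subst (b ∈_) (≡.sym S.r-ab) (there (here refl))))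
      (classify-acc S.da (rs S.w-da) (d≢a ∘ ≡.sym) S.v-da (full-split full (rotate (rotate S)))
        (subst (a ∈_) (≡.sym S.r-da) (there (here refl))) (subst (d ∈_) (≡.sym S.r-da) (here refl)))
      (classify-acc S.bd (rs S.w-bd) d≢b S.v-bd (full-split full (rotate S))
        (subst (d ∈_) (≡.sym S.r-bd) (there (here refl))) (subst (b ∈_) (≡.sym S.r-bd) (here refl)))
    where
    S : Split t a b d
    S = split a≢b (d≢b ∘ ≡.sym) d≢a t vt a∈ b∈ d∈
    module S = Split S

  classify : ∀ t {a b} → a ≢ b → Classifier a b t
  classify t = classify-acc t (<-wellFounded (weight t))

-- Assembling X from three 4-cycles

-- Vertices in no branch set are deleted; disjointness makes the branch set found by the search the
-- right one.
minor-model : ∀ {k n} {F : Graph k} {G : Graph n} (L : Fin k → List (Fin n)) →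
  (∀ x → ∃[ u ] u ∈ L x) → (∀ x → Conn G (L x)) →
  (∀ {x y u} → u ∈ L x → u ∈ L y → x ≡ y) →
  (∀ x y → Edge F x y → ∃[ u ] ∃[ w ] (u ∈ L x × w ∈ L y × Edge G u w)) →
  (∀ {x y u w} → x ≢ y → u ∈ L x → w ∈ L y → Edge G u w → Edge F x y) →
  InducedMinor F G
minor-model {k} {n} {F} {G} L inhabited conn disj edge⁺ edge⁻ =
  (λ u → φ (any? (λ x → u ∈? L x))) ,
  (λ x → let (u , u∈) = inhabited x in u , to u∈) ,
  (λ x u v p q → path-map to (conn x u v (from p) (from q))) ,
  λ x y x≢y →
    (λ e → let (u , w , u∈ , w∈ , e′) = edge⁺ x y e in u , w , to u∈ , to w∈ , e′) ,
    (λ (u , w , p , q , e) → edge⁻ x≢y (from p) (from q) e)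
  where
  φ : ∀ {u} → Dec (∃[ x ] u ∈ L x) → Maybe (Fin k)
  φ (yes (x , _)) = just x
  φ (no _)        = nothing
  to : ∀ {u x} → u ∈ L x → φ (any? (λ x → u ∈? L x)) ≡ just x
  to {u} {x} u∈ with any? (λ x → u ∈? L x)
  ... | yes (y , u∈′) = cong just (disj u∈′ u∈)
  ... | no ∄          = ⊥-elim (∄ (x , u∈))
  from : ∀ {u x} → φ (any? (λ x → u ∈? L x)) ≡ just x → u ∈ L x
  from {u} eq with any? (λ x → u ∈? L x)
  from refl | yes (_ , u∈) = u∈

bool-any? : ∀ {P : Bool → Set} → (∀ b → Dec (P b)) → Dec (∃ P)
bool-any? P? = map′ [ (false ,_) , (true ,_) ]′ (λ { (false , p) → inj₁ p ; (true , p) → inj₂ p })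
  (P? false ⊎-dec P? true)

next : Fin 3 → Fin 3
next 0F = 1F
next 1F = 2F
next 2F = 0F

hub : Fin 3 → Fin 9
hub 0F = 0F
hub 1F = 2F
hub 2F = 4F

side : Fin 3 → Bool → Fin 9
side 0F false = 1F
side 0F true  = 6F
side 1F false = 3F
side 1F true  = 7F
side 2F false = 5F
side 2F true  = 8F

-- X is read as a ring of three 4-cycles; the end `true` of each is the end `false` of the next one.
label : Fin 3 → Role → Fin 9
label i (end false) = hub i
label i (end true)  = hub (next i)
label i (mid j)     = side i j

label-edge : ∀ i x y → Edge X (label i (end x)) (label i (mid y))
label-edge 0F false false = refl
label-edge 0F false true  = refl
label-edge 0F true  false = refl
label-edge 0F true  true  = refl
label-edge 1F false false = refl
label-edge 1F false true  = refl
label-edge 1F true  false = refl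
label-edge 1F true  true  = refl
label-edge 2F false false = refl
label-edge 2F false true  = refl
label-edge 2F true  false = refl
label-edge 2F true  true  = refl

abstract
  -- A finite check by decision procedure; `abstract` keeps it from being unfolded later.
  edge-label : ∀ x y → Edge X x y → ∃[ i ] ∃[ p ] ∃[ q ]
    ((label i (end p) ≡ x × label i (mid q) ≡ y) ⊎ (label i (end p) ≡ y × label i (mid q) ≡ x))
  edge-label = from-yes (all? λ x → all? λ y → edge? {G = X} x y →-dec
    any? λ i → bool-any? λ p → bool-any? λ q →
      (label i (end p) ≟ x ×-dec label i (mid q) ≟ y) ⊎-dec (label i (end p) ≟ y ×-dec label i (mid q) ≟ x))

module Hexagon {n : ℕ} (G : Graph n) where

  open Surgery G
  open Classification G

  module _ (U : Fin 3 → Fin n → Set) (κ : Fin 3 → Fin n)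
    (S : ∀ j → Square (U j) (κ j) (κ (next j)))
    (share : ∀ j {u} → U j u → U (next j) u → u ≡ κ (next j))
    (together : ∀ {u w} → E u w → ∃[ j ] (U j u × U j w)) where

    private
      module S j = Square (S j)

    L : Fin 9 → List (Fin n)
    L 0F = S.set 0F (end false) ++ S.set 2F (end true)
    L 1F = S.set 0F (mid false)
    L 2F = S.set 1F (end false) ++ S.set 0F (end true)
    L 3F = S.set 1F (mid false)
    L 4F = S.set 2F (end false) ++ S.set 1F (end true)
    L 5F = S.set 2F (mid false)
    L 6F = S.set 0F (mid true)
    L 7F = S.set 1F (mid true)
    L 8F = S.set 2F (mid true)

    L⁻ : ∀ x {u} → u ∈ L x → ∃[ j ] ∃[ r ] (label j r ≡ x × u ∈ S.set j r)
    L⁻ 0F p = [ (λ q → 0F , end false , refl , q) , (λ q → 2F , end true , refl , q) ]′ (∈-++⁻ (S.set 0F (end false)) p)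
    L⁻ 1F p = 0F , mid false , refl , p
    L⁻ 2F p = [ (λ q → 1F , end false , refl , q) , (λ q → 0F , end true , refl , q) ]′ (∈-++⁻ (S.set 1F (end false)) p)
    L⁻ 3F p = 1F , mid false , refl , p
    L⁻ 4F p = [ (λ q → 2F , end false , refl , q) , (λ q → 1F , end true , refl , q) ]′ (∈-++⁻ (S.set 2F (end false)) p)
    L⁻ 5F p = 2F , mid false , refl , p
    L⁻ 6F p = 0F , mid true , refl , p
    L⁻ 7F p = 1F , mid true , refl , p
    L⁻ 8F p = 2F , mid true , refl , p

    L⁺ : ∀ j r {u} → u ∈ S.set j r → u ∈ L (label j r)
    L⁺ 0F (end false) p = ∈-++⁺ˡ p
    L⁺ 0F (end true)  p = ∈-++⁺ʳ (S.set 1F (end false)) p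
    L⁺ 0F (mid false) p = p
    L⁺ 0F (mid true)  p = p
    L⁺ 1F (end false) p = ∈-++⁺ˡ p
    L⁺ 1F (end true)  p = ∈-++⁺ʳ (S.set 2F (end false)) p
    L⁺ 1F (mid false) p = p
    L⁺ 1F (mid true)  p = p
    L⁺ 2F (end false) p = ∈-++⁺ˡ p
    L⁺ 2F (end true)  p = ∈-++⁺ʳ (S.set 0F (end false)) p
    L⁺ 2F (mid false) p = p
    L⁺ 2F (mid true)  p = p

    L-conn : ∀ x → Conn G (L x)
    L-conn 0F = conn-++ (S.conn 0F (end false)) (S.conn 2F (end true)) (S.a∈ 0F) (S.b∈ 2F)
    L-conn 1F = S.conn 0F (mid false)
    L-conn 2F = conn-++ (S.conn 1F (end false)) (S.conn 0F (end true)) (S.a∈ 1F) (S.b∈ 0F)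
    L-conn 3F = S.conn 1F (mid false)
    L-conn 4F = conn-++ (S.conn 2F (end false)) (S.conn 1F (end true)) (S.a∈ 2F) (S.b∈ 1F)
    L-conn 5F = S.conn 2F (mid false)
    L-conn 6F = S.conn 0F (mid true)
    L-conn 7F = S.conn 1F (mid true)
    L-conn 8F = S.conn 2F (mid true)

    -- Consecutive parts share only the corner between them, which is an end of both squares and
    -- carries the same label in both.
    forward : ∀ j r {u} → u ∈ S.set j r → U (next j) u →
      ∃[ s ] (u ∈ S.set (next j) s × label (next j) s ≡ label j r)
    forward j r p x with share j (S.sub j r p) x
    ... | refl with S.disj j r (end true) p (S.b∈ j)
    ...   | refl = end false , S.a∈ (next j) , refl

    backward : ∀ i r {u} → u ∈ S.set (next i) r → U i u →
      ∃[ s ] (u ∈ S.set i s × label i s ≡ label (next i) r)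
    backward i r p x with share i x (S.sub (next i) r p)
    ... | refl with S.disj (next i) r (end false) p (S.a∈ (next i))
    ...   | refl = end true , S.b∈ i , refl

    -- Any two of three parts are consecutive in one direction or the other. Hence vertices known in
    -- different squares can be compared within one, for disjointness as well as for edges.
    move : ∀ i j r {u} → u ∈ S.set j r → U i u → ∃[ s ] (u ∈ S.set i s × label i s ≡ label j r)
    move 0F 0F r p _ = r , p , refl
    move 0F 1F r p x = backward 0F r p x
    move 0F 2F r p x = forward 2F r p x
    move 1F 0F r p x = forward 0F r p x
    move 1F 1F r p _ = r , p , refl
    move 1F 2F r p x = backward 1F r p x
    move 2F 0F r p x = backward 2F r p x
    move 2F 1F r p x = forward 1F r p x
    move 2F 2F r p _ = r , p , refl

    local-edge : ∀ i r s {u w} → u ∈ S.set i r → w ∈ S.set i s → E u w →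
      label i r ≢ label i s → Edge X (label i r) (label i s)
    local-edge i (end x)     (mid y)     _ _ _ _ = label-edge i x y
    local-edge i (mid y)     (end x)     _ _ _ _ = edge-sym {G = X} {label i (end x)} {label i (mid y)} (label-edge i x y)
    local-edge i (end false) (end true)  p q e _ = ⊥-elim (S.apart-end i p q e)
    local-edge i (end true)  (end false) p q e _ = ⊥-elim (S.apart-end i q p (esym e))
    local-edge i (mid false) (mid true)  p q e _ = ⊥-elim (S.apart-mid i p q e)
    local-edge i (mid true)  (mid false) p q e _ = ⊥-elim (S.apart-mid i q p (esym e))
    local-edge i (end false) (end false) _ _ _ d = ⊥-elim (d refl)
    local-edge i (end true)  (end true)  _ _ _ d = ⊥-elim (d refl)
    local-edge i (mid false) (mid false) _ _ _ d = ⊥-elim (d refl)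
    local-edge i (mid true)  (mid true)  _ _ _ d = ⊥-elim (d refl)

    -- Every edge of `G` lies inside one part, where the apartness conditions of a single square
    -- decide which branch sets it may join.
    hexagon : InducedMinor X G
    hexagon = minor-model {F = X} L inhabited L-conn disj edge⁺ edge⁻
      where
      inhabited : ∀ x → ∃[ u ] u ∈ L x
      inhabited 0F = κ 0F , L⁺ 0F (end false) (S.a∈ 0F)
      inhabited 1F = let (_ , w , _ , w∈ , _) = S.link 0F false false in w , w∈
      inhabited 2F = κ 1F , L⁺ 1F (end false) (S.a∈ 1F)
      inhabited 3F = let (_ , w , _ , w∈ , _) = S.link 1F false false in w , w∈
      inhabited 4F = κ 2F , L⁺ 2F (end false) (S.a∈ 2F)
      inhabited 5F = let (_ , w , _ , w∈ , _) = S.link 2F false false in w , w∈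
      inhabited 6F = let (_ , w , _ , w∈ , _) = S.link 0F false true in w , w∈
      inhabited 7F = let (_ , w , _ , w∈ , _) = S.link 1F false true in w , w∈
      inhabited 8F = let (_ , w , _ , w∈ , _) = S.link 2F false true in w , w∈
      disj : ∀ {x y u} → u ∈ L x → u ∈ L y → x ≡ y
      disj {x} {y} p q with L⁻ x p | L⁻ y q
      ... | i , r , refl , p′ | j , s , refl , q′ with move i j s q′ (S.sub i r p′)
      ...   | s′ , q″ , eq = ≡.trans (cong (label i) (S.disj i r s′ p′ q″)) eq
      edge⁺ : ∀ x y → Edge X x y → ∃[ u ] ∃[ w ] (u ∈ L x × w ∈ L y × E u w)
      edge⁺ x y e with edge-label x y e
      ... | i , a , b , inj₁ (refl , refl) = let (u , w , u∈ , w∈ , e′) = S.link i a b in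
            u , w , L⁺ i (end a) u∈ , L⁺ i (mid b) w∈ , e′
      ... | i , a , b , inj₂ (refl , refl) = let (u , w , u∈ , w∈ , e′) = S.link i a b in
            w , u , L⁺ i (mid b) w∈ , L⁺ i (end a) u∈ , esym e′
      edge⁻ : ∀ {x y u w} → x ≢ y → u ∈ L x → w ∈ L y → E u w → Edge X x y
      edge⁻ {x} {y} x≢y p q e with L⁻ x p | L⁻ y q | together e
      ... | j , r , refl , p′ | k , s , refl , q′ | i , Uu , Uw
        with move i j r p′ Uu | move i k s q′ Uw
      ...   | r′ , p″ , eq | s′ , q″ , eq′ =
        subst₂ (Edge X) eq eq′ (local-edge i r′ s′ p″ q″ e
          (λ z → x≢y (≡.trans (≡.sym eq) (≡.trans z eq′))))

-- Removing independent bags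

module Elimination {n : ℕ} (G : Graph n) (no-X : ¬ InducedMinor X G) where

  open Surgery G
  open Classification G
  open Hexagon G

  Better : Tree n → Set
  Better t = ∃[ t′ ] (Valid 3 t′ × (∀ {u w} → Rel u w → Cov t u w → Cov t′ u w) × zeros t′ < zeros t)

  module _ {t : Tree n} {a b d : Fin n} (b≢d : b ≢ d) (d≢a : d ≢ a) (S : Split t a b d)
    (bad≡ : bad (root t) ≡ 1) where

    open Split S
    open ≤-Reasoning
    open +-*-Solver

    private
      -- The bag `{a, b, d}` belongs to none of the three parts; its unit is the gain of both
      -- replacements below.
      count : suc (zeros ab + (zeros bd + zeros da)) ≤ zeros t
      count = subst (λ z → z + (zeros ab + (zeros bd + zeros da)) ≤ zeros t) bad≡ cnt

      cov₃ : ∀ {t′} → (∀ {u w} → Rel u w → Cov ab u w → Cov t′ u w) →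
        (∀ {u w} → Cov bd u w → Cov t′ u w) → (∀ {u w} → Cov da u w → Cov t′ u w) →
        ∀ {u w} → Rel u w → Cov t u w → Cov t′ u w
      cov₃ f g h r c = [ f r , [ g , h ]′ ]′ (cov c)

      b∈bd : b ∈ root bd
      b∈bd = subst (b ∈_) (≡.sym r-bd) (here refl)
      d∈bd : d ∈ root bd
      d∈bd = subst (d ∈_) (≡.sym r-bd) (there (here refl))
      d∈da : d ∈ root da
      d∈da = subst (d ∈_) (≡.sym r-da) (here refl)
      a∈da : a ∈ root da
      a∈da = subst (a ∈_) (≡.sym r-da) (there (here refl))

    -- Once `{a, b, d}` is dropped, the parts behind `bd` and `da` are joined at `d`, and the halves
    -- of the cut hang at the root of `da` for `a` and at the root of `bd` for `b`.
    improve-cut : Cut ab a b → Better t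
    improve-cut C = tree₂ , valid-graft tree₁ (valid-graft tree₀ v₀ C.va p adh₁) C.vb q adh₂
      , cov₃ (λ r c → [ Cov-graftˡ tree₁ q ∘ Cov-graftʳ tree₀ p , Cov-graftʳ tree₁ q ]′ (C.cov r c))
          (Cov-graftˡ tree₁ q ∘ Cov-graftˡ tree₀ p ∘ Cov-joinˡ)
          (Cov-graftˡ tree₁ q ∘ Cov-graftˡ tree₀ p ∘ Cov-joinʳ)
      , (begin
          suc (zeros tree₂)                                             ≡⟨ cong suc (zeros-graft tree₁ q) ⟩
          suc (zeros tree₁ + zeros C.tb)                                ≡⟨ cong (λ z → suc (z + zeros C.tb)) (zeros-graft tree₀ p) ⟩
          suc (((zeros bd + zeros da) + zeros C.ta) + zeros C.tb)       ≡⟨ cong suc (solve 3 (λ x y z → (x :+ y) :+ z := (y :+ z) :+ x) refl (zeros bd + zeros da) (zeros C.ta) (zeros C.tb)) ⟩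
          suc ((zeros C.ta + zeros C.tb) + (zeros bd + zeros da))       ≤⟨ s≤s (+-monoˡ-≤ _ C.cnt) ⟩
          suc (zeros ab + (zeros bd + zeros da))                        ≤⟨ count ⟩
          zeros t                                                       ∎)
      where
      module C = Cut C
      tree₀ : Tree n
      tree₀ = join bd da
      v₀ : Valid 3 tree₀
      v₀ = v-bd , v-da , λ { v x y → subst (λ z → z ∈ root bd × z ∈ root da) (≡.sym (i-d x y)) (d∈bd , d∈da) }
      p : At tree₀ (root da)
      p = inj₂ (at-root da)
      tree₁ : Tree n
      tree₁ = graft tree₀ C.ta p
      q : At tree₁ (root bd)
      q = at-graftˡ tree₀ p (inj₁ (at-root bd))
      tree₂ : Tree n
      tree₂ = graft tree₁ C.tb q
      adh₁ : ∀ v → V tree₀ v → V C.ta v → v ∈ root da × v ∈ root C.ta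
      adh₁ v x y with V-join⁻ x
      ... | inj₁ z with i-b (C.sa y) z
      ...   | refl = ⊥-elim (C.b∉a y)
      adh₁ v x y | inj₂ z with i-a z (C.sa y)
      ...   | refl = a∈da , C.a∈
      adh₂ : ∀ v → V tree₁ v → V C.tb v → v ∈ root bd × v ∈ root C.tb
      adh₂ v x y with V-graft⁻ tree₀ p x
      ... | inj₂ z = ⊥-elim (C.dis z y)
      ... | inj₁ x′ with V-join⁻ x′
      ...   | inj₁ z with i-b (C.sb y) z
      ...     | refl = b∈bd , C.b∈
      adh₂ v x y | inj₁ x′ | inj₂ z with i-a z (C.sb y)
      ...     | refl = ⊥-elim (C.a∉b y)

    -- With apex `d` the fan has bags containing `b, d` and `a, d`; they take over from the root bag
    -- the task of carrying the two other parts.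
    improve-ladder : Fan ab a b d → Better t
    improve-ladder F = tree₂ , valid-graft tree₁ (valid-graft F.tree F.valid v-bd p adh₁) v-da q adh₂
      , cov₃ (λ r → Cov-graftˡ tree₁ q ∘ Cov-graftˡ F.tree p ∘ F.cov r)
          (Cov-graftˡ tree₁ q ∘ Cov-graftʳ F.tree p) (Cov-graftʳ tree₁ q)
      , (begin
          suc (zeros tree₂)                                 ≡⟨ cong suc (zeros-graft tree₁ q) ⟩
          suc (zeros tree₁ + zeros da)                      ≡⟨ cong (λ z → suc (z + zeros da)) (zeros-graft F.tree p) ⟩
          suc ((zeros F.tree + zeros bd) + zeros da)        ≡⟨ cong suc (+-assoc (zeros F.tree) _ _) ⟩
          suc (zeros F.tree + (zeros bd + zeros da))        ≤⟨ s≤s (+-monoˡ-≤ _ F.cnt) ⟩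
          suc (zeros ab + (zeros bd + zeros da))            ≤⟨ count ⟩
          zeros t                                           ∎)
      where
      module F = Fan F
      p : At F.tree (proj₁ F.bc)
      p = proj₁ (proj₂ F.bc)
      tree₁ : Tree n
      tree₁ = graft F.tree bd p
      q : At tree₁ (proj₁ F.ac)
      q = at-graftˡ F.tree p (proj₁ (proj₂ F.ac))
      tree₂ : Tree n
      tree₂ = graft tree₁ da q
      at-bd : ∀ {v} → v ≡ b ⊎ v ≡ d → v ∈ proj₁ F.bc × v ∈ root bd
      at-bd (inj₁ refl) = proj₁ (proj₂ (proj₂ F.bc)) , b∈bd
      at-bd (inj₂ refl) = proj₂ (proj₂ (proj₂ F.bc)) , d∈bd
      at-ad : ∀ {v} → v ≡ a ⊎ v ≡ d → v ∈ proj₁ F.ac × v ∈ root da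
      at-ad (inj₁ refl) = proj₁ (proj₂ (proj₂ F.ac)) , a∈da
      at-ad (inj₂ refl) = proj₂ (proj₂ (proj₂ F.ac)) , d∈da
      adh₁ : ∀ v → V F.tree v → V bd v → v ∈ proj₁ F.bc × v ∈ root bd
      adh₁ v x y = at-bd (Sum.map (λ z → i-b z y) id (F.sub x))
      adh₂ : ∀ v → V tree₁ v → V da v → v ∈ proj₁ F.ac × v ∈ root da
      adh₂ v x y with V-graft⁻ F.tree p x
      ... | inj₁ z = at-ad (Sum.map (i-a y) id (F.sub z))
      ... | inj₂ z = at-ad (inj₂ (i-d z y))

    improve : Class ab a b → Better t ⊎ Square (V ab) a b
    improve (cut C)      = inj₁ (improve-cut C)
    improve (ladder _ f) = inj₁ (improve-ladder (f d (split-∌ b≢d S)))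
    improve (double _ s) = inj₂ s

  Covers : Tree n → Set
  Covers t = ∀ {u w} → Rel u w → Cov t u w

  bad-triple : ∀ B → bad B ≢ 0 → Unique B → ∃[ a ] ∃[ b ] ∃[ d ]
    (bad B ≡ 1 × a ≢ b × b ≢ d × d ≢ a × a ∈ B × b ∈ B × d ∈ B)
  bad-triple []                ≢0 _ = ⊥-elim (≢0 refl)
  bad-triple (_ ∷ [])          ≢0 _ = ⊥-elim (≢0 refl)
  bad-triple (_ ∷ _ ∷ [])      ≢0 _ = ⊥-elim (≢0 refl)
  bad-triple (a ∷ b ∷ d ∷ B) ≢0 ((a≢b ∷ a≢d ∷ _) ∷ (b≢d ∷ _) ∷ _)
    with adj G a b ∨ (adj G b d ∨ adj G d a)
  ... | true  = ⊥-elim (≢0 refl)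
  ... | false = a , b , d , refl , a≢b , b≢d , a≢d ∘ ≡.sym , here refl , there (here refl) , there (there (here refl))

  step-down : ∀ t → Valid 3 t → Covers t → bad (root t) ≢ 0 → Better t
  step-down t vt covers ≢0 with bad-triple (root t) ≢0 (proj₁ (valid-at t vt (at-root t)))
  ... | a , b , d , bad≡ , a≢b , b≢d , d≢a , a∈ , b∈ , d∈ = result
    where
    S : Split t a b d
    S = split a≢b b≢d d≢a t vt a∈ b∈ d∈
    open Split S
    full : Full t
    full _ _ e = covers (inj₂ e)
    class : ∀ {x y z} → x ≢ y → (R : Split t x y z) → Class (Split.ab R) x y
    class x≢y R = classify (Split.ab R) x≢y (Split.v-ab R) (full-split full R)
      (subst (_ ∈_) (≡.sym (Split.r-ab R)) (here refl)) (subst (_ ∈_) (≡.sym (Split.r-ab R)) (there (here refl)))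
    result : Better t
    result with improve b≢d d≢a S bad≡ (class a≢b S)
              | improve d≢a a≢b (rotate S) bad≡ (class b≢d (rotate S))
              | improve a≢b b≢d (rotate (rotate S)) bad≡ (class d≢a (rotate (rotate S)))
    ... | inj₁ r | _ | _ = r
    ... | _ | inj₁ r | _ = r
    ... | _ | _ | inj₁ r = r
    ... | inj₂ s₀ | inj₂ s₁ | inj₂ s₂ = ⊥-elim (no-X (hexagon U κ squares share together))
      where
      U : Fin 3 → Fin n → Set
      U 0F = V ab
      U 1F = V bd
      U 2F = V da
      κ : Fin 3 → Fin n
      κ 0F = a
      κ 1F = b
      κ 2F = d
      squares : ∀ j → Square (U j) (κ j) (κ (next j))
      squares 0F = s₀
      squares 1F = s₁
      squares 2F = s₂
      share : ∀ j {u} → U j u → U (next j) u → u ≡ κ (next j)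
      share 0F = i-b
      share 1F = i-d
      share 2F = i-a
      together : ∀ {u w} → E u w → ∃[ j ] (U j u × U j w)
      together e with cov (covers (inj₂ e))
      ... | inj₁ c        = 0F , covˡ c , covʳ c
      ... | inj₂ (inj₁ c) = 1F , covˡ c , covʳ c
      ... | inj₂ (inj₂ c) = 2F , covˡ c , covʳ c

  find-bad : ∀ t → zeros t ≡ 0 ⊎ ∃[ B ] (At t B × bad B ≢ 0)
  find-bad (leaf B) with bad B in eq
  ... | zero  = inj₁ refl
  ... | suc _ = inj₂ (B , refl , λ p → 1+n≢0 (≡.trans (≡.sym eq) p))
  find-bad (join t s) with find-bad t | find-bad s
  ... | inj₁ p            | inj₁ q            = inj₁ (cong₂ _+_ p q)
  ... | inj₂ (B , at , p) | _                 = inj₂ (B , inj₁ at , p)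
  ... | _                 | inj₂ (B , at , p) = inj₂ (B , inj₂ at , p)

  -- `step-down` works at the root, so the tree is rerooted at an independent bag first; this keeps
  -- the number of such bags.
  eliminate : ∀ t → Acc _<_ (zeros t) → Valid 3 t → Covers t →
    ∃[ t′ ] (Valid 3 t′ × Covers t′ × zeros t′ ≡ 0)
  eliminate t (acc rs) vt covers with find-bad t
  ... | inj₁ p = t , vt , covers , p
  ... | inj₂ (B , at , ≢0) =
    let (t′ , v′ , covers′ , lt) = step-down R.tree R.valid (λ r → R.Cov⁺ (covers r))
                                     (subst (λ C → bad C ≢ 0) (≡.sym R.root≡) ≢0)
    in eliminate t′ (rs (subst (zeros t′ <_) R.zeros≡ lt)) v′ (λ r → covers′ r (R.Cov⁺ (covers r)))
    where
    module R = Reroot (reroot t vt at)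

-- From tree decompositions to rooted trees of bags

members : ∀ {n} → Subset n → List (Fin n)
members []            = []
members (inside ∷ p)  = zero ∷ map suc (members p)
members (outside ∷ p) = map suc (members p)

∈-members⁺ : ∀ {n} {p : Subset n} {v} → v ∈ₛ p → v ∈ members p
∈-members⁺ {p = inside ∷ p}  here       = here refl
∈-members⁺ {p = inside ∷ p}  (there v∈) = there (∈-map⁺ suc (∈-members⁺ v∈))
∈-members⁺ {p = outside ∷ p} (there v∈) = ∈-map⁺ suc (∈-members⁺ v∈)

∈-members⁻ : ∀ {n} (p : Subset n) {v} → v ∈ members p → v ∈ₛ p
∈-members⁻ (inside ∷ p)  (here refl) = here
∈-members⁻ (inside ∷ p)  (there v∈) with ∈-map⁻ suc v∈
... | _ , w∈ , refl = there (∈-members⁻ p w∈)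
∈-members⁻ (outside ∷ p) v∈ with ∈-map⁻ suc v∈
... | _ , w∈ , refl = there (∈-members⁻ p w∈)

members-length : ∀ {n} (p : Subset n) → length (members p) ≡ ∣ p ∣
members-length []            = refl
members-length (inside ∷ p)  = cong suc (≡.trans (length-map suc (members p)) (members-length p))
members-length (outside ∷ p) = ≡.trans (length-map suc (members p)) (members-length p)

members-unique : ∀ {n} (p : Subset n) → Unique (members p)
members-unique []            = []
members-unique (inside ∷ p)  =
  All.tabulate (λ { v∈ refl → case-zero (∈-map⁻ suc v∈) }) ∷ Unique.map⁺ suc-injective (members-unique p)
  where
  case-zero : ∀ {n} {l : List (Fin n)} → ¬ (∃[ x ] (x ∈ l × Fin.zero ≡ suc x))
  case-zero (_ , _ , ())
members-unique (outside ∷ p) = Unique.map⁺ suc-injective (members-unique p)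

module _ {m : ℕ} {T : Graph m} where

  -- Lists the visited vertices, both ends included, so that absence of repetitions can be stated
  -- and cycles assembled.
  data Walk : Fin m → Fin m → List (Fin m) → Set where
    [_] : ∀ u → Walk u u (u ∷ [])
    _∷_ : ∀ {u w v l} → Edge T u w → Walk w v l → Walk u v (u ∷ l)

  suffix : ∀ {w v l u} → Walk w v l → u ∈ l →
    ∃[ l′ ] (Walk u v l′ × (Unique l → Unique l′) × (∀ {x} → x ∈ l′ → x ∈ l))
  suffix W@([ u ])   (here refl) = _ , W , id , id
  suffix W@(e ∷ _)   (here refl) = _ , W , id , id
  suffix (e ∷ W)     (there u∈)  =
    let (l′ , W′ , uniq , sub) = suffix W u∈ in l′ , W′ , (λ { (_ ∷ U) → uniq U }) , there ∘ sub

  simple : ∀ {P : Fin m → Set} {u v} → PathIn T P u v →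
    ∃[ l ] (Walk u v l × Unique l × (∀ {x} → x ∈ l → P x))
  simple (here p) = _ , [ _ ] , [] ∷ [] , λ { (here refl) → p }
  simple {u = u} (step p e r) with simple r
  ... | l , W , U , sub with u ∈? l
  ...   | yes u∈ = let (l′ , W′ , uniq , sub′) = suffix W u∈ in l′ , W′ , uniq U , sub ∘ sub′
  ...   | no u∉  = u ∷ l , e ∷ W , ¬Any⇒All¬ l u∉ ∷ U , λ { (here refl) → p ; (there x∈) → sub x∈ }

  walk-++ : ∀ {s z w u l l′} → Walk s z l → Edge T z w → Walk w u l′ → Walk s u (l ++ l′)
  walk-++ [ _ ]   e W′ = e ∷ W′
  walk-++ (f ∷ W) e W′ = f ∷ walk-++ W e W′

  walk-linked : ∀ {s u l x} → Walk s u l → Edge T u x → Linked (Edge T) (l ++ x ∷ [])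
  walk-linked [ _ ]         e = e ∷ [-]
  walk-linked (f ∷ [ _ ])   e = f ∷ e ∷ [-]
  walk-linked (f ∷ (g ∷ W)) e = f ∷ walk-linked (g ∷ W) e

  walk-length : ∀ {s u l} → Walk s u l → 1 ≤ length l
  walk-length [ _ ]   = s≤s z≤n
  walk-length (_ ∷ _) = s≤s z≤n

  first-entry : ∀ {P : Fin m → Set} (S : List (Fin m)) {x i} → PathIn T P x i → x ∉ S → i ∈ S →
    ∃[ w ] ∃[ z ] (PathIn T (_∉ S) x w × Edge T w z × z ∈ S × P z)
  first-entry S (here _) x∉ i∈ = ⊥-elim (x∉ i∈)
  first-entry S (step {w = w} p e r) x∉ i∈ with w ∈? S
  ... | yes w∈ = _ , w , here x∉ , e , w∈ , path-start r
  ... | no w∉  = let (w′ , z , q , f , z∈ , Pz) = first-entry S r w∉ i∈ in w′ , z , step x∉ e q , f , z∈ , Pz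

  -- Otherwise the path from u would close a cycle with the edge su and a path in S.
  gate : ¬ HasCycle T → ∀ {P : Fin m → Set} {S s u i} → Conn T S → s ∈ S → u ∉ S → Edge T s u →
    PathIn T P u i → i ∈ S → P s
  gate acyclic {S = S} {s} {u} conn s∈ u∉ e r i∈ with first-entry S r u∉ i∈
  ... | w , z , q , f , z∈ , Pz with simple (conn s z s∈ z∈) | simple (path-sym q)
  ...   | _ , [ _ ] , _ , _ | _ = Pz
  ...   | _ , W@(_∷_ {l = l} _ W₀) , U , sub | l′ , W′ , U′ , sub′ = ⊥-elim (acyclic
      (s , _ , subst (2 ≤_) (≡.sym (length-++ l)) (+-mono-≤ (walk-length W₀) (walk-length W′))
      , Unique.++⁺ U U′ (λ (x∈ , x∈′) → sub′ x∈′ (sub x∈))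
      , walk-linked (walk-++ W (edge-sym {G = T} f) W′) (edge-sym {G = T} e)))

module _ {n : ℕ} {G : Graph n} (D : TreeDecomp G) where

  private
    B : Fin (m D) → Bag n
    B i = members (bag D i)

  -- The portion of the decomposition tree absorbed so far. It is kept connected because only then
  -- does `gate` force a shared vertex into the bag where the next node is attached.
  record Grown (k : ℕ) : Set where
    field
      nodes : List (Fin (m D))
      conn  : Conn (T D) nodes
      tree  : Tree n
      valid : Valid k tree
      at⁺   : ∀ {i} → i ∈ nodes → At tree (B i)
      at⁻   : ∀ {C} → At tree C → ∃[ i ] (i ∈ nodes × C ≡ B i)

  module _ {k : ℕ} (width : ∀ i → ∣ bag D i ∣ ≤ k) where

    private
      leaf-valid : ∀ i → Valid k (leaf (B i))
      leaf-valid i = members-unique (bag D i) , subst (_≤ k) (≡.sym (members-length (bag D i))) (width i)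

    grow : (S : Grown k) {s u : Fin (m D)} → s ∈ Grown.nodes S → u ∉ Grown.nodes S → Edge (T D) s u → Grown k
    grow S {s} {u} s∈ u∉ e = record
      { nodes = u ∷ nodes
      ; conn = conn-edge conn-[ u ] conn (here refl) s∈ (edge-sym {G = T D} e)
      ; tree = graft tree (leaf (B u)) (at⁺ s∈)
      ; valid = valid-graft tree valid (leaf-valid u) (at⁺ s∈) adh
      ; at⁺ = λ { (here refl) → at-graftʳ tree (at⁺ s∈) refl ; (there i∈) → at-graftˡ tree (at⁺ s∈) (at⁺ i∈) }
      ; at⁻ = λ p → [ (λ q → let (i , i∈ , eq) = at⁻ q in i , there i∈ , eq)
                    , (λ eq → u , here refl , ≡.sym eq) ]′ (at-graft⁻ tree (at⁺ s∈) p)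
      }
      where
      open Grown S
      adh : ∀ v → V tree v → V (leaf (B u)) v → v ∈ B s × v ∈ B u
      adh v (C , p , v∈) (_ , refl , v∈′) with at⁻ p
      -- The nodes containing `v` connect `u` to the grown portion, and in a tree they can do so
      -- only through `s`.
      ... | i , i∈ , refl = ∈-members⁺ (gate (proj₂ (proj₂ (isTree D))) conn s∈ u∉ e
              (subtree D v u i (∈-members⁻ _ v∈′) (∈-members⁻ _ v∈)) i∈) , v∈′

    grow-along : (S : Grown k) {s i : Fin (m D)} → s ∈ Grown.nodes S → PathIn (T D) (λ _ → ⊤) s i →
      Σ (Grown k) λ S′ → i ∈ Grown.nodes S′ × (∀ {j} → j ∈ Grown.nodes S → j ∈ Grown.nodes S′)
    grow-along S s∈ (here _) = S , s∈ , id
    grow-along S s∈ (step {w = w} _ e r) with w ∈? Grown.nodes S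
    ... | yes w∈ = grow-along S w∈ r
    ... | no w∉  = let (S′ , i∈ , sub) = grow-along (grow S s∈ w∉ e) (here refl) r in S′ , i∈ , sub ∘ there

    grow-all : (l : List (Fin (m D))) (S : Grown k) {s : Fin (m D)} → s ∈ Grown.nodes S →
      Σ (Grown k) λ S′ → (∀ {j} → j ∈ l → j ∈ Grown.nodes S′) × (∀ {j} → j ∈ Grown.nodes S → j ∈ Grown.nodes S′)
    grow-all []      S s∈ = S , (λ ()) , id
    grow-all (i ∷ l) S {s} s∈ =
      let (S₁ , i∈ , sub₁) = grow-along S s∈ (proj₁ (proj₂ (isTree D)) s i tt tt)
          (S₂ , l∈ , sub₂) = grow-all l S₁ (sub₁ s∈)
      in S₂ , (λ { (here refl) → sub₂ i∈ ; (there j∈) → l∈ j∈ }) , sub₂ ∘ sub₁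

    to-tree : ∃[ t ] (Valid k t × (∀ i → At t (B i)) × (∀ {C} → At t C → ∃[ i ] C ≡ B i))
    to-tree = tree , valid , (λ i → at⁺ (proj₁ (proj₂ grown) (∈-allFin i))) ,
      λ p → let (i , _ , eq) = at⁻ p in i , eq
      where
      first : ∀ {m} → 1 ≤ m → Fin m
      first (s≤s _) = zero
      i₀ : Fin (m D)
      i₀ = first (proj₁ (isTree D))
      start : Grown k
      start = record
        { nodes = i₀ ∷ [] ; conn = conn-[ i₀ ] ; tree = leaf (B i₀) ; valid = leaf-valid i₀
        ; at⁺ = λ { (here refl) → refl } ; at⁻ = λ { refl → i₀ , here refl , refl } }
      grown : Σ (Grown k) λ S → (∀ {j} → j ∈ allFin (m D) → j ∈ Grown.nodes S) × (∀ {j} → j ∈ i₀ ∷ [] → j ∈ Grown.nodes S)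
      grown = grow-all (allFin (m D)) start (here refl)
      open Grown (proj₁ grown)

-- From rooted trees of bags back to tree decompositions

module _ {m : ℕ} {T : Graph m} where

  last-edge : ∀ {x} p l → Linked (Edge T) (p ∷ l ++ x ∷ []) → ∃[ q ] (q ∈ p ∷ l × Edge T q x)
  last-edge p []       (e ∷ _) = p , here refl , e
  last-edge p (p′ ∷ l) (_ ∷ L) = let (q , q∈ , e) = last-edge p′ l L in q , there q∈ , e

  -- The alternative `2 ≤ length xs` is for the initial call, where `p` is `x` itself; afterwards
  -- the predecessor differs from `x`.
  inner-neighbours : ∀ {x y} p xs → Linked (Edge T) (p ∷ xs ++ x ∷ []) → Unique (p ∷ xs) →
    All (x ≢_) xs → p ≢ x ⊎ 2 ≤ length xs → y ∈ xs → ∃[ q ] ∃[ r ] (Edge T y q × Edge T y r × q ≢ r)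
  inner-neighbours {x} p (y ∷ [])     (e ∷ f ∷ _) _ _ (inj₁ p≢x) (here refl) =
    p , x , edge-sym {G = T} e , f , p≢x
  inner-neighbours p (y ∷ [])         _ _ _ (inj₂ (s≤s ())) (here refl)
  inner-neighbours p (y ∷ q ∷ xs)     (e ∷ f ∷ _) ((_ ∷ p≢q ∷ _) ∷ _) _ _ (here refl) =
    p , q , edge-sym {G = T} e , f , p≢q
  inner-neighbours p (z ∷ xs) (_ ∷ L) (_ ∷ U) (x≢z ∷ x∉) _ (there y∈) =
    inner-neighbours z xs L U x∉ (inj₁ (x≢z ∘ ≡.sym)) y∈

  -- The reason why a new leaf, having a single neighbour, lies on no cycle.
  cycle-neighbours : ∀ {x xs y} → 2 ≤ length xs → Unique (x ∷ xs) → Linked (Edge T) (x ∷ xs ++ x ∷ []) →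
    y ∈ x ∷ xs → ∃[ q ] ∃[ r ] (Edge T y q × Edge T y r × q ≢ r)
  cycle-neighbours {x} {p ∷ p′ ∷ xs} _ (_ ∷ (p∉ ∷ _)) (e ∷ _ ∷ L) (here refl) =
    let (q , q∈ , f) = last-edge p′ xs L in p , q , e , edge-sym {G = T} f , All.lookup p∉ q∈
  cycle-neighbours {x} {xs} len U@(x∉ ∷ _) L (there y∈) = inner-neighbours x xs L U x∉ (inj₂ len) y∈
  cycle-neighbours {xs = []} () _ _ (here refl)
  cycle-neighbours {xs = _ ∷ []} (s≤s ()) _ _ (here refl)

add-leaf : ∀ {m} → Graph m → Fin m → Graph (suc m)
add-leaf {m} T i = record { adj = a ; sym = s ; irrefl = r }
  where
  a : Fin (suc m) → Fin (suc m) → Bool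
  a zero    zero    = false
  a zero    (suc v) = does (i ≟ v)
  a (suc u) zero    = does (i ≟ u)
  a (suc u) (suc v) = adj T u v
  s : ∀ u v → a u v ≡ a v u
  s zero    zero    = refl
  s zero    (suc v) = refl
  s (suc u) zero    = refl
  s (suc u) (suc v) = Defs.sym T u v
  r : ∀ u → a u u ≡ false
  r zero    = refl
  r (suc u) = irrefl T u

module _ {m : ℕ} {T : Graph m} {i : Fin m} where

  private
    T⁺ : Graph (suc m)
    T⁺ = add-leaf T i

  leaf-edge : Edge T⁺ zero (suc i)
  leaf-edge = dec-true (i ≟ i) refl

  leaf-neighbour : ∀ {q} → Edge T⁺ zero q → q ≡ suc i
  leaf-neighbour {suc v} e with i ≟ v
  ... | yes refl = refl
  leaf-neighbour {suc v} () | no _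

  path-suc : ∀ {P : Fin m → Set} {Q : Fin (suc m) → Set} → (∀ {x} → P x → Q (suc x)) →
    ∀ {u v} → PathIn T P u v → PathIn T⁺ Q (suc u) (suc v)
  path-suc f (here p)     = here (f p)
  path-suc f (step p e r) = step (f p) e (path-suc f r)

  connected-leaf : ∀ {P : Fin (suc m) → Set} → ConnectedSet T (P ∘ suc) →
    (∀ j → P zero → P (suc j) → P (suc i)) → ConnectedSet T⁺ P
  connected-leaf c h zero    zero    p q = here p
  connected-leaf c h zero    (suc v) p q = step p leaf-edge (path-suc id (c i v (h v p q) q))
  connected-leaf c h (suc u) zero    p q = path-sym (step q leaf-edge (path-suc id (c i u (h u q p) p)))
  connected-leaf c h (suc u) (suc v) p q = path-suc id (c u v p q)

  unsuc : ∀ (l : List (Fin (suc m))) → zero ∉ l → ∃[ l′ ] l ≡ map suc l′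
  unsuc []          _  = [] , refl
  unsuc (zero ∷ l)  z∉ = ⊥-elim (z∉ (here refl))
  unsuc (suc x ∷ l) z∉ = let (l′ , eq) = unsuc l (z∉ ∘ there) in x ∷ l′ , cong (suc x ∷_) eq

  isTree-leaf : IsTree T → IsTree T⁺
  isTree-leaf (_ , conn , acyclic) = s≤s z≤n , connected-leaf (λ u v _ _ → conn u v tt tt) (λ _ _ _ → tt) , no-cycle
    where
    no-cycle : ¬ HasCycle T⁺
    no-cycle (x , xs , len , U , L) with zero ∈? (x ∷ xs)
    ... | yes z∈ = let (q , r , e , f , q≢r) = cycle-neighbours {T = T⁺} len U L z∈ in
                   q≢r (≡.trans (leaf-neighbour e) (≡.sym (leaf-neighbour f)))
    ... | no z∉ with unsuc (x ∷ xs) z∉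
    ...   | x′ ∷ xs′ , refl = acyclic (x′ , xs′ , subst (2 ≤_) (length-map suc xs′) len , Unique.map⁻ U
            , Linked.map⁻ (subst (Linked (Edge T⁺)) (cong (suc x′ ∷_) (≡.sym (map-++ suc xs′ (x′ ∷ [])))) L))

-- Covering conditions are left out while nodes are still being added; they are recovered at the end
-- by matching the bags with those of a `Tree`.
record ListDecomp (n : ℕ) : Set where
  field
    size    : ℕ
    shape   : Graph size
    tree    : IsTree shape
    bags    : Fin size → Bag n
    joined  : ∀ v → ConnectedSet shape (λ i → v ∈ bags i)

module _ {n : ℕ} where

  -- A node with empty bag shares no vertex with anything, so every tree can be attached to it.
  point : ListDecomp n
  point = record
    { size = 1
    ; shape = record { adj = λ _ _ → false ; sym = λ _ _ → refl ; irrefl = λ _ → refl }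
    ; tree = s≤s z≤n , (λ { zero zero _ _ → here tt }) , λ where
        (_ , [] , () , _)
        (_ , _ ∷ _ , _ , _ , () ∷ _)
    ; bags = λ _ → []
    ; joined = λ { v zero zero () }
    }

  extend : (D : ListDecomp n) (i : Fin (ListDecomp.size D)) (B : Bag n) →
    (∀ v j → v ∈ B → v ∈ ListDecomp.bags D j → v ∈ ListDecomp.bags D i) → ListDecomp n
  extend D i B h = record
    { size = suc size ; shape = add-leaf shape i ; tree = isTree-leaf tree
    ; bags = λ { zero → B ; (suc j) → bags j }
    ; joined = λ v → connected-leaf (joined v) (λ j → h v j)
    }
    where
    open ListDecomp D

  record Attached (D : ListDecomp n) (t : Tree n) : Set where
    private
      module D = ListDecomp D
    field
      result : ListDecomp n
    open ListDecomp result public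
    field
      old  : ∀ j → ∃[ j′ ] bags j′ ≡ D.bags j
      top  : ∃[ r ] bags r ≡ root t
      at⁺  : ∀ {B} → At t B → ∃[ j ] bags j ≡ B
      at⁻  : ∀ j → (∃[ j′ ] bags j ≡ D.bags j′) ⊎ At t (bags j)

  attach : ∀ {k} (D : ListDecomp n) (i : Fin (ListDecomp.size D)) (t : Tree n) → Valid k t →
    (∀ v j → v ∈ ListDecomp.bags D j → V t v → v ∈ ListDecomp.bags D i × v ∈ root t) → Attached D t
  attach D i (leaf B) _ h = record
    { result = extend D i B (λ v j v∈B v∈j → proj₁ (h v j v∈j (B , refl , v∈B)))
    ; old = λ j → suc j , refl
    ; top = zero , refl
    ; at⁺ = λ { refl → zero , refl }
    ; at⁻ = λ { zero → inj₂ refl ; (suc j) → inj₁ (j , refl) }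
    }
  attach D i (join t s) (vt , vs , adh) h = record
    { result = A₂.result
    ; old = λ j → let (j₁ , eq₁) = A₁.old j ; (j₂ , eq₂) = A₂.old j₁ in j₂ , ≡.trans eq₂ eq₁
    ; top = let (r , eq) = A₁.top ; (r′ , eq′) = A₂.old r in r′ , ≡.trans eq′ eq
    ; at⁺ = [ (λ p → let (j , eq) = A₁.at⁺ p ; (j′ , eq′) = A₂.old j in j′ , ≡.trans eq′ eq) , A₂.at⁺ ]′
    ; at⁻ = at⁻
    }
    where
    A₁ : Attached D t
    A₁ = attach D i t vt (λ v j v∈ x → h v j v∈ (V-joinˡ x))
    module A₁ = Attached A₁
    h₂ : ∀ v j → v ∈ A₁.bags j → V s v → v ∈ A₁.bags (proj₁ A₁.top) × v ∈ root s
    h₂ v j v∈ x = subst (v ∈_) (≡.sym (proj₂ A₁.top)) (proj₁ both) , proj₂ both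
      where
      Vt : V t v
      Vt with A₁.at⁻ j
      -- An old bag sharing `v` with `s` forces `v` into the root of the whole join, which is the
      -- root of `t`.
      ... | inj₁ (j′ , eq) = root⇒V t (proj₂ (h v j′ (subst (v ∈_) eq v∈) (V-joinʳ x)))
      ... | inj₂ p         = A₁.bags j , p , v∈
      both : v ∈ root t × v ∈ root s
      both = adh v Vt x
    A₂ : Attached A₁.result s
    A₂ = attach A₁.result (proj₁ A₁.top) s vs h₂
    module A₂ = Attached A₂
    at⁻ : ∀ j → (∃[ j′ ] A₂.bags j ≡ ListDecomp.bags D j′) ⊎ At (join t s) (A₂.bags j)
    at⁻ j with A₂.at⁻ j
    ... | inj₂ p = inj₂ (inj₂ p)
    ... | inj₁ (j₁ , eq) with A₁.at⁻ j₁
    ...   | inj₁ (j₀ , eq₀) = inj₁ (j₀ , ≡.trans eq eq₀)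
    ...   | inj₂ p          = inj₂ (inj₁ (subst (At t) (≡.sym eq) p))

  from-tree : ∀ {k} (t : Tree n) → Valid k t → Σ (ListDecomp n) λ D →
    (∀ {B} → At t B → ∃[ j ] ListDecomp.bags D j ≡ B) ×
    (∀ j → ListDecomp.bags D j ≡ [] ⊎ At t (ListDecomp.bags D j))
  from-tree t vt = result , at⁺ , λ j → Sum.map proj₂ id (at⁻ j)
    where
    open Attached (attach point zero t vt (λ _ _ ()))

to-subset : ∀ {n} → List (Fin n) → Subset n
to-subset []      = ⊥ₛ
to-subset (x ∷ l) = ⁅ x ⁆ ∪ₛ to-subset l

∈-subset⁺ : ∀ {n} {l : List (Fin n)} {v} → v ∈ l → v ∈ₛ to-subset l
∈-subset⁺ (here refl) = x∈p∪q⁺ (inj₁ (x∈⁅x⁆ _))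
∈-subset⁺ (there v∈)  = x∈p∪q⁺ (inj₂ (∈-subset⁺ v∈))

∈-subset⁻ : ∀ {n} (l : List (Fin n)) {v} → v ∈ₛ to-subset l → v ∈ l
∈-subset⁻ []      v∈ = ⊥-elim (∉⊥ v∈)
∈-subset⁻ (x ∷ l) v∈ with x∈p∪q⁻ ⁅ x ⁆ (to-subset l) v∈
... | inj₁ p = here (x∈⁅y⁆⇒x≡y x p)
... | inj₂ p = there (∈-subset⁻ l p)

subset-size : ∀ {n} (l : List (Fin n)) → ∣ to-subset l ∣ ≤ length l
subset-size l = subst (_≤ length l) (members-length (to-subset l))
  (unique-⊆-length (members-unique (to-subset l)) (∈-subset⁻ l ∘ ∈-members⁻ (to-subset l)))

subset-size⁻ : ∀ {n} (p : Subset n) {l : List (Fin n)} → Unique l → (∀ {v} → v ∈ l → v ∈ₛ p) → length l ≤ ∣ p ∣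
subset-size⁻ p U sub = subst (_ ≤_) (members-length p) (unique-⊆-length U (∈-members⁺ ∘ sub))

-- Matchings given by lists of pairs

module Matchings {n : ℕ} (G : Graph n) where

  covered⇒mate : ∀ {B} (M : MatchingIn G B) {u} → Covered M u → ∃[ w ] mate M u ≡ just w
  covered⇒mate M {u} c with mate M u
  ... | just w  = w , refl
  ... | nothing = ⊥-elim (c refl)

  matched-neighbour : ∀ {B} → Matched G B → ∀ {c} → c ∈ₛ B → ∃[ w ] (w ∈ₛ B × Edge G c w)
  matched-neighbour (inj₁ (M , cov)) {c} c∈ = let (w , eq) = covered⇒mate M (cov c c∈) in
    w , proj₂ (mate-in M c w eq) , mate-edge M c w eq
  matched-neighbour (inj₂ (M , v , _ , _ , cov , w , w∈ , _ , e)) {c} c∈ with c ≟ v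
  ... | yes refl = w , w∈ , e
  ... | no c≢v   = let (w , eq) = covered⇒mate M (cov c c∈ c≢v) in
    w , proj₂ (mate-in M c w eq) , mate-edge M c w eq

  Pairs : Set
  Pairs = List (Fin n × Fin n)

  flat : Pairs → List (Fin n)
  flat []             = []
  flat ((a , b) ∷ ps) = a ∷ b ∷ flat ps

  partner : Pairs → Fin n → Maybe (Fin n)
  partner []             u = nothing
  partner ((a , b) ∷ ps) u with u ≟ a | u ≟ b
  ... | yes _ | _     = just b
  ... | no _  | yes _ = just a
  ... | no _  | no _  = partner ps u

  partner-∈ : ∀ ps {u w} → partner ps u ≡ just w → u ∈ flat ps × w ∈ flat ps
  partner-∈ ((a , b) ∷ ps) {u} eq with u ≟ a | u ≟ b
  partner-∈ ((a , b) ∷ ps) refl | yes refl | _        = here refl , there (here refl)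
  partner-∈ ((a , b) ∷ ps) refl | no _     | yes refl = there (here refl) , here refl
  partner-∈ ((a , b) ∷ ps) eq   | no _     | no _     = let (p , q) = partner-∈ ps eq in there (there p) , there (there q)

  partner-edge : ∀ ps → All (λ (a , b) → Edge G a b) ps → ∀ {u w} → partner ps u ≡ just w → Edge G u w
  partner-edge ((a , b) ∷ ps) (e ∷ es) {u} eq with u ≟ a | u ≟ b
  partner-edge ((a , b) ∷ ps) (e ∷ es) refl | yes refl | _        = e
  partner-edge ((a , b) ∷ ps) (e ∷ es) refl | no _     | yes refl = edge-sym {G = G} e
  partner-edge ((a , b) ∷ ps) (e ∷ es) eq   | no _     | no _     = partner-edge ps es eq

  partner-fst : ∀ a b ps → partner ((a , b) ∷ ps) a ≡ just b
  partner-fst a b ps with a ≟ a | a ≟ b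
  ... | yes _ | _ = refl
  ... | no ¬p | _ = ⊥-elim (¬p refl)

  partner-snd : ∀ a b ps → a ≢ b → partner ((a , b) ∷ ps) b ≡ just a
  partner-snd a b ps a≢b with b ≟ a | b ≟ b
  ... | yes p | _     = ⊥-elim (a≢b (≡.sym p))
  ... | no _  | yes _ = refl
  ... | no _  | no ¬p = ⊥-elim (¬p refl)

  partner-rest : ∀ {a b} ps {w} → w ≢ a → w ≢ b → partner ((a , b) ∷ ps) w ≡ partner ps w
  partner-rest {a} {b} ps {w} w≢a w≢b with w ≟ a | w ≟ b
  ... | yes p | _     = ⊥-elim (w≢a p)
  ... | no _  | yes p = ⊥-elim (w≢b p)
  ... | no _  | no _  = refl

  partner-sym : ∀ ps → Unique (flat ps) → ∀ {u w} → partner ps u ≡ just w → partner ps w ≡ just u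
  partner-sym ((a , b) ∷ ps) ((a≢b ∷ a∉) ∷ b∉ ∷ U) {u} eq with u ≟ a | u ≟ b
  partner-sym ((a , b) ∷ ps) ((a≢b ∷ a∉) ∷ b∉ ∷ U) refl | yes refl | _        = partner-snd a b ps a≢b
  partner-sym ((a , b) ∷ ps) ((a≢b ∷ a∉) ∷ b∉ ∷ U) refl | no _     | yes refl = partner-fst a b ps
  partner-sym ((a , b) ∷ ps) ((a≢b ∷ a∉) ∷ b∉ ∷ U) eq   | no _     | no _     =
    let w∈ = proj₂ (partner-∈ ps eq) in
    ≡.trans (partner-rest ps (All.lookup a∉ w∈ ∘ ≡.sym) (All.lookup b∉ w∈ ∘ ≡.sym)) (partner-sym ps U eq)

  partner-covers : ∀ ps {u} → u ∈ flat ps → partner ps u ≢ nothing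
  partner-covers ((a , b) ∷ ps) {u} u∈ eq with u ≟ a | u ≟ b
  partner-covers ((a , b) ∷ ps) u∈ () | yes _ | _
  partner-covers ((a , b) ∷ ps) u∈ () | no _  | yes _
  partner-covers ((a , b) ∷ ps) (here p)          eq | no ¬p | no _  = ¬p p
  partner-covers ((a , b) ∷ ps) (there (here p))  eq | no _  | no ¬p = ¬p p
  partner-covers ((a , b) ∷ ps) (there (there p)) eq | no _  | no _  = partner-covers ps p eq

  partner-misses : ∀ ps {u} → u ∉ flat ps → partner ps u ≡ nothing
  partner-misses ps {u} u∉ with partner ps u in eq
  ... | nothing = refl
  ... | just w  = ⊥-elim (u∉ (proj₁ (partner-∈ ps eq)))

  pairs-matching : ∀ ps {B} → Unique (flat ps) → All (λ (a , b) → Edge G a b) ps →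
    (∀ {v} → v ∈ flat ps → v ∈ₛ B) → MatchingIn G B
  pairs-matching ps U es sub = record
    { mate = partner ps
    ; mate-in = λ u w eq → let (p , q) = partner-∈ ps eq in sub p , sub q
    ; mate-edge = λ u w → partner-edge ps es
    ; mate-sym = λ u w → partner-sym ps U
    }

  perfect : ∀ ps {l} → Unique (flat ps) → All (λ (a , b) → Edge G a b) ps →
    (∀ {v} → v ∈ flat ps → v ∈ l) → (∀ {v} → v ∈ l → v ∈ flat ps) → Matched G (to-subset l)
  perfect ps {l} U es sub sup = inj₁ (pairs-matching ps U es (∈-subset⁺ ∘ sub) ,
    λ u u∈ → partner-covers ps (sup (∈-subset⁻ l u∈)))

  near-perfect : ∀ {a b c l} → a ≢ b → c ≢ a → c ≢ b → a ∈ l → b ∈ l → c ∈ l →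
    (∀ {v} → v ∈ l → v ≢ c → v ∈ a ∷ b ∷ []) → Edge G a b → ∃[ w ] (w ∈ l × Edge G c w) → Matched G (to-subset l)
  near-perfect {a} {b} {c} {l} a≢b c≢a c≢b a∈ b∈ c∈ sup e (w , w∈ , f) =
    inj₂ (pairs-matching ps ((a≢b ∷ []) ∷ [] ∷ []) (e ∷ []) sub
      , c , ∈-subset⁺ c∈ , partner-misses ps (λ { (here p) → c≢a p ; (there (here p)) → c≢b p })
      , (λ u u∈ u≢c → partner-covers ps (sup (∈-subset⁻ l u∈) u≢c))
      -- Being adjacent to `c`, the vertex `w` differs from it and hence belongs to the matched
      -- pair.
      , w , ∈-subset⁺ w∈ , partner-covers ps (sup w∈ (edge⇒≢ {G = G} f ∘ ≡.sym)) , f)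
    where
    ps : Pairs
    ps = (a , b) ∷ []
    sub : ∀ {v} → v ∈ flat ps → v ∈ₛ to-subset l
    sub (here refl)         = ∈-subset⁺ a∈
    sub (there (here refl)) = ∈-subset⁺ b∈

-- Padding bags until all of them are matched

sum-strict : ∀ {A : Set} {f g : A → ℕ} (l : List A) → (∀ x → f x ≤ g x) →
  ∀ {i} → i ∈ l → f i < g i → sum (map f l) < sum (map g l)
sum-mono : ∀ {A : Set} {f g : A → ℕ} (l : List A) → (∀ x → f x ≤ g x) → sum (map f l) ≤ sum (map g l)
sum-mono []      h = z≤n
sum-mono (x ∷ l) h = +-mono-≤ (h x) (sum-mono l h)
sum-strict (x ∷ l) h (here refl) lt = +-mono-<-≤ lt (sum-mono l h)
sum-strict (x ∷ l) h (there i∈)  lt = +-mono-≤-< (h x) (sum-strict l h i∈ lt)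

module Padding {n : ℕ} (G : Graph n) (no-isolated : NoIsolated G)
  {size : ℕ} (shape : Graph size) (shape-tree : IsTree shape) where

  open Surgery G
  open Matchings G

  Busy : Fin n → Bag n → Set
  Busy c l = Any (E c) l

  busy? : ∀ c l → Dec (Busy c l)
  busy? c = Any.any? (edge? {G = G} c)

  -- Preserved by insertion. A bag of three has an edge or is matched, and a bag of four is matched,
  -- so vertices without a neighbour in their bag occur only in bags of at most three.
  data Inv (l : Bag n) : Set where
    small  : length l ≤ 2 → Inv l
    triple : length l ≡ 3 → ∀ {u w} → u ∈ l → w ∈ l → E u w → Inv l
    paired : length l ≤ 4 → Matched G (to-subset l) → Inv l

  record State : Set where
    field
      bags   : Fin size → Bag n
      unique : ∀ i → Unique (bags i)
      joined : ∀ v → ConnectedSet shape (λ i → v ∈ bags i)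
      covers : ∀ {u w} → Rel u w → ∃[ i ] (u ∈ bags i × w ∈ bags i)
      inv    : ∀ i → Inv (bags i)

  -- The total room left below the maximal bag size 4.
  potential : State → ℕ
  potential S = sum (map (λ i → 4 ∸ length (State.bags S i)) (allFin size))

  lonely-short : ∀ {l c} → Inv l → c ∈ l → ¬ Busy c l → length l ≤ 3
  lonely-short (small p)       _  _   = ≤-trans p (n≤1+n 2)
  lonely-short (triple p _ _ _) _ _   = ≤-reflexive p
  lonely-short {l} (paired _ M) c∈ ¬b =
    let (w , w∈ , e) = matched-neighbour M (∈-subset⁺ c∈) in ⊥-elim (¬b (lose (∈-subset⁻ l w∈) e))

  -- In a triple with an edge `uw`, the vertex `c` is off that edge, so `cd` and `uw` match all four
  -- vertices. A bag of two becomes a triple with the edge `cd`.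
  inv-cons : ∀ {l c d} → Inv l → c ∈ l → ¬ Busy c l → E c d → Inv (d ∷ l)
  inv-cons {x ∷ []} _ _ _ _ = small ≤-refl
  inv-cons {x ∷ y ∷ []} _ c∈ _ e = triple refl (there c∈) (here refl) e
  inv-cons {x ∷ y ∷ z ∷ _} (small (s≤s (s≤s ()))) _ _ _
  inv-cons {l@(x ∷ y ∷ z ∷ _)} {c} {d} (triple len {u} {w} u∈ w∈ f) c∈ ¬b e = paired (s≤s (≤-reflexive len))
    (perfect ((c , d) ∷ (u , w) ∷ []) U (e ∷ f ∷ []) sub sup)
    where
    c≢u : c ≢ u
    c≢u refl = ¬b (lose w∈ f)
    c≢w : c ≢ w
    c≢w refl = ¬b (lose u∈ (esym f))
    fresh : ∀ {v} → v ∈ l → d ≢ v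
    fresh v∈ refl = ¬b (lose v∈ e)
    u≢w : u ≢ w
    u≢w = edge⇒≢ {G = G} f
    U : Unique (c ∷ d ∷ u ∷ w ∷ [])
    U = (edge⇒≢ {G = G} e ∷ c≢u ∷ c≢w ∷ []) ∷ (fresh u∈ ∷ fresh w∈ ∷ []) ∷ (u≢w ∷ []) ∷ [] ∷ []
    sub : ∀ {v} → v ∈ c ∷ d ∷ u ∷ w ∷ [] → v ∈ d ∷ l
    sub (here refl) = there c∈
    sub (there (here refl)) = here refl
    sub (there (there (here refl))) = there u∈
    sub (there (there (there (here refl)))) = there w∈
    sup : ∀ {v} → v ∈ d ∷ l → v ∈ c ∷ d ∷ u ∷ w ∷ []
    sup (here refl) = there (here refl)
    sup (there v∈) with only (≤-reflexive len) c∈ u∈ w∈ c≢u u≢w (c≢w ∘ ≡.sym) v∈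
    ... | inj₁ refl        = here refl
    ... | inj₂ (inj₁ refl) = there (there (here refl))
    ... | inj₂ (inj₂ refl) = there (there (there (here refl)))
  inv-cons {l@(x ∷ y ∷ z ∷ _)} (paired _ M) c∈ ¬b _ =
    let (w , w∈ , e) = matched-neighbour M (∈-subset⁺ c∈) in ⊥-elim (¬b (lose (∈-subset⁻ l w∈) e))

  last-lonely : (bags : Fin size → Bag n) → ∀ {c i j} → PathIn shape (λ k → c ∈ bags k) i j →
    ¬ Busy c (bags i) → Busy c (bags j) →
    ∃[ i ] ∃[ j ] (c ∈ bags i × ¬ Busy c (bags i) × Edge shape i j × Busy c (bags j))
  last-lonely bags (here _) ¬b b = ⊥-elim (¬b b)
  last-lonely bags {c} (step {w = k} c∈ e r) ¬b b with busy? c (bags k)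
  ... | yes b′ = _ , k , c∈ , ¬b , e , b′
  ... | no ¬b′ = last-lonely bags r ¬b′ b

  module Insert (S : State) {i j : Fin size} {c d : Fin n} (c∈ : c ∈ State.bags S i)
    (lonely : ¬ Busy c (State.bags S i)) (ij : Edge shape i j) (d∈ : d ∈ State.bags S j) (cd : E c d) where

    open State S

    bags′ : Fin size → Bag n
    bags′ k with k ≟ i
    ... | yes _ = d ∷ bags i
    ... | no _  = bags k

    grown : ∀ {k v} → v ∈ bags k → v ∈ bags′ k
    grown {k} v∈ with k ≟ i
    ... | yes refl = there v∈
    ... | no _     = v∈

    new : d ∈ bags′ i
    new with i ≟ i
    ... | yes _ = here refl
    ... | no ¬p = ⊥-elim (¬p refl)

    ungrown : ∀ {k v} → v ∈ bags′ k → v ∈ bags k ⊎ (k ≡ i × v ≡ d)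
    ungrown {k} v∈ with k ≟ i
    ungrown (here p)   | yes eq   = inj₂ (eq , p)
    ungrown (there v∈) | yes refl = inj₁ v∈
    ungrown v∈         | no _     = inj₁ v∈

    -- The only new occurrence is that of `d` at node `i`, next to node `j`, whose bag contains `d`
    -- already.
    joined′ : ∀ v → ConnectedSet shape (λ k → v ∈ bags′ k)
    joined′ v x y x∈ y∈ =
      let (x₀ , x₀∈ , p) = to-old x x∈
          (y₀ , y₀∈ , q) = to-old y y∈
      in path-trans p (path-trans (path-map grown (joined v x₀ y₀ x₀∈ y₀∈)) (path-sym q))
      where
      to-old : ∀ x → v ∈ bags′ x → ∃[ x₀ ] (v ∈ bags x₀ × PathIn shape (λ k → v ∈ bags′ k) x x₀)
      to-old x x∈ with ungrown x∈
      ... | inj₁ x∈′           = x , x∈′ , here x∈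
      ... | inj₂ (refl , refl) = j , d∈ , step x∈ ij (here (grown d∈))

    inserted : State
    inserted = record
      { bags = bags′ ; unique = unique′ ; joined = joined′
      ; covers = λ r → let (k , u∈ , w∈) = covers r in k , grown u∈ , grown w∈
      ; inv = inv′ }
      where
      unique′ : ∀ k → Unique (bags′ k)
      unique′ k with k ≟ i
      ... | yes _ = ¬Any⇒All¬ _ (λ d∈′ → lonely (lose d∈′ cd)) ∷ unique i
      ... | no _  = unique k
      inv′ : ∀ k → Inv (bags′ k)
      inv′ k with k ≟ i
      ... | yes _ = inv-cons (inv i) c∈ lonely cd
      ... | no _  = inv k

    decreases : potential inserted < potential S
    decreases = sum-strict (allFin size) le (∈-allFin i) lt
      where
      le : ∀ k → 4 ∸ length (bags′ k) ≤ 4 ∸ length (bags k)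
      le k with k ≟ i
      ... | yes refl = ∸-monoʳ-≤ 4 (n≤1+n (length (bags k)))
      ... | no _     = ≤-refl
      lt : 4 ∸ length (bags′ i) < 4 ∸ length (bags i)
      lt with i ≟ i
      -- Truncated subtraction decreases strictly here because the bag still had at most three
      -- vertices.
      ... | yes _ = ∸-monoʳ-< ≤-refl (s≤s (lonely-short (inv i) c∈ lonely))
      ... | no ¬p = ⊥-elim (¬p refl)

  -- In a bag of three, `a` and a neighbour form the matched pair, and the remaining vertex finds
  -- its own neighbour within that pair.
  busy-matched : ∀ {l} → Unique l → Inv l → (∀ {c} → c ∈ l → Busy c l) → Matched G (to-subset l)
  busy-matched _ (paired _ M) _ = M
  busy-matched {[]} _ _ _ = perfect [] {l = []} [] [] id id
  busy-matched {a ∷ []} _ _ busy with busy (here refl)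
  ... | here e = ⊥-elim (edge-irrefl {G = G} e)
  busy-matched {a ∷ b ∷ []} U _ busy with busy (here refl)
  ... | here e         = ⊥-elim (edge-irrefl {G = G} e)
  ... | there (here e) = perfect ((a , b) ∷ []) U (e ∷ []) id id
  busy-matched {a ∷ b ∷ c ∷ []} ((a≢b ∷ a≢c ∷ []) ∷ (b≢c ∷ []) ∷ _) _ busy with busy (here refl)
  ... | here e         = ⊥-elim (edge-irrefl {G = G} e)
  ... | there (here e) = near-perfect a≢b (a≢c ∘ ≡.sym) (b≢c ∘ ≡.sym) (here refl) (there (here refl)) (there (there (here refl)))
      (λ { (here p) _ → here p ; (there (here p)) _ → there (here p) ; (there (there (here p))) ≢c → ⊥-elim (≢c p)
         ; (there (there (there ()))) _ })
      e (find (busy (there (there (here refl)))))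
  ... | there (there (here e)) = near-perfect a≢c (a≢b ∘ ≡.sym) b≢c (here refl) (there (there (here refl))) (there (here refl))
      (λ { (here p) _ → here p ; (there (here p)) ≢b → ⊥-elim (≢b p) ; (there (there (here p))) _ → there (here p)
         ; (there (there (there ()))) _ })
      e (find (busy (there (here refl))))
  busy-matched {_ ∷ _ ∷ _ ∷ _ ∷ _} _ (small (s≤s (s≤s ()))) _
  busy-matched {_ ∷ _ ∷ _ ∷ _ ∷ _} _ (triple () _ _ _) _

  inv-width : ∀ {l} → Inv l → length l ≤ 4
  inv-width (small p)        = ≤-trans p (s≤s (s≤s z≤n))
  inv-width (triple p _ _ _) = ≤-trans (≤-reflexive p) (n≤1+n 3)
  inv-width (paired p _)     = p

  pad-acc : (S : State) → Acc _<_ (potential S) → MtwAtMost G 3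
  pad-acc S (acc rs) with any? (λ i → Any.any? (λ c → ¬? (busy? c (State.bags S i))) (State.bags S i))
  ... | yes (i , some) =
    let (c , c∈ , ¬b)              = find some
        -- Some bag covers an edge at `c`, so the bags containing `c` lead from one where it is
        -- lonely to one where it is busy.
        (d , e)                    = no-isolated c
        (j , c∈j , d∈j)            = covers (inj₂ e)
        (i′ , j′ , c∈′ , ¬b′ , f , b) = last-lonely bags (joined c i j c∈ c∈j) ¬b (lose d∈j e)
        (d′ , d∈′ , e′)            = find b
    in pad-acc (Insert.inserted S c∈′ ¬b′ f d∈′ e′) (rs (Insert.decreases S c∈′ ¬b′ f d∈′ e′))
    where
    open State S
  ... | no none = record
      { m = size ; T = shape ; isTree = shape-tree
      ; bag = λ i → to-subset (bags i)
      ; edgeCov = λ u v e → let (i , u∈ , v∈) = covers (inj₂ e) in i , ∈-subset⁺ u∈ , ∈-subset⁺ v∈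
      ; vertexCov = λ v → let (i , v∈ , _) = covers (inj₁ refl) in i , ∈-subset⁺ v∈
      ; subtree = λ v i j p q → path-map ∈-subset⁺ (joined v i j (∈-subset⁻ (bags i) p) (∈-subset⁻ (bags j) q))
      }
      , (λ i → ≤-trans (subset-size (bags i)) (inv-width (inv i)))
      , (λ i → busy-matched (unique i) (inv i) (busy i))
    where
    open State S
    busy : ∀ i {c} → c ∈ bags i → Busy c (bags i)
    busy i {c} c∈ with busy? c (bags i)
    ... | yes b = b
    ... | no ¬b = ⊥-elim (none (i , lose c∈ ¬b))

  pad : State → MtwAtMost G 3
  pad S = pad-acc S (<-wellFounded (potential S))

-- Helly's theorem for vertex sets in a tree of bags

module Helly {n : ℕ} {A : Set} (⟦_⟧ : A → Fin n → Set) (⟦_⟧? : ∀ K u → Dec (⟦ K ⟧ u)) where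

  -- Consecutive vertices share a bag instead of an edge of `G`. Such chains survive restriction to
  -- one side of a join: an excursion to the other side is replaced by a step within the root bag.
  data Chain (t : Tree n) (K : A) : Fin n → Fin n → Set where
    stop : ∀ {u} → ⟦ K ⟧ u → Chain t K u u
    hop  : ∀ {u w v} → ⟦ K ⟧ u → Cov t u w → Chain t K w v → Chain t K u v

  Linking : Tree n → A → Set
  Linking t K = ∀ {u v} → ⟦ K ⟧ u → ⟦ K ⟧ v → V t u → V t v → Chain t K u v

  -- Expresses that the subtrees formed by the bags meeting `K` and by those meeting `L` intersect;
  -- the two vertices may differ.
  Touch : Tree n → A → A → Set
  Touch t K L = ∃[ u ] ∃[ w ] (⟦ K ⟧ u × ⟦ L ⟧ w × Cov t u w)

  Hits : Bag n → A → Set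
  Hits B K = ∃[ u ] (u ∈ B × ⟦ K ⟧ u)

  Meets : Tree n → A → Set
  Meets t K = ∃[ u ] (⟦ K ⟧ u × V t u)

  meets? : ∀ t K → Dec (Meets t K)
  meets? t K = any? λ u → ⟦ K ⟧? u ×-dec V? t u

  chain-map : ∀ {t t′ K} → (∀ {u w} → Cov t u w → Cov t′ u w) → ∀ {u v} → Chain t K u v → Chain t′ K u v
  chain-map f (stop k)    = stop k
  chain-map f (hop k c r) = hop k (f c) (chain-map f r)

  module _ {k : ℕ} {t s : Tree n} (valid : Valid k (join t s)) {K : A} where

    private
      at-t : ∀ {v} → V t v → V s v → v ∈ root t
      at-t x y = proj₁ (proj₂ (proj₂ valid) _ x y)

    -- z is the last vertex met in t, and x the current one, possibly inside s.
    restrict : ∀ {z x v} → ⟦ K ⟧ z → V t z → x ≡ z ⊎ (V s x × V s z) → V t v →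
      Chain (join t s) K x v → Chain t K z v
    restrict kz tz (inj₁ refl)      tv (stop _) = stop kz
    restrict kz tz (inj₂ (sx , sz)) tv (stop kx) =
      hop kz (root t , at-root t , at-t tz sz , at-t tv sx) (stop kx)
    restrict kz tz p tv (hop kx c r) with Cov-join⁻ c
    restrict kz tz (inj₁ refl) tv (hop kx c r) | inj₁ c′ =
      hop kz c′ (restrict (kw r) (covʳ c′) (inj₁ refl) tv r)
      where
      kw : ∀ {w v} → Chain (join t s) K w v → ⟦ K ⟧ w
      kw (stop k)    = k
      kw (hop k _ _) = k
    restrict kz tz (inj₂ (sx , sz)) tv (hop kx c r) | inj₁ c′ =
      hop kz (root t , at-root t , at-t tz sz , at-t (covˡ c′) sx)
        (hop kx c′ (restrict (kw r) (covʳ c′) (inj₁ refl) tv r))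
      where
      kw : ∀ {w v} → Chain (join t s) K w v → ⟦ K ⟧ w
      kw (stop k)    = k
      kw (hop k _ _) = k
    restrict kz tz (inj₁ refl)     tv (hop kx c r) | inj₂ c′ = restrict kz tz (inj₂ (covʳ c′ , covˡ c′)) tv r
    restrict kz tz (inj₂ (_ , sz)) tv (hop kx c r) | inj₂ c′ = restrict kz tz (inj₂ (covʳ c′ , sz)) tv r

    crossing : ∀ {u v} → V s u → V t v → Chain (join t s) K u v → ∃[ z ] (⟦ K ⟧ z × z ∈ root t)
    crossing su tv (stop k) = _ , k , at-t tv su
    crossing {u} su tv (hop k c r) with V? t u
    ... | yes tu = u , k , at-t tu su
    ... | no ¬tu with Cov-join⁻ c
    ...   | inj₁ c′ = ⊥-elim (¬tu (covˡ c′))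
    ...   | inj₂ c′ = crossing (covʳ c′) tv r

    at-root-t : Meets t K → Linking (join t s) K → ∀ {u} → ⟦ K ⟧ u → V s u → ∃[ z ] (⟦ K ⟧ z × z ∈ root t)
    at-root-t (v , kv , tv) linking ku su = crossing su tv (linking ku kv (V-joinʳ su) (V-joinˡ tv))

  -- If the common bag lies in `s`, both sets reach from there into `t`, so both meet the root bag
  -- of `t`.
  touch-restrict : ∀ {k t s} → Valid k (join t s) → ∀ {K L} → Meets t K → Meets t L →
    Linking (join t s) K → Linking (join t s) L → Touch (join t s) K L → Touch t K L
  touch-restrict {t = t} v mk ml lk ll (u , w , ku , lw , c) with Cov-join⁻ c
  ... | inj₁ c′ = u , w , ku , lw , c′
  ... | inj₂ c′ =
    let (x , kx , x∈) = at-root-t v mk lk ku (covˡ c′)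
        (y , ly , y∈) = at-root-t v ml ll lw (covʳ c′)
    in x , y , kx , ly , root t , at-root t , x∈ , y∈

  -- Either all sets meet `t`, and the family restricts to `t`; or some set avoids `t`, and since
  -- every set touches it, they all meet `s` and the family restricts there.
  helly : ∀ {k} t → Valid k t → (F : List A) → (∀ {K} → K ∈ F → Linking t K) →
    (∀ {K L} → K ∈ F → L ∈ F → Touch t K L) → ∃[ B ] (At t B × (∀ {K} → K ∈ F → Hits B K))
  helly (leaf B) _ F _ touch = B , refl , λ K∈ → hits (touch K∈ K∈)
    where
    hits : ∀ {K} → Touch (leaf B) K K → Hits B K
    hits (u , _ , ku , _ , _ , refl , u∈ , _) = u , u∈ , ku
  helly (join t s) v@(vt , vs , adh) F linking touch with All.all? (meets? t) F
  ... | yes all =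
    let (B , p , hits) = helly t vt F
          (λ K∈ ku kv tu tv → restrict v ku tu (inj₁ refl) tv (linking K∈ ku kv (V-joinˡ tu) (V-joinˡ tv)))
          (λ K∈ L∈ → touch-restrict v (All.lookup all K∈) (All.lookup all L∈) (linking K∈) (linking L∈) (touch K∈ L∈))
    in B , inj₁ p , hits
  ... | no ¬all with find (¬All⇒Any¬ (meets? t) F ¬all)
  ...   | K₀ , K₀∈ , ¬meets =
    let (B , p , hits) = helly s vs F
          (λ K∈ ku kv su sv → restrict v′ ku su (inj₁ refl) sv (linking′ K∈ ku kv (V-joinˡ su) (V-joinˡ sv)))
          (λ K∈ L∈ → touch-restrict v′ (meets K∈) (meets L∈) (linking′ K∈) (linking′ L∈) (touch′ K∈ L∈))
    in B , inj₂ p , hits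
    where
    v′ : Valid _ (join s t)
    v′ = vs , vt , λ x sx tx → let (p , q) = adh x tx sx in q , p
    flip-cov : ∀ {u w} → Cov (join t s) u w → Cov (join s t) u w
    flip-cov = [ Cov-joinʳ , Cov-joinˡ ]′ ∘ Cov-join⁻
    linking′ : ∀ {K} → K ∈ F → Linking (join s t) K
    linking′ K∈ ku kv u∈ v∈ = chain-map flip-cov (linking K∈ ku kv (flip-V u∈) (flip-V v∈))
      where
      flip-V : ∀ {u} → V (join s t) u → V (join t s) u
      flip-V = [ V-joinʳ , V-joinˡ ]′ ∘ V-join⁻
    touch′ : ∀ {K L} → K ∈ F → L ∈ F → Touch (join s t) K L
    touch′ K∈ L∈ = let (u , w , ku , lw , c) = touch K∈ L∈ in u , w , ku , lw , flip-cov c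
    meets : ∀ {K} → K ∈ F → Meets s K
    meets K∈ with touch K∈ K₀∈
    ... | u , w , ku , kw , c with Cov-join⁻ c
    ...   | inj₁ c′ = ⊥-elim (¬meets (w , kw , covʳ c′))
    ...   | inj₂ c′ = u , ku , covˡ c′

-- Independent vertices in matched bags

module Independence {n : ℕ} (G : Graph n) where

  open Matchings G

  -- The mates of `u` and `v` are distinct, and by independence they differ from all three vertices,
  -- which makes five members.
  two-covered : ∀ {B} → ∣ B ∣ ≤ 4 → (M : MatchingIn G B) → ∀ {u v w} → u ∈ₛ B → v ∈ₛ B → w ∈ₛ B →
    u ≢ v → v ≢ w → w ≢ u → ¬ Edge G u v → ¬ Edge G v w → ¬ Edge G w u → Covered M u → Covered M v → ⊥
  two-covered {B} size M {u} {v} {w} u∈ v∈ w∈ u≢v v≢w w≢u ¬uv ¬vw ¬wu cu cv =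
    <-irrefl refl (≤-trans (subset-size⁻ B U sub) size)
    where
    u′ v′ : Fin n
    u′ = proj₁ (covered⇒mate M cu)
    v′ = proj₁ (covered⇒mate M cv)
    eu : mate M u ≡ just u′
    eu = proj₂ (covered⇒mate M cu)
    ev : mate M v ≡ just v′
    ev = proj₂ (covered⇒mate M cv)
    uu′ : Edge G u u′
    uu′ = mate-edge M u u′ eu
    vv′ : Edge G v v′
    vv′ = mate-edge M v v′ ev
    u′≢v′ : u′ ≢ v′
    u′≢v′ eq = u≢v (just-injective (≡.trans (≡.sym (mate-sym M u u′ eu))
      (≡.trans (cong (mate M) eq) (mate-sym M v v′ ev))))
    U : Unique (u ∷ v ∷ w ∷ u′ ∷ v′ ∷ [])
    U = (u≢v ∷ (w≢u ∘ ≡.sym) ∷ edge⇒≢ {G = G} uu′ ∷ (λ { refl → ¬uv (edge-sym {G = G} vv′) }) ∷ [])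
      ∷ (v≢w ∷ (λ { refl → ¬uv uu′ }) ∷ edge⇒≢ {G = G} vv′ ∷ [])
      ∷ ((λ { refl → ¬wu (edge-sym {G = G} uu′) }) ∷ (λ { refl → ¬vw vv′ }) ∷ [])
      ∷ (u′≢v′ ∷ []) ∷ [] ∷ []
    sub : ∀ {x} → x ∈ u ∷ v ∷ w ∷ u′ ∷ v′ ∷ [] → x ∈ₛ B
    sub (here refl) = u∈
    sub (there (here refl)) = v∈
    sub (there (there (here refl))) = w∈
    sub (there (there (there (here refl)))) = proj₂ (mate-in M u u′ eu)
    sub (there (there (there (there (here refl))))) = proj₂ (mate-in M v v′ ev)

  -- At most one vertex of the bag is unmatched, so two of the three are covered; the triple is
  -- rotated to put those first.
  no-independent : ∀ {B} → ∣ B ∣ ≤ 4 → Matched G B → ∀ {u v w} → u ∈ₛ B → v ∈ₛ B → w ∈ₛ B →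
    u ≢ v → v ≢ w → w ≢ u → ¬ Edge G u v → ¬ Edge G v w → ¬ Edge G w u → ⊥
  no-independent size (inj₁ (M , cov)) u∈ v∈ w∈ u≢v v≢w w≢u ¬uv ¬vw ¬wu =
    two-covered size M u∈ v∈ w∈ u≢v v≢w w≢u ¬uv ¬vw ¬wu (cov _ u∈) (cov _ v∈)
  no-independent size (inj₂ (M , x , _ , _ , cov , _)) {u} {v} {w} u∈ v∈ w∈ u≢v v≢w w≢u ¬uv ¬vw ¬wu
    with u ≟ x | v ≟ x
  ... | no u≢x   | no v≢x   = two-covered size M u∈ v∈ w∈ u≢v v≢w w≢u ¬uv ¬vw ¬wu (cov u u∈ u≢x) (cov v v∈ v≢x)
  ... | yes refl | _        = two-covered size M v∈ w∈ u∈ v≢w w≢u u≢v ¬vw ¬wu ¬uv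
                                (cov v v∈ (u≢v ∘ ≡.sym)) (cov w w∈ w≢u)
  ... | no u≢x   | yes refl = two-covered size M w∈ u∈ v∈ w≢u u≢v v≢w ¬wu ¬uv ¬vw
                                (cov w w∈ (v≢w ∘ ≡.sym)) (cov u u∈ u≢x)

-- X as an induced minor excludes matched decompositions of width 3

Apart : Fin 9 → Fin 9 → Set
Apart x y = x ≢ y × ¬ Edge X x y

apart? : ∀ x y → Dec (Apart x y)
apart? x y = ¬? (x ≟ y) ×-dec ¬? (edge? {G = X} x y)

-- The inner part of a route from hub i to hub (next i) through the third hub.
detour : Fin 3 → List (Fin 9)
detour i = side (next (next i)) false ∷ hub (next (next i)) ∷ side (next i) false ∷ []

-- Each of the three routes occurs once with either hub. A bag hitting both versions hits the route
-- or both hubs. The sets are pairwise close because every route is adjacent to both hubs.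
family : Fin 3 → List (List (Fin 9))
family i = (hub i ∷ side i false ∷ []) ∷ (hub (next i) ∷ side i false ∷ [])
  ∷ (hub i ∷ side i true ∷ []) ∷ (hub (next i) ∷ side i true ∷ [])
  ∷ (hub i ∷ detour i) ∷ (detour i ++ hub (next i) ∷ []) ∷ []

Close : List (Fin 9) → List (Fin 9) → Set
Close l l′ = Any (λ x → Any (λ y → x ≡ y ⊎ Edge X x y) l′) l

abstract
  family-linked : ∀ i → All (Linked (Edge X)) (family i)
  family-linked = from-yes (all? λ i → All.all? (linked? (edge? {G = X})) (family i))

  family-close : ∀ i → All (λ l → All (Close l) (family i)) (family i)
  family-close = from-yes (all? λ i → All.all? (λ l → All.all? (λ l′ →
    Any.any? (λ x → Any.any? (λ y → (x ≟ y) ⊎-dec edge? {G = X} x y) l′) l) (family i)) (family i))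

  sides-apart : ∀ i → Apart (side i false) (side i true) ×
    All (λ x → Apart (side i true) x × Apart x (side i false)) (detour i)
  sides-apart = from-yes (all? λ i → apart? (side i false) (side i true) ×-dec
    All.all? (λ x → apart? (side i true) x ×-dec apart? x (side i false)) (detour i))

  hubs-apart : ∀ i → Apart (hub i) (hub (next i))
  hubs-apart = from-yes (all? λ i → apart? (hub i) (hub (next i)))

module Obstruction {n : ℕ} (G : Graph n) (D : TreeDecomp G) (width : WidthAtMost D 3)
  (matched : ∀ i → Matched G (bag D i)) (minor : InducedMinor X G) where

  open Independence G

  private
    φ : Fin n → Maybe (Fin 9)
    φ = proj₁ minor
    fibre : ∀ x → ∃[ u ] φ u ≡ just x
    fibre = proj₁ (proj₂ minor)
    fibre-conn : ∀ x → ConnectedSet G (λ u → φ u ≡ just x)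
    fibre-conn = proj₁ (proj₂ (proj₂ minor))
    edge-conv = proj₂ (proj₂ (proj₂ minor))
    tree = to-tree D width
    t : Tree n
    t = proj₁ tree
    valid : Valid 4 t
    valid = proj₁ (proj₂ tree)
    at⁺ = proj₁ (proj₂ (proj₂ tree))
    at⁻ = proj₂ (proj₂ (proj₂ tree))

  edge⇒cov : ∀ {u w} → Edge G u w → Cov t u w
  edge⇒cov {u} {w} e = let (i , u∈ , w∈) = edgeCov D u w e in _ , at⁺ i , ∈-members⁺ u∈ , ∈-members⁺ w∈

  vertex⇒cov : ∀ u → Cov t u u
  vertex⇒cov u = let (i , u∈) = vertexCov D u in _ , at⁺ i , ∈-members⁺ u∈ , ∈-members⁺ u∈

  ⟦_⟧ : List (Fin 9) → Fin n → Set
  ⟦ l ⟧ u = Any (λ x → φ u ≡ just x) l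

  ⟦_⟧? : ∀ l u → Dec (⟦ l ⟧ u)
  ⟦ l ⟧? u = Any.any? (λ x → ≡-dec _≟_ (φ u) (just x)) l

  open Helly ⟦_⟧ ⟦_⟧?

  to-head : ∀ x l → Linked (Edge X) (x ∷ l) → ∀ {u} → ⟦ x ∷ l ⟧ u →
    ∃[ v ] (φ v ≡ just x × PathIn G ⟦ x ∷ l ⟧ u v)
  to-head x l _ {u} (here p) = u , p , here (here p)
  to-head x (y ∷ l) (e ∷ L) (there q) =
    let (v , φv , r)           = to-head y l L q
        (w , w′ , φw , φw′ , f) = proj₁ (edge-conv x y (edge⇒≢ {G = X} {x} {y} e)) e
    in w , φw , path-trans (path-map there (path-trans r (path-map here (fibre-conn y v w′ φv φw′))))
         (step (there (here φw′)) (edge-sym {G = G} f) (here (here φw)))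

  linked⇒connected : ∀ l → Linked (Edge X) l → ConnectedSet G ⟦ l ⟧
  linked⇒connected (x ∷ l) L u v u∈ v∈ =
    let (u′ , φu′ , p) = to-head x l L u∈
        (v′ , φv′ , q) = to-head x l L v∈
    in path-trans p (path-trans (path-map here (fibre-conn x u′ v′ φu′ φv′)) (path-sym q))

  path⇒chain : ∀ {l u v} → PathIn G ⟦ l ⟧ u v → Chain t l u v
  path⇒chain (here p)     = stop p
  path⇒chain (step p e r) = hop p (edge⇒cov e) (path⇒chain r)

  linking : ∀ {l} → Linked (Edge X) l → Linking t l
  linking {l} L u∈ v∈ _ _ = path⇒chain (linked⇒connected l L _ _ u∈ v∈)

  fibre-touch : ∀ {x y} → x ≡ y ⊎ Edge X x y → ∃[ u ] ∃[ w ] (φ u ≡ just x × φ w ≡ just y × Cov t u w)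
  fibre-touch {x} (inj₁ refl) = let (u , φu) = fibre x in u , u , φu , φu , vertex⇒cov u
  fibre-touch {x} {y} (inj₂ e) =
    let (u , w , φu , φw , f) = proj₁ (edge-conv x y (edge⇒≢ {G = X} {x} {y} e)) e in u , w , φu , φw , edge⇒cov f

  close⇒touch : ∀ {l l′} → Close l l′ → Touch t l l′
  close⇒touch c =
    let (x , x∈ , c′)           = find c
        (y , y∈ , r)            = find c′
        (u , w , φu , φw , cov) = fibre-touch r
    in u , w , lose x∈ φu , lose y∈ φw , cov

  Sees : Bag n → Fin 9 → Set
  Sees B x = ∃[ u ] (u ∈ B × φ u ≡ just x)

  apart-fibres : ∀ {x y u w} → Apart x y → φ u ≡ just x → φ w ≡ just y → u ≢ w × ¬ Edge G u w
  apart-fibres {x} {y} (x≢y , ¬e) φu φw =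
    (λ { refl → x≢y (just-injective (≡.trans (≡.sym φu) φw)) }) ,
    λ e → ¬e (proj₂ (edge-conv x y x≢y) (_ , _ , φu , φw , e))

  three-apart : ∀ {B x y z} → At t B → Apart x y → Apart y z → Apart z x → Sees B x → Sees B y → Sees B z → ⊥
  three-apart {B} p xy yz zx (u , u∈ , φu) (v , v∈ , φv) (w , w∈ , φw) with at⁻ p
  ... | i , refl =
    let (a , a′) = apart-fibres xy φu φv
        (b , b′) = apart-fibres yz φv φw
        (c , c′) = apart-fibres zx φw φu
    in no-independent (width i) (matched i) (∈-members⁻ _ u∈) (∈-members⁻ _ v∈) (∈-members⁻ _ w∈) a b c a′ b′ c′

  hubs-meet : ∀ i → Touch t (hub i ∷ []) (hub (next i) ∷ [])
  hubs-meet i with helly t valid (family i) (λ K∈ → linking (All.lookup (family-linked i) K∈))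
                     (λ K∈ L∈ → close⇒touch (All.lookup (All.lookup (family-close i) K∈) L∈))
  ... | B , p , hits = decide (choose (hits (here refl)) (hits (there (here refl))))
                              (choose (hits (there (there (here refl)))) (hits (there (there (there (here refl))))))
                              (choose′ (hits (there (there (there (there (here refl))))))
                                       (hits (there (there (there (there (there (here refl))))))))
    where
    Both : Set
    Both = Sees B (hub i) × Sees B (hub (next i))
    choose : ∀ {x} → Hits B (hub i ∷ x ∷ []) → Hits B (hub (next i) ∷ x ∷ []) → Both ⊎ Sees B x
    choose (u , u∈ , here p)         (w , w∈ , here q)         = inj₁ ((u , u∈ , p) , (w , w∈ , q))
    choose (u , u∈ , there (here p)) _                         = inj₂ (u , u∈ , p)
    choose _                         (w , w∈ , there (here q)) = inj₂ (w , w∈ , q)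
    choose′ : Hits B (hub i ∷ detour i) → Hits B (detour i ++ hub (next i) ∷ []) → Both ⊎ Hits B (detour i)
    choose′ (u , u∈ , there p) _ = inj₂ (u , u∈ , p)
    choose′ (u , u∈ , here p) (w , w∈ , q) with ++⁻ (detour i) q
    ... | inj₁ q′       = inj₂ (w , w∈ , q′)
    ... | inj₂ (here q′) = inj₁ ((u , u∈ , p) , (w , w∈ , q′))
    both : Both → Touch t (hub i ∷ []) (hub (next i) ∷ [])
    both ((u , u∈ , φu) , (w , w∈ , φw)) = u , w , here φu , here φw , B , p , u∈ , w∈
    decide : Both ⊎ Sees B (side i false) → Both ⊎ Sees B (side i true) → Both ⊎ Hits B (detour i) →
      Touch t (hub i ∷ []) (hub (next i) ∷ [])
    decide (inj₁ b) _ _ = both b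
    decide _ (inj₁ b) _ = both b
    decide _ _ (inj₁ b) = both b
    decide (inj₂ s) (inj₂ s′) (inj₂ (w , w∈ , q)) =
      let (x , x∈ , φw) = find q
          (a , as)      = sides-apart i
          (b , c)       = All.lookup as x∈
      in ⊥-elim (three-apart p a b c s s′ (w , w∈ , φw))

  touch-sym : ∀ {l l′} → Touch t l l′ → Touch t l′ l
  touch-sym (u , w , p , q , B , at , u∈ , w∈) = w , u , q , p , B , at , w∈ , u∈

  hubs-touch : ∀ i j → Touch t (hub i ∷ []) (hub j ∷ [])
  hubs-touch 0F 0F = close⇒touch (here (here (inj₁ refl)))
  hubs-touch 0F 1F = hubs-meet 0F
  hubs-touch 0F 2F = touch-sym (hubs-meet 2F)
  hubs-touch 1F 0F = touch-sym (hubs-meet 0F)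
  hubs-touch 1F 1F = close⇒touch (here (here (inj₁ refl)))
  hubs-touch 1F 2F = hubs-meet 1F
  hubs-touch 2F 0F = hubs-meet 2F
  hubs-touch 2F 1F = touch-sym (hubs-meet 1F)
  hubs-touch 2F 2F = close⇒touch (here (here (inj₁ refl)))

  hub-set : Fin 3 → List (Fin 9)
  hub-set i = hub i ∷ []

  contradiction : ⊥
  contradiction with helly t valid (map hub-set (allFin 3)) link touch
    where
    link : ∀ {K} → K ∈ map hub-set (allFin 3) → Linking t K
    link K∈ with ∈-map⁻ hub-set {xs = allFin 3} K∈
    ... | _ , _ , refl = linking [-]
    touch : ∀ {K L} → K ∈ map hub-set (allFin 3) → L ∈ map hub-set (allFin 3) → Touch t K L
    touch K∈ L∈ with ∈-map⁻ hub-set {xs = allFin 3} K∈ | ∈-map⁻ hub-set {xs = allFin 3} L∈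
    ... | i , _ , refl | j , _ , refl = hubs-touch i j
  ... | B , p , hits = three-apart p (hubs-apart 0F) (hubs-apart 1F) (hubs-apart 2F) (sees 0F) (sees 1F) (sees 2F)
    where
    sees : ∀ i → Sees B (hub i)
    sees i with hits (∈-map⁺ hub-set (∈-allFin i))
    ... | u , u∈ , here φu = u , u∈ , φu

-- Combining elimination and padding

module Construction {n : ℕ} (G : Graph n) (no-isolated : NoIsolated G) (no-X : ¬ InducedMinor X G) where

  open Surgery G
  open Elimination G no-X

  zeros-at : ∀ t {B} → zeros t ≡ 0 → At t B → bad B ≡ 0
  zeros-at (leaf B)   z refl     = z
  zeros-at (join t s) z (inj₁ p) = zeros-at t (m+n≡0⇒m≡0 (zeros t) z) p
  zeros-at (join t s) z (inj₂ p) = zeros-at s (m+n≡0⇒n≡0 (zeros t) z) p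

  module _ {size : ℕ} {shape : Graph size} {shape-tree : IsTree shape} where

    open Padding G no-isolated shape shape-tree

    invariant : ∀ B → length B ≤ 3 → bad B ≡ 0 → Inv B
    invariant []           _ _ = small z≤n
    invariant (_ ∷ [])     _ _ = small (s≤s z≤n)
    invariant (_ ∷ _ ∷ []) _ _ = small ≤-refl
    invariant (a ∷ b ∷ c ∷ []) _ z with adj G a b in ab | adj G b c in bc | adj G c a in ca
    ... | true  | _     | _     = triple refl (here refl) (there (here refl)) ab
    ... | false | true  | _     = triple refl (there (here refl)) (there (there (here refl))) bc
    ... | false | false | true  = triple refl (there (there (here refl))) (here refl) ca
    invariant (a ∷ b ∷ c ∷ []) _ () | false | false | false
    invariant (_ ∷ _ ∷ _ ∷ _ ∷ _) (s≤s (s≤s (s≤s ()))) _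

  construct : TwAtMost G 2 → MtwAtMost G 3
  construct (D , width) = pad record
    { bags = bags
    ; unique = λ i → [ (λ eq → subst Unique (≡.sym eq) []) , proj₁ ∘ valid-at t′ valid′ ]′ (back i)
    ; joined = joined
    ; covers = λ r → let (B , p , u∈ , w∈) = covers′ r ; (i , eq) = forth p in
        i , subst (_ ∈_) (≡.sym eq) u∈ , subst (_ ∈_) (≡.sym eq) w∈
    ; inv = λ i → [ (λ eq → subst Inv (≡.sym eq) (small z≤n))
                  , (λ p → invariant (bags i) (proj₂ (valid-at t′ valid′ p)) (zeros-at t′ zero′ p)) ]′ (back i)
    }
    where
    tree₀ = to-tree D width
    t₀ : Tree n
    t₀ = proj₁ tree₀
    covers₀ : Covers t₀
    covers₀ {u} (inj₁ refl) = let (i , u∈) = vertexCov D u in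
      _ , proj₁ (proj₂ (proj₂ tree₀)) i , ∈-members⁺ u∈ , ∈-members⁺ u∈
    covers₀ {u} {w} (inj₂ e) = let (i , u∈ , w∈) = edgeCov D u w e in
      _ , proj₁ (proj₂ (proj₂ tree₀)) i , ∈-members⁺ u∈ , ∈-members⁺ w∈
    result = eliminate t₀ (<-wellFounded (zeros t₀)) (proj₁ (proj₂ tree₀)) covers₀
    t′ : Tree n
    t′ = proj₁ result
    valid′ : Valid 3 t′
    valid′ = proj₁ (proj₂ result)
    covers′ : Covers t′
    covers′ = proj₁ (proj₂ (proj₂ result))
    zero′ : zeros t′ ≡ 0
    zero′ = proj₂ (proj₂ (proj₂ result))
    decomp = from-tree t′ valid′
    open ListDecomp (proj₁ decomp)
    forth = proj₁ (proj₂ decomp)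
    back = proj₂ (proj₂ decomp)
    open Padding G no-isolated shape tree

theorem9 : (n : ℕ) (G : Graph n) → NoIsolated G → TwAtMost G 2 →
    ((¬ InducedMinor X G → MtwAtMost G 3) × (MtwAtMost G 3 → ¬ InducedMinor X G))
theorem9 n G no-isolated tw =
  (λ no-X → Construction.construct G no-isolated no-X tw) ,
  (λ (D , width , matched) minor → Obstruction.contradiction G D width matched minor)
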